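{- Let $L$ be a valid lattice and $K$ a Kasteleyn matrix for $\mathbb{T}_L$. Let $\varphi\in\mathscr{F}(L)$ and let $c_{ij}\,q_0^iq_1^j$ be the monomial in the full expansion of the Laurent polynomial $\det(K)$ that corresponds to $\varphi$. Then $|c_{ij}|$ is the number of tilings of $\mathbb{T}_L$ with flux $\varphi$.
   Context: Tilings: the unit square $[i,i+1]\times[j,j+1]$ ($i,j\in\mathbb{Z}$) is black if $i+j$ is even and white otherwise. A domino is the union of two unit squares sharing a side; a tiling of $\mathbb{Z}^2$ is a set of dominoes with pairwise disjoint interiors covering $\mathbb{R}^2$. Let $\mathscr{E}=2\mathbb{Z}^2$, $\mathscr{O}=2\mathbb{Z}^2+(1,1)$. A valid lattice is a subgroup $L\subset\mathbb{Z}^2$ generated by two linearly independent vectors in $\mathscr{E}\sqcup\mathscr{O}$. A tiling of $\mathbb{T}_L=\mathbb{R}^2/L$ is identified with an $L$-periodic tiling of $\mathbb{Z}^2$. Height functions and flux: each unit edge between neighboring points of $\mathbb{Z}^2$ is oriented so that the boundary of every black square is oriented clockwise. The height function $h_t:\mathbb{Z}^2\to\mathbb{Z}$ of a tiling $t$ satisfies $h_t(0)=0$ and, for every edge oriented from $u$ to $w$: $h_t(w)=h_t(u)+1$ if the edge is not the common side of the two squares of a domino of $t$, and $h_t(w)=h_t(u)-3$ otherwise. For a tiling $t$ of $\mathbb{T}_L$, the flux is the unique $\varphi_t\in\mathbb{R}^2$ with $4\langle\varphi_t,v\rangle=h_t(u+v)-h_t(u)$ for all $v\in L$, $u\in\mathbb{Z}^2$.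 $\mathscr{F}(L)$ is the set of fluxes of all tilings of $\mathbb{T}_L$. Kasteleyn matrix: let $x_0$ be the smallest positive integer with $v_0=(x_0,0)\in L$, $y_1$ the smallest positive integer such that $L$ contains a vector with second coordinate $y_1$, and $v_1=(x_1,y_1)$ the unique such vector in $L$ with $0\le x_1<x_0$; $\{v_0,v_1\}$ generates $L$. The rectangle $D_L=[0,x_0]\times[0,y_1]$ is a fundamental domain with equally many black and white squares; enumerate its black squares $b_1,\dots,b_m$ and its white squares $w_1,\dots,w_m$ (arbitrarily). Let $G(\mathbb{Z}^2)$ be the graph whose vertices are the centers of unit squares, with edges joining centers of squares sharing a side (edges correspond to dominoes). An edge has sign $-1$ if it is horizontal with black left endpoint and white right endpoint, and sign $+1$ otherwise. Let $u(0)$ be the straight lattice path from $(0,0)$ to $v_0$ and $u(1)$ the lattice path $(0,0)\to(0,y_1)\to(x_1,y_1)$. To each $L$-orbit $[e]_L$ of edges of $G(\mathbb{Z}^2)$ assign the weight: its sign, multiplied for each $k\in\{0,1\}$ by $q_k$ if some edge in $[e]_L$ crosses $u(k)$ with its black endpoint to the left of the oriented path $u(k)$ (equivalently, a domino at that place produces a height change $+3$ along $u(k)$), by $q_k^{ -1}$ if some edge in $[e]_L$ crosses $u(k)$ with its black endpoint to the right (height change $-3$), and by $1$ if no edge of $[e]_L$ crosses $u(k)$. The entry $K(i,j)$ is the sum of the weights of the $L$-orbits of edges joining a translate of $b_i$ to a translate of $w_j$ by elements of $L$ (0 if there are none). Thus $\det K$ is a Laurent polynomial in $q_0,q_1$.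 Correspondence: the monomial corresponding to $\varphi\in\mathscr{F}(L)$ is $q_0^iq_1^j$ with $i=\langle\varphi,v_0\rangle$, and $j=\langle\varphi,v_1\rangle$ if $v_1\in\mathscr{E}$, $j=\langle\varphi,v_1\rangle-\frac12$ if $v_1\in\mathscr{O}$. -}

module Defs where

open import Level using (0ℓ; suc)
open import Algebra.Bundles using (RawRing)
import Algebra.Definitions.RawSemiring as RawSemiringDefs
open import Data.Fin.Base as Fin using (Fin)
import Data.Fin.Properties as Fin
open import Data.Fin.Permutation as Perm using (Permutation′; _⟨$⟩ʳ_)
open import Data.Integer.Base as ℤ
  using (ℤ; +_; 0ℤ; 1ℤ; -1ℤ; _+_; _-_; _*_; -_; NonZero; ≢-nonZero)
open import Data.Integer.Divisibility.Signed using (_∣_; divides; _∣?_)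
import Data.Integer.Properties as ℤ
open import Data.Integer.Tactic.RingSolver using (solve-∀)
open import Data.List.Base as List using (List; []; _∷_; _++_; map; upTo; allFin)
open import Data.List.Relation.Unary.Any using (any?)
open import Data.Nat.Base as ℕ using (ℕ; _≤_; _<_)
open import Data.Product.Base using (_×_; _,_; proj₁; proj₂; Σ-syntax; ∃₂; ∃-syntax)
open import Data.Product.Properties using (≡-dec)
open import Data.Rational.Base as ℚ using (ℚ; ½)
open import Data.Sum.Base using (_⊎_)
open import Function.Base using (_∘_; _on_)
open import Function.Bundles using (Inverse)
open import Function.Definitions using (Injective)
open import Relation.Binary.Bundles using (Setoid)
import Relation.Binary.Construct.On as On
open import Relation.Binary.PropositionalEquality
  using (_≡_; refl; sym; trans; cong; cong₂; setoid)
open import Relation.Nullary using (Dec; yes; no; does; ¬_; contradiction; _×-dec_; map′)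
open import Relation.Nullary.Decidable using (¬?)
open import Relation.Unary using (Pred; Decidable; _∈_; _≐_)
open import Relation.Unary.Relation.Binary.Equality using (≐-isEquivalence)
open import Data.Bool.Base using (if_then_else_)

ℤ² : Set
ℤ² = ℤ × ℤ

infixl 6 _+ᵛ_ _-ᵛ_
infixl 7 _·ᵛ_

_+ᵛ_ _-ᵛ_ : ℤ² → ℤ² → ℤ²
(a , b) +ᵛ (c , d) = a + c , b + d
(a , b) -ᵛ (c , d) = a - c , b - d

_·ᵛ_ : ℤ → ℤ² → ℤ²
k ·ᵛ (a , b) = k * a , k * b

0ᵛ : ℤ²
0ᵛ = 0ℤ , 0ℤ

data Axis : Set where
  hor ver : Axis

_≟ᵃ_ : (a b : Axis) → Dec (a ≡ b)
hor ≟ᵃ hor = yes refl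
hor ≟ᵃ ver = no λ ()
ver ≟ᵃ hor = no λ ()
ver ≟ᵃ ver = yes refl

unit : Axis → ℤ²
unit hor = 1ℤ , 0ℤ
unit ver = 0ℤ , 1ℤ

-- The unit square [i,i+1]×[j,j+1] is represented by its corner (i , j).
Square : Set
Square = ℤ²

Black White : Pred Square 0ℓ
Black (i , j) = + 2 ∣ i + j
White s = ¬ Black s

black? : Decidable Black
black? (i , j) = + 2 ∣? i + j

white? : Decidable White
white? = ¬? ∘ black?

-- The domino (s , a) is the union of the squares s and s +ᵛ unit a.  It is
-- also the edge of G(ℤ²) joining the centers of these squares.
Domino : Set
Domino = Square × Axis

infix 4 _∈ᵈ_

_∈ᵈ_ : Square → Domino → Set
s ∈ᵈ (r , a) = s ≡ r ⊎ s ≡ r +ᵛ unit a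

whiteEnd : Domino → Square
whiteEnd (s , a) = if does (black? s) then s +ᵛ unit a else s

dominoesAt : Square → List Domino
dominoesAt s = (s , hor) ∷ (s -ᵛ unit hor , hor) ∷ (s , ver) ∷ (s -ᵛ unit ver , ver) ∷ []

-- The edge (p , a) of the grid ℤ² joins p to p +ᵛ unit a.
GridEdge : Set
GridEdge = ℤ² × Axis

-- The squares on either side of an edge traversed from p to p +ᵛ unit a.
leftOf rightOf : GridEdge → Square
leftOf (p , hor) = p
leftOf (p , ver) = p -ᵛ unit hor
rightOf (p , hor) = p -ᵛ unit ver
rightOf (p , ver) = p

-- The domino formed by the two squares sharing a given edge.
crossing : GridEdge → Domino
crossing (p , hor) = p -ᵛ unit ver , ver
crossing (p , ver) = p -ᵛ unit hor , hor

-- Clockwise around a black square means keeping it on the right.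
tail head : GridEdge → ℤ²
tail e@(p , a) = if does (black? (rightOf e)) then p else p +ᵛ unit a
head e@(p , a) = if does (black? (rightOf e)) then p +ᵛ unit a else p

𝓔 𝓞 : Pred ℤ² 0ℓ
𝓔 (x , y) = + 2 ∣ x × + 2 ∣ y
𝓞 (x , y) = + 2 ∣ x - 1ℤ × + 2 ∣ y - 1ℤ

-- For integer vectors, linear independence over ℝ and over ℤ coincide.
record ValidLattice : Set where
  field
    g₁ g₂       : ℤ²
    g₁-valid    : g₁ ∈ 𝓔 ⊎ g₁ ∈ 𝓞
    g₂-valid    : g₂ ∈ 𝓔 ⊎ g₂ ∈ 𝓞
    independent : ∀ m n → m ·ᵛ g₁ +ᵛ n ·ᵛ g₂ ≡ 0ᵛ → m ≡ 0ℤ × n ≡ 0ℤ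

  Vectors : Pred ℤ² 0ℓ
  Vectors v = ∃₂ λ m n → v ≡ m ·ᵛ g₁ +ᵛ n ·ᵛ g₂

open ValidLattice using (Vectors)

infix 4 _∈ᴸ_ _∈ᴸ?_

_∈ᴸ_ : ℤ² → ValidLattice → Set
v ∈ᴸ L = v ∈ Vectors L

-- Membership in L is decided by Cramer's rule.
private
  _∧_ : ℤ² → ℤ² → ℤ
  (a , b) ∧ (c , d) = a * d - b * c

  ∧-nonZero : (L : ValidLattice) → let open ValidLattice L in ¬ g₁ ∧ g₂ ≡ 0ℤ
  ∧-nonZero L D≡0 = contradiction (proj₁ (independent 1ℤ 0ℤ vanish)) λ ()
    where
    open ValidLattice L
    a = proj₁ g₁
    b = proj₂ g₁
    c = proj₁ g₂
    d = proj₂ g₂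

    D′ : ∀ a b c d → d * a + (- b) * c ≡ a * d - b * c
    D′ = solve-∀

    D″ : ∀ a b c d → (- c) * b + a * d ≡ a * d - b * c
    D″ = solve-∀

    comm₁ : ∀ b d → d * b + (- b) * d ≡ 0ℤ
    comm₁ = solve-∀

    comm₂ : ∀ a c → (- c) * a + a * c ≡ 0ℤ
    comm₂ = solve-∀

    neg0 : ∀ {x} → - x ≡ 0ℤ → x ≡ 0ℤ
    neg0 {x} eq = trans (sym (ℤ.neg-involutive x)) (cong (-_) eq)

    b≡0 : b ≡ 0ℤ
    b≡0 = neg0 (proj₂ (independent d (- b)
            (cong₂ _,_ (trans (D′ a b c d) D≡0) (comm₁ b d))))

    a≡0 : a ≡ 0ℤ
    a≡0 = proj₂ (independent (- c) a
            (cong₂ _,_ (comm₂ a c) (trans (D″ a b c d) D≡0)))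

    vanish : 1ℤ ·ᵛ g₁ +ᵛ 0ℤ ·ᵛ g₂ ≡ 0ᵛ
    vanish = cong₂ _,_ (cong (λ x → 1ℤ * x + 0ℤ * c) a≡0)
                       (cong (λ x → 1ℤ * x + 0ℤ * d) b≡0)

_∈ᴸ?_ : ∀ v L → Dec (v ∈ᴸ L)
(x , y) ∈ᴸ? L = map′ to from (D ∣? (x , y) ∧ g₂ ×-dec D ∣? g₁ ∧ (x , y))
  where
  open ValidLattice L
  a = proj₁ g₁
  b = proj₂ g₁
  c = proj₁ g₂
  d = proj₂ g₂

  D = g₁ ∧ g₂

  instance
    D≢0 : NonZero D
    D≢0 = ≢-nonZero (∧-nonZero L)

  expand₁ : ∀ x y a b c d → x * (a * d - b * c) ≡ a * (x * d - y * c) + c * (a * y - b * x)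
  expand₁ = solve-∀

  expand₂ : ∀ x y a b c d → y * (a * d - b * c) ≡ b * (x * d - y * c) + d * (a * y - b * x)
  expand₂ = solve-∀

  collect : ∀ a c m n e → a * (m * e) + c * (n * e) ≡ (m * a + n * c) * e
  collect = solve-∀

  cramer₁ : ∀ m n a b c d →
            (m * a + n * c) * d - (m * b + n * d) * c ≡ m * (a * d - b * c)
  cramer₁ = solve-∀

  cramer₂ : ∀ m n a b c d →
            a * (m * b + n * d) - b * (m * a + n * c) ≡ n * (a * d - b * c)
  cramer₂ = solve-∀

  to : D ∣ (x , y) ∧ g₂ × D ∣ g₁ ∧ (x , y) → (x , y) ∈ᴸ L
  to (divides m eq₁ , divides n eq₂) = m , n , cong₂ _,_
    (ℤ.*-cancelʳ-≡ x _ D (trans (expand₁ x y a b c d)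
      (trans (cong₂ (λ s t → a * s + c * t) eq₁ eq₂) (collect a c m n D))))
    (ℤ.*-cancelʳ-≡ y _ D (trans (expand₂ x y a b c d)
      (trans (cong₂ (λ s t → b * s + d * t) eq₁ eq₂) (collect b d m n D))))

  from : (x , y) ∈ᴸ L → D ∣ (x , y) ∧ g₂ × D ∣ g₁ ∧ (x , y)
  from (m , n , refl) = divides m (cramer₁ m n a b c d) , divides n (cramer₂ m n a b c d)

SameOrbit : ValidLattice → Domino → Domino → Set
SameOrbit L (s , a) (r , b) = a ≡ b × s -ᵛ r ∈ᴸ L

sameOrbit? : ∀ L d e → Dec (SameOrbit L d e)
sameOrbit? L (s , a) (r , b) = a ≟ᵃ b ×-dec s -ᵛ r ∈ᴸ? L

-- Dominoes are unions of closed unit squares, so covering ℝ² means covering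
-- every square, and interiors are disjoint when no square is shared.
record IsTiling (t : Pred Domino 0ℓ) : Set where
  field
    covers   : ∀ s → ∃[ d ] d ∈ t × s ∈ᵈ d
    disjoint : ∀ {d e s} → d ∈ t → e ∈ t → s ∈ᵈ d → s ∈ᵈ e → d ≡ e

record IsHeight (t : Pred Domino 0ℓ) (h : ℤ² → ℤ) : Set where
  field
    origin    : h 0ᵛ ≡ 0ℤ
    uncrossed : ∀ e → ¬ crossing e ∈ t → h (head e) ≡ h (tail e) + 1ℤ
    crossed   : ∀ e → crossing e ∈ t → h (head e) ≡ h (tail e) - + 3

record TorusTiling (L : ValidLattice) : Set₁ where
  field
    dominoes : Pred Domino 0ℓ
    isTiling : IsTiling dominoes
    periodic : ∀ {v s a} → v ∈ᴸ L → (s , a) ∈ dominoes → (s +ᵛ v , a) ∈ dominoes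

open TorusTiling using (dominoes)

fromℤ : ℤ → ℚ
fromℤ n = n ℚ./ 1

-- L has rank two and 4⟨φ,v⟩ is an integer for all v ∈ L, so a flux always
-- has rational coordinates.
ℚ² : Set
ℚ² = ℚ × ℚ

⟨_,_⟩ : ℚ² → ℤ² → ℚ
⟨ (p , q) , (x , y) ⟩ = p ℚ.* fromℤ x ℚ.+ q ℚ.* fromℤ y

HasFlux : (L : ValidLattice) → TorusTiling L → ℚ² → Set
HasFlux L t φ = ∃[ h ] IsHeight (dominoes t) h ×
  (∀ {v} → v ∈ᴸ L → ∀ u → fromℤ (+ 4) ℚ.* ⟨ φ , v ⟩ ≡ fromℤ (h (u +ᵛ v) - h u))

𝓕 : ValidLattice → Pred ℚ² (suc 0ℓ)
𝓕 L φ = ∃[ t ] HasFlux L t φ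

tilingsWithFlux : ValidLattice → ℚ² → Setoid (suc 0ℓ) 0ℓ
tilingsWithFlux L φ = record
  { Carrier       = Σ[ t ∈ TorusTiling L ] HasFlux L t φ
  ; _≈_           = _≐_ on (dominoes ∘ proj₁)
  ; isEquivalence = On.isEquivalence (dominoes ∘ proj₁) ≐-isEquivalence
  }

HasCardinality : ∀ {c ℓ} → Setoid c ℓ → ℕ → Set _
HasCardinality S n = Inverse S (setoid (Fin n))

-- Each permutation of Fin n is listed exactly once.
permutations : ∀ n → List (Permutation′ n)
permutations ℕ.zero    = Perm.id ∷ []
permutations (ℕ.suc n) =
  List.cartesianProductWith (Perm.insert Fin.zero) (allFin (ℕ.suc n)) (permutations n)

inversions : ∀ {n} → Permutation′ n → ℕ
inversions {n} π = List.length (List.filter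
  (λ (i , j) → i Fin.<? j ×-dec (π ⟨$⟩ʳ j) Fin.<? (π ⟨$⟩ʳ i))
  (List.cartesianProduct (allFin n) (allFin n)))

module _ {c ℓ} (R : RawRing c ℓ) where
  open RawRing R renaming (_+_ to _+ʳ_; -_ to -ʳ_; _*_ to _*ʳ_)
  open RawSemiringDefs rawSemiring using (product; _^_)

  det : ∀ {n} → (Fin n → Fin n → Carrier) → Carrier
  det {n} A = List.foldr _+ʳ_ 0# (map term (permutations n))
    where
    term : Permutation′ n → Carrier
    term π = ((-ʳ 1#) ^ inversions π) *ʳ product (λ i → A i (π ⟨$⟩ʳ i))

-- The monomial (c , i , j) is c q₀ⁱ q₁ʲ.
Monomial : Set
Monomial = ℤ × ℤ × ℤ

-- A Laurent polynomial is a formal sum of monomials, in which exponents may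
-- repeat; two such sums are identified when their coefficients agree.
Laurent : Set
Laurent = List Monomial

coeff : Laurent → ℤ → ℤ → ℤ
coeff p i j = List.foldr _+_ 0ℤ
  (map proj₁ (List.filter (λ (_ , k) → ≡-dec ℤ._≟_ ℤ._≟_ k (i , j)) p))

laurentRing : RawRing 0ℓ 0ℓ
laurentRing = record
  { Carrier = Laurent
  ; _≈_     = λ p q → ∀ i j → coeff p i j ≡ coeff q i j
  ; _+_     = _++_
  ; _*_     = List.cartesianProductWith
                λ (c , i , j) (c′ , i′ , j′) → c * c′ , i + i′ , j + j′
  ; -_      = map λ (c , i , j) → - c , i , j
  ; 0#      = []
  ; 1#      = (1ℤ , 0ℤ , 0ℤ) ∷ []
  }

record ReducedBasis (L : ValidLattice) : Set where
  field
    x₀ x₁ y₁   : ℕ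
    x₀-pos     : 0 < x₀
    x₀-mem     : (+ x₀ , 0ℤ) ∈ᴸ L
    x₀-minimal : ∀ {x} → 0 < x → (+ x , 0ℤ) ∈ᴸ L → x₀ ≤ x
    y₁-pos     : 0 < y₁
    y₁-minimal : ∀ {x : ℤ} {y} → 0 < y → (x , + y) ∈ᴸ L → y₁ ≤ y
    x₁-bound   : x₁ < x₀
    v₁-mem     : (+ x₁ , + y₁) ∈ᴸ L

  v₀ v₁ : ℤ²
  v₀ = + x₀ , 0ℤ
  v₁ = + x₁ , + y₁

  -- The squares contained in [0,x₀]×[0,y₁].
  Domain : Pred Square 0ℓ
  Domain (i , j) = (0ℤ ℤ.≤ i × i ℤ.< + x₀) × (0ℤ ℤ.≤ j × j ℤ.< + y₁)

  BlackDomain WhiteDomain : Pred Square 0ℓ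
  BlackDomain s = s ∈ Domain × s ∈ Black
  WhiteDomain s = s ∈ Domain × s ∈ White

  -- The steps of the paths are traversed in the direction of unit hor or unit ver.
  path₀ path₁ : List GridEdge
  path₀ = map (λ k → (+ k , 0ℤ) , hor) (upTo x₀)
  path₁ = map (λ k → (0ℤ , + k) , ver) (upTo y₁) ++
          map (λ k → (+ k , + y₁) , hor) (upTo x₁)

  -- A domino crossing u with its black square on the left makes the height
  -- change by +3 along u.  An orbit crosses at most one step of each of path₀, path₁.
  crossingExponent : List GridEdge → Domino → ℤ
  crossingExponent u d =
    if      does (any? (λ e → sameOrbit? L (crossing e) d ×-dec black? (leftOf e)) u)
    then 1ℤ
    else if does (any? (λ e → sameOrbit? L (crossing e) d ×-dec black? (rightOf e)) u)
    then -1ℤ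
    else 0ℤ

  edgeSign : Domino → ℤ
  edgeSign (s , hor) = if does (black? s) then -1ℤ else 1ℤ
  edgeSign (s , ver) = 1ℤ

  weight : Domino → Monomial
  weight d = edgeSign d , crossingExponent path₀ d , crossingExponent path₁ d

record Enumeration (P : Pred Square 0ℓ) (m : ℕ) : Set where
  field
    at         : Fin m → Square
    member     : ∀ i → at i ∈ P
    injective  : Injective _≡_ _≡_ at
    exhaustive : ∀ {s} → s ∈ P → ∃[ i ] at i ≡ s

module _ {L : ValidLattice} (B : ReducedBasis L) where
  open ReducedBasis B
  open Enumeration

  -- An orbit of edges joining a translate of bᵢ to a translate of wⱼ has
  -- exactly one representative whose black endpoint is bᵢ itself, since
  -- translations by L preserve colors.
  kasteleyn : ∀ {m} → Enumeration BlackDomain m → Enumeration WhiteDomain m →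
              Fin m → Fin m → Laurent
  kasteleyn b w i j = map weight
    (List.filter (λ d → whiteEnd d -ᵛ at w j ∈ᴸ? L) (dominoesAt (at b i)))

  CorrespondsTo : ℚ² → ℤ → ℤ → Set
  CorrespondsTo φ i j =
    fromℤ i ≡ ⟨ φ , v₀ ⟩ ×
    ((v₁ ∈ 𝓔 × fromℤ j ≡ ⟨ φ , v₁ ⟩) ⊎ (v₁ ∈ 𝓞 × fromℤ j ≡ ⟨ φ , v₁ ⟩ ℚ.- ½))

{-# OPTIONS --safe #-}
module Submission where

-- A periodic tiling is the same as a field of directions (each square points to the other
-- square of its domino), and as a permutation π together with a direction for every bᵢ;
-- these are the terms of the expansion of det K, and the exponents of a term are read off
-- from its height function along u(0) and u(1).  It remains to see that terms with equal
-- exponents have equal signs.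
--
-- Compare a tiling with the tiling t₀ in which every black square is matched upwards.  The
-- horizontal sides of squares crossed by exactly one of the two tilings are the positions of
-- particles that move downwards, one row at a time and at most one column to the left or
-- right, without collisions.  Hence the motion keeps the cyclic order within each row, and
-- its inversions with respect to the row-major order are determined by the number of
-- particles and by how often they wind around the torus.  Up to a constant and the number
-- of dominoes pointing down, the parity of these inversions is that of π.  The number of
-- particles and their total drift are sums of height increments over the torus, so they are
-- determined by the flux: the height functions of two tilings with the same flux differ by
-- an L-periodic function.

open import Defs
open import Algebra.Bundles using (AbelianGroup; CommutativeRing; RawRing)
import Algebra.Definitions.RawSemiring as RawSemiringDefs
import Algebra.Properties.Group as GroupProperties
import Algebra.Properties.Semiring.Sum as SemiringSum
open import Data.Bool.Base using (Bool; true; false; not; _∧_; _∨_; _xor_; if_then_else_)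
import Data.Bool.Properties as Bool
open import Data.Fin.Base as Fin using (Fin; zero; suc; punchIn)
open import Data.Fin.Permutation as Perm using (Permutation′; _⟨$⟩ʳ_; _⟨$⟩ˡ_)
import Data.Fin.Properties as Fin
open import Data.Integer.Base as ℤ
  using (ℤ; +_; -[1+_]; +[1+_]; +0; 0ℤ; 1ℤ; -1ℤ; _+_; _-_; _*_; -_; ∣_∣)
open import Data.Integer.Divisibility.Signed
  using (_∣_; divides; _∣?_; ∣m∣n⇒∣m+n; ∣m∣n⇒∣m-n; ∣m⇒∣m*n; ∣n⇒∣m*n)
open import Data.Integer.DivMod using (_%ℕ_; _/ℕ_; n%ℕd<d; a≡a%ℕn+[a/ℕn]*n)
import Data.Integer.Properties as ℤ
open import Data.Integer.Tactic.RingSolver using (solve-∀)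
open import Data.List.Base as List
  using (List; []; _∷_; _++_; map; upTo; applyUpTo; allFin; concat; filter; length; lookup;
         cartesianProduct; cartesianProductWith)
open import Data.List.Membership.Propositional using () renaming (_∈_ to _∈ˡ_)
import Data.List.Membership.Propositional.Properties as List
import Data.List.Properties as List
open import Data.List.Relation.Unary.All as All using (All; []; _∷_)
import Data.List.Relation.Unary.All.Properties as All
open import Data.List.Relation.Unary.AllPairs as AllPairs using (AllPairs; []; _∷_)
import Data.List.Relation.Unary.AllPairs.Properties as AllPairs
open import Data.List.Relation.Unary.Any as Any using (any?; here; there)
import Data.List.Relation.Unary.Any.Properties as Any
open import Data.List.Relation.Unary.Unique.Propositional using (Unique)
import Data.List.Relation.Unary.Unique.Propositional.Properties as Unique
import Data.List.Relation.Unary.Unique.Setoid.Properties as UniqueSetoid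
open import Data.Nat.Base as ℕ using (ℕ; s≤s; z≤n)
import Data.Nat.Properties as ℕ
open import Data.Product.Base using (_×_; _,_; proj₁; proj₂; ∃-syntax; ∃₂)
open import Data.Product.Properties using (≡-dec)
open import Data.Rational.Base as ℚ using (½)
import Data.Rational.Properties as ℚ
import Data.Rational.Unnormalised.Base as ℚᵘ
import Data.Rational.Unnormalised.Properties as ℚᵘ
open import Data.Sum.Base using (_⊎_; inj₁; inj₂)
open import Data.Vec.Base as Vec using (Vec; []; _∷_)
import Data.Vec.Properties as Vec
open import Function.Base using (_∘_; _on_)
open import Function.Definitions using (Injective)
open import Level using (0ℓ)
open import Relation.Binary.Bundles using (Setoid)
open import Relation.Binary.Definitions using (DecidableEquality; tri<; tri≈; tri>)
open import Relation.Binary.PropositionalEquality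
  using (_≡_; _≢_; _≗_; refl; sym; trans; cong; cong₂; subst; subst₂; setoid; module ≡-Reasoning)
open import Relation.Nullary using (Dec; yes; no; does; ¬_; contradiction; _×-dec_)
open import Relation.Nullary.Decidable using (dec-true; dec-false; from-no)
open import Relation.Unary using (Pred; _∈_; _≐_; Decidable)

open TorusTiling using (dominoes; isTiling; periodic)

-- On the torus the union of two tilings may contain noncontractible cycles, which a cycle-by-cycle
-- comparison of signs would have to treat by homology class. The inversions of the particle motion
-- treat all of them at once: with P particles, total row winding r and total column winding c, the
-- number of reversed pairs is (r - 1)c + (P - 1)r modulo 2, whatever the individual paths.
--
-- The motion is defined on all squares and not only on the particles. Its domain and its range are
-- then the same fixed set of squares, so its inversions can be compared with those of π by
-- reordering; the squares that stay in place cancel out.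
--
-- Up to a constant, this comparison gives the inversions of π plus the number of black squares
-- matched downwards. The sign of a term consists of the inversions of π plus the number of black
-- squares matched to the right. The discrepancy is "down plus right", which is exactly half of P
-- plus the total drift and hence fixed by the flux. This is why the sign -1 belongs on the
-- horizontal edges with black left endpoint.

BoolFun : ℕ → Set
BoolFun ℕ.zero    = Bool
BoolFun (ℕ.suc n) = Bool → BoolFun n

Agree : ∀ n → BoolFun n → BoolFun n → Set
Agree ℕ.zero    f g = f ≡ g
Agree (ℕ.suc n) f g = ∀ x → Agree n (f x) (g x)

agree? : ∀ n → BoolFun n → BoolFun n → Bool
agree? ℕ.zero    f g = does (f Bool.≟ g)
agree? (ℕ.suc n) f g = agree? n (f true) (g true) ∧ agree? n (f false) (g false)

∧-true : ∀ {a b} → a ∧ b ≡ true → a ≡ true × b ≡ true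
∧-true {true} {true} refl = refl , refl

-- Reflection: identities over the field with two elements are verified by evaluating the truth
-- table, so `refl` is the only evidence that a use has to supply.
agree : ∀ n f g → agree? n f g ≡ true → Agree n f g
agree ℕ.zero    true  true  _ = refl
agree ℕ.zero    false false _ = refl
agree (ℕ.suc n) f g p true  = agree n _ _ (proj₁ (∧-true p))
agree (ℕ.suc n) f g p false = agree n _ _ (proj₂ (∧-true {agree? n (f true) (g true)} p))

-- Parities of inversions

module ∑₂ = SemiringSum (CommutativeRing.semiring Bool.xor-∧-commutativeRing)

-- Finite sums in the field with two elements, kept abstract because the same inversion count is
-- needed over `Fin m` and over the sites `Fin m × Bool`. In `∑-diag` the off-diagonal terms occur
-- twice and cancel.
record Summation (X : Set) : Set where
  field
    ∑       : (X → Bool) → Bool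
    ∑-cong  : ∀ {f g} → (∀ x → f x ≡ g x) → ∑ f ≡ ∑ g
    ∑-xor   : ∀ f g → ∑ (λ x → f x xor g x) ≡ ∑ f xor ∑ g
    ∑-∧     : ∀ a f → ∑ (λ x → a ∧ f x) ≡ a ∧ ∑ f
    ∑-comm  : ∀ (f : X → X → Bool) → ∑ (λ x → ∑ (f x)) ≡ ∑ (λ y → ∑ (λ x → f x y))
    ∑-diag  : ∀ (f : X → X → Bool) → (∀ x y → f x y ≡ f y x) →
              ∑ (λ x → ∑ (f x)) ≡ ∑ (λ x → f x x)
    _≟_     : DecidableEquality X

  ∑-zero : ∀ {f} → (∀ x → f x ≡ false) → ∑ f ≡ false
  ∑-zero {f} f≡0 = trans (∑-cong f≡0) (∑-∧ false f)

  ∑∑-cong : ∀ {f g : X → X → Bool} → (∀ x y → f x y ≡ g x y) →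
            ∑ (λ x → ∑ (f x)) ≡ ∑ (λ x → ∑ (g x))
  ∑∑-cong eq = ∑-cong λ x → ∑-cong (eq x)

  ∑∑-xor : ∀ (f g : X → X → Bool) →
           ∑ (λ x → ∑ (λ y → f x y xor g x y)) ≡ ∑ (λ x → ∑ (f x)) xor ∑ (λ x → ∑ (g x))
  ∑∑-xor f g = trans (∑-cong λ x → ∑-xor (f x) (g x)) (∑-xor _ _)

-- Induction on n: by symmetry the first row and the first column, without their common corner, have
-- equal sums and cancel.
fin-diag : ∀ n (f : Fin n → Fin n → Bool) → (∀ i j → f i j ≡ f j i) →
           ∑₂.sum (λ i → ∑₂.sum (f i)) ≡ ∑₂.sum (λ i → f i i)
fin-diag ℕ.zero    f f-sym = refl
fin-diag (ℕ.suc n) f f-sym = begin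
  (a xor r) xor ∑₂.sum (λ i → f (suc i) zero xor ∑₂.sum (λ j → f (suc i) (suc j)))
    ≡⟨ cong ((a xor r) xor_) (∑₂.∑-distrib-+ (λ i → f (suc i) zero) _) ⟩
  (a xor r) xor (∑₂.sum (λ i → f (suc i) zero) xor d)
    ≡⟨ cong (λ c → (a xor r) xor (c xor d)) (∑₂.sum-cong-≗ λ i → f-sym (suc i) zero) ⟩
  (a xor r) xor (r xor d)
    ≡⟨ agree 3 (λ a r d → (a xor r) xor (r xor d)) (λ a r d → a xor d) refl a r d ⟩
  a xor d
    ≡⟨ cong (a xor_) (fin-diag n (λ i j → f (suc i) (suc j)) λ i j → f-sym (suc i) (suc j)) ⟩
  a xor ∑₂.sum (λ i → f (suc i) (suc i))
    ∎
  where
  open ≡-Reasoning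
  a = f zero zero
  r = ∑₂.sum (λ j → f zero (suc j))
  d = ∑₂.sum (λ i → ∑₂.sum (λ j → f (suc i) (suc j)))

finSummation : ∀ n → Summation (Fin n)
finSummation n = record
  { ∑      = ∑₂.sum
  ; ∑-cong = ∑₂.sum-cong-≗
  ; ∑-xor  = ∑₂.∑-distrib-+
  ; ∑-∧    = λ a f → sym (∑₂.*-distribˡ-sum a f)
  ; ∑-comm = ∑₂.∑-comm
  ; ∑-diag = fin-diag n
  ; _≟_    = Fin._≟_
  }

module _ {X : Set} (S : Summation X) where
  open Summation S

  -- For `∑-diag`, summing over the four pairs of Booleans gives a symmetric function on X; on its
  -- diagonal the two mixed terms agree and cancel.
  doubleSummation : Summation (X × Bool)
  doubleSummation = record
    { ∑      = λ f → ∑ λ x → f (x , true) xor f (x , false)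
    ; ∑-cong = λ eq → ∑-cong λ x → cong₂ _xor_ (eq (x , true)) (eq (x , false))
    ; ∑-xor  = λ f g → trans
        (∑-cong λ x → exchange (f (x , true)) (g (x , true)) (f (x , false)) (g (x , false)))
        (∑-xor _ _)
    ; ∑-∧    = λ a f → trans
        (∑-cong λ x → sym (Bool.∧-distribˡ-xor a (f (x , true)) (f (x , false))))
        (∑-∧ a _)
    ; ∑-comm = λ f → trans (∑-cong λ x → sym (∑-xor _ _))
        (trans (∑-comm _) (∑-cong λ y → trans
          (∑-cong λ x → exchange (f (x , true) (y , true)) (f (x , true) (y , false))
                                 (f (x , false) (y , true)) (f (x , false) (y , false)))
          (∑-xor _ _)))
    ; ∑-diag = λ f f-sym → trans (∑-cong λ x → sym (∑-xor _ _)) (trans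
        (∑-diag _ λ x y → trans
          (cong₂ _xor_ (cong₂ _xor_ (f-sym _ _) (f-sym _ _)) (cong₂ _xor_ (f-sym _ _) (f-sym _ _)))
          (exchange (f (y , true) (x , true)) _ (f (y , true) (x , false)) _))
        (∑-cong λ x → trans (cong (λ c → (f (x , true) (x , true) xor f (x , true) (x , false))
                                     xor (c xor f (x , false) (x , false)))
                                  (f-sym (x , false) (x , true)))
                      (cancel (f (x , true) (x , true)) (f (x , true) (x , false))
                              (f (x , false) (x , false)))))
    ; _≟_    = ≡-dec _≟_ Bool._≟_
    }
    where
    exchange : ∀ a b c d → (a xor b) xor (c xor d) ≡ (a xor c) xor (b xor d)
    exchange = agree 4 (λ a b c d → (a xor b) xor (c xor d)) (λ a b c d → (a xor c) xor (b xor d)) refl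
    cancel : ∀ a b c → (a xor b) xor (b xor c) ≡ a xor c
    cancel = agree 3 (λ a b c → (a xor b) xor (b xor c)) (λ a b c → a xor c) refl

-- Counting inversions only involves the orientation of pairs, so of a strict total order just this
-- is recorded: each pair of distinct elements is oriented in exactly one direction.
record IsTournament {X : Set} (A : X → X → Bool) : Set where
  field
    irreflexive : ∀ x → A x x ≡ false
    converse    : ∀ {x y} → x ≢ y → A y x ≡ not (A x y)

open IsTournament

pullback : ∀ {X Y : Set} {A : Y → Y → Bool} {f : X → Y} →
           IsTournament A → Injective _≡_ _≡_ f → IsTournament (A on f)
pullback {f = f} A-t inj = record
  { irreflexive = λ x → irreflexive A-t (f x)
  ; converse    = λ x≢y → converse A-t (x≢y ∘ inj)
  }

module _ {X : Set} (S : Summation X) where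
  open Summation S
  open ≡-Reasoning

  -- For tournaments, the parity of the number of unordered pairs on which A and B disagree.
  Inv : (A B : X → X → Bool) → Bool
  Inv A B = ∑ λ x → ∑ λ y → A x y ∧ B y x

  Inv-self : ∀ {A} → IsTournament A → Inv A A ≡ false
  Inv-self {A} A-t = trans (∑∑-cong vanish) (∑-zero λ x → ∑-zero λ y → refl)
    where
    vanish : ∀ x y → A x y ∧ A y x ≡ false
    vanish x y with x ≟ y
    ... | yes refl = trans (Bool.∧-idem (A x x)) (irreflexive A-t x)
    ... | no x≢y   = trans (cong (A x y ∧_) (converse A-t x≢y)) (Bool.∧-inverseʳ (A x y))

  -- The differences A + A′ and B + B′ of tournaments are symmetric, so their
  -- double sum is the diagonal one, which is zero.
  Inv-bilinear : ∀ {A A′ B B′} → IsTournament A → IsTournament A′ → IsTournament B → IsTournament B′ →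
                 Inv A B ≡ Inv A′ B xor (Inv A B′ xor Inv A′ B′)
  Inv-bilinear {A} {A′} {B} {B′} A-t A′-t B-t B′-t = begin
    Inv A B
      ≡⟨ agree 4 (λ a b c d → a) (λ a b c d → (b xor (c xor d)) xor (a xor (b xor (c xor d)))) refl
           (Inv A B) (Inv A′ B) (Inv A B′) (Inv A′ B′) ⟩
    rest xor (Inv A B xor (Inv A′ B xor (Inv A B′ xor Inv A′ B′)))
      ≡⟨ cong (rest xor_) (sym (split)) ⟩
    rest xor ∑ (λ x → ∑ λ y → d x y)
      ≡⟨ cong (rest xor_) (trans (∑-diag d d-sym) (∑-zero d-diag)) ⟩
    rest xor false
      ≡⟨ Bool.xor-identityʳ rest ⟩
    rest
      ∎
    where
    rest = Inv A′ B xor (Inv A B′ xor Inv A′ B′)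
    d : X → X → Bool
    d x y = (A x y ∧ B y x) xor ((A′ x y ∧ B y x) xor ((A x y ∧ B′ y x) xor (A′ x y ∧ B′ y x)))
    split : ∑ (λ x → ∑ λ y → d x y) ≡ Inv A B xor rest
    split = trans (∑∑-xor _ _) (cong (Inv A B xor_)
              (trans (∑∑-xor _ _) (cong (Inv A′ B xor_) (∑∑-xor _ _))))
    d-diag : ∀ x → d x x ≡ false
    d-diag x rewrite irreflexive A-t x | irreflexive A′-t x = refl
    d-sym : ∀ x y → d x y ≡ d y x
    d-sym x y with x ≟ y
    ... | yes refl = refl
    ... | no x≢y rewrite converse A-t x≢y | converse A′-t x≢y
                       | converse B-t x≢y | converse B′-t x≢y =
      agree 4 (λ a a′ b b′ → (a ∧ not b) xor ((a′ ∧ not b) xor ((a ∧ not b′) xor (a′ ∧ not b′))))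
              (λ a a′ b b′ → (not a ∧ b) xor ((not a′ ∧ b) xor ((not a ∧ b′) xor (not a′ ∧ b′))))
              refl (A x y) (A′ x y) (B x y) (B′ x y)

  -- Every unordered pair {x , y} contributes s x y (c x + c y) exactly once.
  ∑-halve : ∀ {A} → IsTournament A → ∀ (s : X → X → Bool) (c : X → Bool) → (∀ x y → s x y ≡ s y x) →
            ∑ (λ x → ∑ λ y → A x y ∧ (s x y ∧ (c x xor c y)))
            ≡ ∑ (λ x → c x ∧ (∑ (s x) xor s x x))
  ∑-halve {A} A-t s c s-sym = begin
    ∑ (λ x → ∑ λ y → A x y ∧ (s x y ∧ (c x xor c y)))
      ≡⟨ ∑∑-cong (λ x y → agree 4 (λ a s c d → a ∧ (s ∧ (c xor d)))
                                  (λ a s c d → (a ∧ (s ∧ c)) xor (a ∧ (s ∧ d))) refl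
                                  (A x y) (s x y) (c x) (c y)) ⟩
    ∑ (λ x → ∑ λ y → (A x y ∧ (s x y ∧ c x)) xor (A x y ∧ (s x y ∧ c y)))
      ≡⟨ ∑∑-xor _ _ ⟩
    p xor ∑ (λ x → ∑ λ y → A x y ∧ (s x y ∧ c y))
      ≡⟨ cong (p xor_) (trans (∑-comm _) (∑∑-cong λ x y →
           cong (λ s → A y x ∧ (s ∧ c x)) (s-sym y x))) ⟩
    p xor q
      ≡⟨ agree 3 (λ p q r → p xor q) (λ p q r → (p xor (q xor r)) xor r) refl p q r ⟩
    (p xor (q xor r)) xor r
      ≡⟨ cong (_xor r) (sym (trans (∑∑-xor _ _) (cong (p xor_) (∑∑-xor _ _)))) ⟩
    ∑ (λ x → ∑ λ y → u x y) xor r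
      ≡⟨ cong (_xor r) (trans (∑-diag u u-sym) (∑-cong u-diag)) ⟩
    ∑ (λ x → c x ∧ s x x) xor r
      ≡⟨ Bool.xor-comm _ r ⟩
    r xor ∑ (λ x → c x ∧ s x x)
      ≡⟨ cong (_xor ∑ (λ x → c x ∧ s x x)) (∑-cong λ x →
           trans (∑-cong λ y → Bool.∧-comm (s x y) (c x)) (∑-∧ (c x) (s x))) ⟩
    ∑ (λ x → c x ∧ ∑ (s x)) xor ∑ (λ x → c x ∧ s x x)
      ≡⟨ sym (∑-xor _ _) ⟩
    ∑ (λ x → (c x ∧ ∑ (s x)) xor (c x ∧ s x x))
      ≡⟨ ∑-cong (λ x → sym (Bool.∧-distribˡ-xor (c x) (∑ (s x)) (s x x))) ⟩
    ∑ (λ x → c x ∧ (∑ (s x) xor s x x))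
      ∎
    where
    p = ∑ λ x → ∑ λ y → A x y ∧ (s x y ∧ c x)
    q = ∑ λ x → ∑ λ y → A y x ∧ (s x y ∧ c x)
    r = ∑ λ x → ∑ λ y → s x y ∧ c x
    u : X → X → Bool
    u x y = (A x y ∧ (s x y ∧ c x)) xor ((A y x ∧ (s x y ∧ c x)) xor (s x y ∧ c x))
    u-off : ∀ {x y} → x ≢ y → u x y ≡ false
    u-off {x} {y} x≢y rewrite converse A-t x≢y =
      agree 2 (λ a e → (a ∧ e) xor ((not a ∧ e) xor e)) (λ a e → false) refl (A x y) (s x y ∧ c x)
    u-diag : ∀ x → u x x ≡ c x ∧ s x x
    u-diag x rewrite irreflexive A-t x = Bool.∧-comm (s x x) (c x)
    u-sym : ∀ x y → u x y ≡ u y x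
    u-sym x y with x ≟ y
    ... | yes refl = refl
    ... | no x≢y   = trans (u-off x≢y) (sym (u-off (x≢y ∘ sym)))

  -- Pairs involving a fixed site cancel, because g permutes the moving sites.
  Inv-moving : ∀ {Y : Set} {A : Y → Y → Bool} → IsTournament A → ∀ {s g : X → Y} →
               Injective _≡_ _≡_ s → Injective _≡_ _≡_ g → ∀ (p : X → Bool) →
               (∀ x → p x ≡ false → g x ≡ s x) →
               (∀ (f : Y → Bool) → ∑ (λ x → p x ∧ f (g x)) ≡ ∑ (λ x → p x ∧ f (s x))) →
               Inv (A on s) (A on g) ≡
               ∑ λ x → ∑ λ y → (p x ∧ p y) ∧ (A (s x) (s y) ∧ A (g y) (g x))
  Inv-moving {A = A} A-t {s} {g} s-inj g-inj p fixed moved = begin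
    Inv (A on s) (A on g)
      -- The pairs are split into four classes according to which of their members move.
      ≡⟨ ∑∑-cong (λ x y → agree 4
           (λ p q a b → a ∧ b)
           (λ p q a b → ((p ∧ q) ∧ (a ∧ b)) xor (((p ∧ not q) ∧ (a ∧ b)) xor
                        (((not p ∧ q) ∧ (a ∧ b)) xor ((not p ∧ not q) ∧ (a ∧ b)))))
           refl (p x) (p y) (A (s x) (s y)) (A (g y) (g x))) ⟩
    _
      ≡⟨ trans (∑∑-xor _ _) (cong (pp xor_) (trans (∑∑-xor _ _)
           (cong (pq xor_) (∑∑-xor _ _)))) ⟩
    pp xor (pq xor (qp xor qq))
      ≡⟨ cong₂ (λ a b → pp xor (pq xor (a xor b))) (∑-comm _)
               (∑-zero λ x → ∑-zero λ y → both-fixed x y) ⟩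
    pp xor (pq xor (qp′ xor false))
      ≡⟨ cong (λ a → pp xor (pq xor a)) (Bool.xor-identityʳ qp′) ⟩
    pp xor (pq xor qp′)
      -- The two mixed classes are merged and summed over the moving site first.
      ≡⟨ cong (pp xor_) (trans (sym (∑∑-xor _ _)) (trans (∑-comm _)
           (∑-zero λ y → one-fixed y))) ⟩
    pp xor false
      ≡⟨ Bool.xor-identityʳ pp ⟩
    pp
      ∎
    where
    pp = ∑ λ x → ∑ λ y → (p x ∧ p y) ∧ (A (s x) (s y) ∧ A (g y) (g x))
    pq = ∑ λ x → ∑ λ y → (p x ∧ not (p y)) ∧ (A (s x) (s y) ∧ A (g y) (g x))
    qp = ∑ λ x → ∑ λ y → (not (p x) ∧ p y) ∧ (A (s x) (s y) ∧ A (g y) (g x))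
    qp′ = ∑ λ x → ∑ λ y → (not (p y) ∧ p x) ∧ (A (s y) (s x) ∧ A (g x) (g y))
    qq = ∑ λ x → ∑ λ y → (not (p x) ∧ not (p y)) ∧ (A (s x) (s y) ∧ A (g y) (g x))

    both-fixed : ∀ x y → (not (p x) ∧ not (p y)) ∧ (A (s x) (s y) ∧ A (g y) (g x)) ≡ false
    both-fixed x y with p x in px | p y in py
    ... | true  | _     = refl
    ... | false | true  = refl
    ... | false | false rewrite fixed x px | fixed y py with x ≟ y
    ...   | yes refl rewrite irreflexive A-t (s x) = refl
    ...   | no x≢y rewrite converse A-t (x≢y ∘ s-inj) = Bool.∧-inverseʳ (A (s x) (s y))

    apart : ∀ {x y} → p x ≡ true → p y ≡ false → x ≢ y
    apart px py refl = contradiction (trans (sym px) py) λ ()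

    pair : ∀ x y → ((p x ∧ not (p y)) ∧ (A (s x) (s y) ∧ A (g y) (g x))) xor
                   ((not (p y) ∧ p x) ∧ (A (s y) (s x) ∧ A (g x) (g y)))
                   ≡ not (p y) ∧ ((p x ∧ A (g x) (s y)) xor (p x ∧ A (s x) (s y)))
    pair x y with p x in px | p y in py
    ... | true  | true  = refl
    ... | false | true  = refl
    ... | false | false = refl
    ... | true  | false rewrite converse A-t (apart px py ∘ s-inj) | converse A-t (apart px py ∘ g-inj)
                              | fixed y py =
      agree 2 (λ a b → (a ∧ not b) xor (not a ∧ b)) (λ a b → b xor a) refl (A (s x) (s y)) (A (g x) (s y))

    one-fixed : ∀ y → ∑ (λ x → ((p x ∧ not (p y)) ∧ (A (s x) (s y) ∧ A (g y) (g x))) xor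
                               ((not (p y) ∧ p x) ∧ (A (s y) (s x) ∧ A (g x) (g y)))) ≡ false
    one-fixed y = begin
      _
        ≡⟨ trans (∑-cong λ x → pair x y) (∑-∧ (not (p y)) _) ⟩
      not (p y) ∧ ∑ (λ x → (p x ∧ A (g x) (s y)) xor (p x ∧ A (s x) (s y)))
        -- The parity of the number of moving sites placed before `s y` is the same for `g` and for
        -- `s`.
        ≡⟨ cong (not (p y) ∧_) (trans (∑-xor _ _) (trans
             (cong (_xor ∑ (λ x → p x ∧ A (s x) (s y))) (moved (λ v → A v (s y))))
             (Bool.xor-same (∑ λ x → p x ∧ A (s x) (s y))))) ⟩
      not (p y) ∧ false
        ≡⟨ Bool.∧-zeroʳ (not (p y)) ⟩
      false
        ∎

-- Inversions of permutations and of motions of sites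

before : ∀ {n} → Fin n → Fin n → Bool
before i j = does (i Fin.<? j)

before-tournament : ∀ {n} → IsTournament (before {n})
before-tournament {n} = record
  { irreflexive = λ i → dec-false (i Fin.<? i) (Fin.<-irrefl refl)
  ; converse    = conv
  }
  where
  conv : ∀ {i j : Fin n} → i ≢ j → before j i ≡ not (before i j)
  conv {i} {j} i≢j with Fin.<-cmp i j
  ... | tri< i<j _ j≮i = trans (dec-false (j Fin.<? i) j≮i) (cong not (sym (dec-true (i Fin.<? j) i<j)))
  ... | tri≈ _ i≡j _   = contradiction i≡j i≢j
  ... | tri> i≮j _ j<i = trans (dec-true (j Fin.<? i) j<i) (cong not (sym (dec-false (i Fin.<? j) i≮j)))

⟨$⟩ʳ-injective : ∀ {m} (π : Permutation′ m) → Injective _≡_ _≡_ (π ⟨$⟩ʳ_)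
⟨$⟩ʳ-injective π eq = trans (sym (Perm.inverseˡ π)) (trans (cong (π ⟨$⟩ˡ_) eq) (Perm.inverseˡ π))

inversionParity : ∀ {m} → Permutation′ m → Bool
inversionParity {m} π = Inv (finSummation m) before (before on (π ⟨$⟩ʳ_))

∑∑-permute : ∀ {m} (f : Fin m → Fin m → Bool) (π : Permutation′ m) →
             ∑₂.sum (λ i → ∑₂.sum (f i)) ≡ ∑₂.sum (λ i → ∑₂.sum λ j → f (π ⟨$⟩ʳ i) (π ⟨$⟩ʳ j))
∑∑-permute f π = trans (∑₂.sum-permute _ π) (∑₂.sum-cong-≗ λ i → ∑₂.sum-permute (f (π ⟨$⟩ʳ i)) π)

-- Sites are the squares of the torus, indexed by the domino of the tiling that covers
-- them and their color.  Every black square is sent to its partner and every white one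
-- to the square below it; exchanging the two values on the dominoes with D i false turns
-- this into a map that fixes some sites and moves the others downwards.
twist : ∀ {m} → (Fin m → Bool) → Fin m × Bool → Fin m × Bool
twist D (i , c) = i , not (D i) xor c

module Sites {m : ℕ} {Pos : Set} (b w d : Fin m → Pos) where
  site : Permutation′ m → Fin m × Bool → Pos
  site π (i , true)  = b i
  site π (i , false) = w (π ⟨$⟩ʳ i)

  shift : Permutation′ m → Fin m × Bool → Pos
  shift π (i , true)  = w (π ⟨$⟩ʳ i)
  shift π (i , false) = d (π ⟨$⟩ʳ i)

  moved : Permutation′ m → (Fin m → Bool) → Fin m × Bool → Pos
  moved π D z = shift π (twist D z)

module _ {m : ℕ} {Pos : Set} {A : Pos → Pos → Bool} (A-t : IsTournament A)
         {b w d : Fin m → Pos}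
         (b-inj : Injective _≡_ _≡_ b) (w-inj : Injective _≡_ _≡_ w) (d-inj : Injective _≡_ _≡_ d)
         (b≢w : ∀ {i j} → b i ≢ w j) (d≢w : ∀ {i j} → d i ≢ w j)
  where

  open Sites b w d

  private
    S₁ = finSummation m
    S₂ = doubleSummation S₁
    open Summation

    sum = ∑₂.sum {m}

  site-injective : ∀ π → Injective _≡_ _≡_ (site π)
  site-injective π {i , true}  {j , true}  eq = cong (_, true) (b-inj eq)
  site-injective π {i , true}  {j , false} eq = contradiction eq b≢w
  site-injective π {i , false} {j , true}  eq = contradiction (sym eq) b≢w
  site-injective π {i , false} {j , false} eq = cong (_, false) (⟨$⟩ʳ-injective π (w-inj eq))

  shift-injective : ∀ π → Injective _≡_ _≡_ (shift π)
  shift-injective π {i , true}  {j , true}  eq = cong (_, true) (⟨$⟩ʳ-injective π (w-inj eq))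
  shift-injective π {i , true}  {j , false} eq = contradiction (sym eq) d≢w
  shift-injective π {i , false} {j , true}  eq = contradiction eq d≢w
  shift-injective π {i , false} {j , false} eq = cong (_, false) (⟨$⟩ʳ-injective π (d-inj eq))

  twist-injective : ∀ (D : Fin m → Bool) → Injective _≡_ _≡_ (twist D)
  twist-injective D {i , c} {j , e} eq with cong proj₁ eq
  ... | refl = cong (i ,_) (xor-cancelˡ (not (D i)) c e (cong proj₂ eq))
    where
    xor-cancelˡ : ∀ x y z → x xor y ≡ x xor z → y ≡ z
    xor-cancelˡ false y     z     eq = eq
    xor-cancelˡ true  true  true  eq = refl
    xor-cancelˡ true  false false eq = refl

  moved-injective : ∀ π D → Injective _≡_ _≡_ (moved π D)
  moved-injective π D {z} {z′} = twist-injective D {z} {z′} ∘ shift-injective π {twist D z} {twist D z′}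

  -- An auxiliary order in which the two sites of a domino are neighbors, so that the exchanges made
  -- by `twist` are exchanges of adjacent sites and each of them changes the parity by one.
  lexicographic : Fin m × Bool → Fin m × Bool → Bool
  lexicographic (i , c) (j , e) = before i j xor (does (i Fin.≟ j) ∧ (c ∧ not e))

  -- An auxiliary order along which `site π` runs through the squares in a way that does not depend
  -- on `π`: the black ones by index, then the white ones by index.
  blackFirst : Permutation′ m → Fin m × Bool → Fin m × Bool → Bool
  blackFirst π (i , true)  (j , true)  = before i j
  blackFirst π (i , true)  (j , false) = true
  blackFirst π (i , false) (j , true)  = false
  blackFirst π (i , false) (j , false) = before (π ⟨$⟩ʳ i) (π ⟨$⟩ʳ j)

  private
    module before = IsTournament (before-tournament {m})
    module A = IsTournament A-t

    lex-t : IsTournament lexicographic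
    lex-t = record { irreflexive = irr ; converse = λ {x} {y} → conv {x} {y} }
      where
      irr : ∀ x → lexicographic x x ≡ false
      irr (i , c) rewrite before.irreflexive i | dec-true (i Fin.≟ i) refl = Bool.∧-inverseʳ c
      conv : ∀ {x y} → x ≢ y → lexicographic y x ≡ not (lexicographic x y)
      conv {i , c} {j , e} x≢y with i Fin.≟ j
      conv {i , true}  {i , true}  x≢y | yes refl = contradiction refl x≢y
      conv {i , false} {i , false} x≢y | yes refl = contradiction refl x≢y
      conv {i , true}  {i , false} x≢y | yes refl
        rewrite before.irreflexive i | dec-true (i Fin.≟ i) refl = refl
      conv {i , false} {i , true}  x≢y | yes refl
        rewrite before.irreflexive i | dec-true (i Fin.≟ i) refl = refl
      conv {i , c} {j , e} x≢y | no i≢j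
        rewrite before.converse i≢j | dec-false (j Fin.≟ i) (i≢j ∘ sym) =
        trans (Bool.xor-identityʳ (not (before i j))) (cong not (sym (Bool.xor-identityʳ (before i j))))

    blackFirst-t : ∀ π → IsTournament (blackFirst π)
    blackFirst-t π = record { irreflexive = irr ; converse = λ {x} {y} → conv {x} {y} }
      where
      irr : ∀ x → blackFirst π x x ≡ false
      irr (i , true)  = before.irreflexive i
      irr (i , false) = before.irreflexive (π ⟨$⟩ʳ i)
      conv : ∀ {x y} → x ≢ y → blackFirst π y x ≡ not (blackFirst π x y)
      conv {i , true}  {j , true}  x≢y = before.converse (x≢y ∘ cong (_, true))
      conv {i , true}  {j , false} x≢y = refl
      conv {i , false} {j , true}  x≢y = refl
      conv {i , false} {j , false} x≢y =
        before.converse (x≢y ∘ cong (_, false) ∘ ⟨$⟩ʳ-injective π)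

    site-t : ∀ π → IsTournament (A on site π)
    site-t π = pullback A-t (site-injective π)

    shift-t : ∀ π → IsTournament (A on shift π)
    shift-t π = pullback A-t (shift-injective π)

    moved-t : ∀ π D → IsTournament (A on moved π D)
    moved-t π D = pullback A-t (moved-injective π D)

    open ≡-Reasoning

    pairs : (B C : Fin m × Bool → Fin m × Bool → Bool) → Fin m → Fin m → Bool
    pairs B C i j = (B (i , true) (j , true) ∧ C (j , true) (i , true) xor
                     B (i , true) (j , false) ∧ C (j , false) (i , true)) xor
                    (B (i , false) (j , true) ∧ C (j , true) (i , false) xor
                     B (i , false) (j , false) ∧ C (j , false) (i , false))

    ∑-pairs : ∀ B C → Inv S₂ B C ≡ sum (λ i → sum (pairs B C i))
    ∑-pairs B C = ∑₂.sum-cong-≗ λ i → sym (∑₂.∑-distrib-+ (half i true) (half i false))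
      where
      half : Fin m → Bool → Fin m → Bool
      half i c j = B (i , c) (j , true) ∧ C (j , true) (i , c) xor
                   B (i , c) (j , false) ∧ C (j , false) (i , c)

    -- For different dominoes the order is the same for all four pairs of their sites, so permuting
    -- the values within each domino does not change the count. Within one domino the single pair is
    -- reversed exactly when `D i` is false.
    shift-moved : ∀ π D → Inv S₂ lexicographic (A on moved π D) ≡
                  sum (λ i → not (D i)) xor Inv S₂ lexicographic (A on shift π)
    shift-moved π D = begin
      M
        ≡⟨ agree 2 (λ x y → x) (λ x y → (x xor y) xor y) refl M N ⟩
      (M xor N) xor N
        ≡⟨ cong (_xor N) (cong₂ _xor_ (∑-pairs lexicographic (A on moved π D))
                                       (∑-pairs lexicographic (A on shift π))) ⟩
      (sum (λ i → sum (μ i)) xor sum (λ i → sum (ν i))) xor N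
        ≡⟨ cong (_xor N) (sym (∑∑-xor S₁ μ ν)) ⟩
      sum (λ i → sum (λ j → μ i j xor ν i j)) xor N
        ≡⟨ cong (_xor N) (trans (∑-diag S₁ _ diff-sym) (∑₂.sum-cong-≗ diff-diag)) ⟩
      sum (λ i → not (D i)) xor N
        ∎
      where
      M = Inv S₂ lexicographic (A on moved π D)
      N = Inv S₂ lexicographic (A on shift π)
      μ = pairs lexicographic (A on moved π D)
      ν = pairs lexicographic (A on shift π)

      untwist : ∀ x y (f : Bool → Bool → Bool) →
                ((f (x xor true) (y xor true) xor f (x xor true) (y xor false)) xor
                 (f (x xor false) (y xor true) xor f (x xor false) (y xor false))) xor
                ((f true true xor f true false) xor (f false true xor f false false)) ≡ false
      untwist x y f = by-cases x y
        where
        Σ₄ : Bool → Bool → Bool → Bool → Bool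
        Σ₄ a b c d = (a xor b) xor (c xor d)
        cancel : (g : Bool → Bool → Bool → Bool → Bool) →
                 agree? 4 (λ a b c d → g a b c d xor Σ₄ a b c d) (λ _ _ _ _ → false) ≡ true →
                 g (f true true) (f true false) (f false true) (f false false) xor
                 Σ₄ (f true true) (f true false) (f false true) (f false false) ≡ false
        cancel g eq = agree 4 (λ a b c d → g a b c d xor Σ₄ a b c d) (λ _ _ _ _ → false) eq _ _ _ _
        by-cases : ∀ x y → Σ₄ (f (x xor true) (y xor true)) (f (x xor true) (y xor false))
                              (f (x xor false) (y xor true)) (f (x xor false) (y xor false)) xor
                           Σ₄ (f true true) (f true false) (f false true) (f false false) ≡ false
        by-cases true  true  = cancel (λ a b c d → Σ₄ d c b a) refl
        by-cases true  false = cancel (λ a b c d → Σ₄ c d a b) refl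
        by-cases false true  = cancel (λ a b c d → Σ₄ b a d c) refl
        by-cases false false = cancel Σ₄ refl

      diff-off : ∀ {i j} → i ≢ j → μ i j xor ν i j ≡ false
      diff-off {i} {j} i≢j rewrite dec-false (i Fin.≟ j) i≢j with before i j
      ... | false = refl
      ... | true  =
        untwist (not (D i)) (not (D j)) λ c e → A (shift π (j , e)) (shift π (i , c))

      diff-sym : ∀ i j → μ i j xor ν i j ≡ μ j i xor ν j i
      diff-sym i j = by-cases (i Fin.≟ j)
        where
        by-cases : Dec (i ≡ j) → μ i j xor ν i j ≡ μ j i xor ν j i
        by-cases (yes refl) = refl
        by-cases (no i≢j)   = trans (diff-off i≢j) (sym (diff-off (i≢j ∘ sym)))

      diff-diag : ∀ i → μ i i xor ν i i ≡ not (D i)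
      diff-diag i rewrite before.irreflexive i | dec-true (i Fin.≟ i) refl with D i
      ... | true  = Bool.xor-same ((false xor A (d (π ⟨$⟩ʳ i)) (w (π ⟨$⟩ʳ i))) xor false)
      ... | false rewrite A.converse {d (π ⟨$⟩ʳ i)} {w (π ⟨$⟩ʳ i)} d≢w =
        agree 1 (λ a → ((false xor not a) xor false) xor ((false xor a) xor false)) (λ _ → true) refl
              (A (d (π ⟨$⟩ʳ i)) (w (π ⟨$⟩ʳ i)))

  -- The part of the parity in Inv-moved that does not depend on the tiling.
  siteConstant : Bool
  siteConstant = (sum (λ i → sum λ j → before i j ∧ A (b j) (b i)) xor
                   (sum (λ i → sum λ j → A (w j) (b i)) xor
                    sum (λ i → sum λ j → before i j ∧ A (w j) (w i)))) xor
                 (Inv S₁ before (A on w) xor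
                   (sum (λ i → sum λ j → A (d j) (w i)) xor
                    sum (λ i → sum λ j → before i j ∧ A (d j) (d i))))

  private
    blackFirst-expand : ∀ π C → Inv S₂ (blackFirst π) C ≡
      sum (λ i → sum λ j → before i j ∧ C (j , true) (i , true)) xor
      (sum (λ i → sum λ j → C (j , false) (i , true)) xor
       sum (λ i → sum λ j → before (π ⟨$⟩ʳ i) (π ⟨$⟩ʳ j) ∧ C (j , false) (i , false)))
    blackFirst-expand π C = trans (∑-pairs (blackFirst π) C) (trans
      (∑∑-cong S₁ λ i j → Bool.xor-assoc (before i j ∧ C (j , true) (i , true)) (C (j , false) (i , true)) _)
      (trans (∑∑-xor S₁ _ _) (cong (first xor_) (∑∑-xor S₁ _ _))))
      where
      first = sum (λ i → sum λ j → before i j ∧ C (j , true) (i , true))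

    blackFirst-site : ∀ π → Inv S₂ (blackFirst π) (A on site π) ≡
      sum (λ i → sum λ j → before i j ∧ A (b j) (b i)) xor
      (sum (λ i → sum λ j → A (w j) (b i)) xor
       sum (λ i → sum λ j → before i j ∧ A (w j) (w i)))
    blackFirst-site π = trans (blackFirst-expand π (A on site π)) (cong (first xor_) (cong₂ _xor_
      (∑₂.sum-cong-≗ λ i → sym (∑₂.sum-permute (λ j → A (w j) (b i)) π))
      (sym (∑∑-permute (λ i j → before i j ∧ A (w j) (w i)) π))))
      where
      first = sum (λ i → sum λ j → before i j ∧ A (b j) (b i))

    -- The black sites come in the order of i and are sent to the white squares numbered `π i`;
    -- their inversions are those of `π` combined with those of `w`. In the other sums `π`
    -- disappears by reindexing.
    blackFirst-shift : ∀ π → Inv S₂ (blackFirst π) (A on shift π) ≡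
      (inversionParity π xor Inv S₁ before (A on w)) xor
      (sum (λ i → sum λ j → A (d j) (w i)) xor
       sum (λ i → sum λ j → before i j ∧ A (d j) (d i)))
    blackFirst-shift π = trans (blackFirst-expand π (A on shift π)) (cong₂ _xor_ relabel (cong₂ _xor_
      (sym (∑∑-permute (λ i j → A (d j) (w i)) π))
      (sym (∑∑-permute (λ i j → before i j ∧ A (d j) (d i)) π))))
      where
      before-π = before on (π ⟨$⟩ʳ_)
      before-π-t = pullback before-tournament (⟨$⟩ʳ-injective π)
      relabel : Inv S₁ before (A on (w ∘ (π ⟨$⟩ʳ_))) ≡ inversionParity π xor Inv S₁ before (A on w)
      relabel = begin
        Inv S₁ before (A on (w ∘ (π ⟨$⟩ʳ_)))
          ≡⟨ Inv-bilinear S₁ before-tournament before-π-t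
               (pullback A-t (⟨$⟩ʳ-injective π ∘ w-inj)) before-π-t ⟩
        Inv S₁ before-π (A on (w ∘ (π ⟨$⟩ʳ_))) xor (inversionParity π xor Inv S₁ before-π before-π)
          ≡⟨ cong₂ (λ x y → x xor (inversionParity π xor y))
               (sym (∑∑-permute (λ i j → before i j ∧ A (w j) (w i)) π)) (Inv-self S₁ before-π-t) ⟩
        Inv S₁ before (A on w) xor (inversionParity π xor false)
          ≡⟨ agree 2 (λ x y → x xor (y xor false)) (λ x y → y xor x) refl
               (Inv S₁ before (A on w)) (inversionParity π) ⟩
        inversionParity π xor Inv S₁ before (A on w)
          ∎

  -- `Inv-bilinear` is used twice: `lexicographic` reduces `moved` to `shift`, and `blackFirst`
  -- reduces the order by `site` to one that is independent of `π`. The inversions of `shift`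
  -- against `lexicographic` enter twice and cancel.
  Inv-moved : ∀ π D → Inv S₂ (A on site π) (A on moved π D) ≡
              (inversionParity π xor sum (λ i → not (D i))) xor siteConstant
  Inv-moved π D = begin
    Inv S₂ As Am
      ≡⟨ Inv-bilinear S₂ (site-t π) lex-t (moved-t π D) (shift-t π) ⟩
    Inv S₂ lexicographic Am xor (Inv S₂ As Ash xor Inv S₂ lexicographic Ash)
      ≡⟨ cong₂ (λ x y → x xor (y xor Inv S₂ lexicographic Ash)) (shift-moved π D)
           (Inv-bilinear S₂ (site-t π) (blackFirst-t π) (shift-t π) (site-t π)) ⟩
    (n xor l) xor ((Inv S₂ (blackFirst π) Ash xor (Inv S₂ As As xor Inv S₂ (blackFirst π) As)) xor l)
      ≡⟨ cong₂ (λ x y → (n xor l) xor ((x xor y) xor l)) (blackFirst-shift π)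
           (cong₂ _xor_ (Inv-self S₂ (site-t π)) (blackFirst-site π)) ⟩
    (n xor l) xor ((((inversionParity π xor q) xor r) xor (false xor p)) xor l)
      ≡⟨ agree 6 (λ n l i q r p → (n xor l) xor ((((i xor q) xor r) xor (false xor p)) xor l))
                 (λ n l i q r p → (i xor n) xor (p xor (q xor r))) refl n l (inversionParity π) q r p ⟩
    (inversionParity π xor n) xor siteConstant
      ∎
    where
    As = A on site π
    Am = A on moved π D
    Ash = A on shift π
    n = sum (λ i → not (D i))
    l = Inv S₂ lexicographic Ash
    q = Inv S₁ before (A on w)
    r = sum (λ i → sum λ j → A (d j) (w i)) xor sum (λ i → sum λ j → before i j ∧ A (d j) (d i))
    p = sum (λ i → sum λ j → before i j ∧ A (b j) (b i)) xor
        (sum (λ i → sum λ j → A (w j) (b i)) xor sum (λ i → sum λ j → before i j ∧ A (w j) (w i)))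

-- Lattices and fundamental domains

does-true : ∀ {P : Set} (P? : Dec P) → does P? ≡ true → P
does-true (yes p) _ = p

does-false : ∀ {P : Set} (P? : Dec P) → does P? ≡ false → ¬ P
does-false (no ¬p) _ = ¬p

-- Parity of integers and colors of squares

opaque
  odd : ℤ → Bool
  odd n = not (does (+ 2 ∣? n))

  even⇒¬odd : ∀ {n} → + 2 ∣ n → odd n ≡ false
  even⇒¬odd {n} 2∣n = cong not (dec-true (+ 2 ∣? n) 2∣n)

  suc-even⇒odd : ∀ {n} → + 2 ∣ n + 1ℤ → odd n ≡ true
  suc-even⇒odd {n} 2∣n+1 = cong not (dec-false (+ 2 ∣? n) λ 2∣n →
    from-no (+ 2 ∣? 1ℤ) (subst (+ 2 ∣_) (diff n) (∣m∣n⇒∣m-n 2∣n+1 2∣n)))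
    where
    diff : ∀ n → (n + 1ℤ) - n ≡ 1ℤ
    diff = solve-∀

  ¬odd⇒even : ∀ {n} → odd n ≡ false → + 2 ∣ n
  ¬odd⇒even {n} eq = does-true (+ 2 ∣? n) (trans (sym (Bool.not-involutive _)) (cong not eq))

  does-even : ∀ n → does (+ 2 ∣? n) ≡ not (odd n)
  does-even n = sym (Bool.not-involutive _)

even⊎suc-even : ∀ n → (+ 2 ∣ n) ⊎ (+ 2 ∣ n + 1ℤ)
even⊎suc-even n with n %ℕ 2 | n /ℕ 2 | a≡a%ℕn+[a/ℕn]*n n 2 | n%ℕd<d n 2
... | 0 | q | eq | _ = inj₁ (divides q (trans eq (ℤ.+-identityˡ (q * + 2))))
... | 1 | q | eq | _ = inj₂ (divides (q + 1ℤ) (trans (cong (_+ 1ℤ) eq) (collect q)))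
  where
  collect : ∀ q → (1ℤ + q * + 2) + 1ℤ ≡ (q + 1ℤ) * + 2
  collect = solve-∀
... | ℕ.suc (ℕ.suc _) | _ | _ | s≤s (s≤s ())

odd-+ : ∀ a b → odd (a + b) ≡ odd a xor odd b
odd-+ a b with even⊎suc-even a | even⊎suc-even b
... | inj₁ p | inj₁ q rewrite even⇒¬odd p | even⇒¬odd q = even⇒¬odd (∣m∣n⇒∣m+n p q)
... | inj₁ p | inj₂ q rewrite even⇒¬odd p | suc-even⇒odd {b} q =
  suc-even⇒odd (subst (+ 2 ∣_) (sym (ℤ.+-assoc a b 1ℤ)) (∣m∣n⇒∣m+n p q))
... | inj₂ p | inj₁ q rewrite suc-even⇒odd {a} p | even⇒¬odd q =
  suc-even⇒odd (subst (+ 2 ∣_) (shuffle a b) (∣m∣n⇒∣m+n p q))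
  where
  shuffle : ∀ a b → (a + 1ℤ) + b ≡ (a + b) + 1ℤ
  shuffle = solve-∀
... | inj₂ p | inj₂ q rewrite suc-even⇒odd {a} p | suc-even⇒odd {b} q =
  even⇒¬odd (subst (+ 2 ∣_) (shuffle a b) (∣m∣n⇒∣m-n (∣m∣n⇒∣m+n p q) (divides 1ℤ refl)))
  where
  shuffle : ∀ a b → ((a + 1ℤ) + (b + 1ℤ)) - + 2 ≡ a + b
  shuffle = solve-∀

odd-* : ∀ a b → odd (a * b) ≡ odd a ∧ odd b
odd-* a b with even⊎suc-even a | even⊎suc-even b
... | inj₁ p | _      rewrite even⇒¬odd p = even⇒¬odd (∣m⇒∣m*n b p)
... | inj₂ p | inj₁ q rewrite even⇒¬odd q = trans (even⇒¬odd (∣n⇒∣m*n a q)) (sym (Bool.∧-zeroʳ (odd a)))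
... | inj₂ p | inj₂ q rewrite suc-even⇒odd {a} p | suc-even⇒odd {b} q =
  suc-even⇒odd (subst (+ 2 ∣_) (shuffle a b)
    (∣m∣n⇒∣m+n (∣m∣n⇒∣m-n (∣m⇒∣m*n (b + 1ℤ) p) (∣m∣n⇒∣m+n p q)) (divides 1ℤ refl)))
  where
  shuffle : ∀ a b → ((a + 1ℤ) * (b + 1ℤ) - ((a + 1ℤ) + (b + 1ℤ))) + + 2 ≡ a * b + 1ℤ
  shuffle = solve-∀

odd-neg : ∀ a → odd (- a) ≡ odd a
odd-neg a = trans (cong odd (sym (ℤ.-1*i≡-i a))) (trans (odd-* -1ℤ a)
  (cong (_∧ odd a) (suc-even⇒odd {n = -1ℤ} (divides 0ℤ refl))))

opaque
  black : Square → Bool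
  black s = does (black? s)

  does-black : ∀ s → does (black? s) ≡ black s
  does-black s = refl

black-odd : ∀ x y → black (x , y) ≡ not (odd x xor odd y)
black-odd x y = trans (sym (does-black (x , y))) (trans (does-even (x + y)) (cong not (odd-+ x y)))

odd-1 : odd 1ℤ ≡ true
odd-1 = suc-even⇒odd {n = 1ℤ} (divides 1ℤ refl)

black-hor : ∀ s → black (s +ᵛ unit hor) ≡ not (black s)
black-hor (x , y) rewrite black-odd (x + 1ℤ) (y + 0ℤ) | black-odd x y | odd-+ x 1ℤ | odd-1 | ℤ.+-identityʳ y =
  agree 2 (λ a b → not ((a xor true) xor b)) (λ a b → not (not (a xor b))) refl (odd x) (odd y)

black-ver : ∀ s → black (s +ᵛ unit ver) ≡ not (black s)
black-ver (x , y) rewrite black-odd (x + 0ℤ) (y + 1ℤ) | black-odd x y | odd-+ y 1ℤ | odd-1 | ℤ.+-identityʳ x =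
  agree 2 (λ a b → not (a xor (b xor true))) (λ a b → not (not (a xor b))) refl (odd x) (odd y)

black⇒∈ : ∀ {s} → black s ≡ true → s ∈ Black
black⇒∈ {s} eq = does-true (black? s) (trans (does-black s) eq)

white⇒∈ : ∀ {s} → black s ≡ false → s ∈ White
white⇒∈ {s} eq = does-false (black? s) (trans (does-black s) eq)

∈⇒black : ∀ {s} → s ∈ Black → black s ≡ true
∈⇒black {s} p = trans (sym (does-black s)) (dec-true (black? s) p)

∈⇒white : ∀ {s} → s ∈ White → black s ≡ false
∈⇒white {s} p = trans (sym (does-black s)) (dec-false (black? s) p)

-ᵛ-+ᵛ : ∀ s v → (s -ᵛ v) +ᵛ v ≡ s
-ᵛ-+ᵛ (a , b) (c , d) = cong₂ _,_ (i a c) (i b d)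
  where
  i : ∀ a c → (a - c) + c ≡ a
  i = solve-∀

+ᵛ--ᵛ : ∀ s v → (s +ᵛ v) -ᵛ v ≡ s
+ᵛ--ᵛ (a , b) (c , d) = cong₂ _,_ (i a c) (i b d)
  where
  i : ∀ a c → (a + c) - c ≡ a
  i = solve-∀

+ᵛ-cancelˡ : ∀ s v → (s +ᵛ v) -ᵛ s ≡ v
+ᵛ-cancelˡ (a , b) (c , d) = cong₂ _,_ (i a c) (i b d)
  where
  i : ∀ a c → (a + c) - a ≡ c
  i = solve-∀

+ᵛ-assoc : ∀ s u v → (s +ᵛ u) +ᵛ v ≡ s +ᵛ (u +ᵛ v)
+ᵛ-assoc (a , b) (c , d) (e , f) = cong₂ _,_ (ℤ.+-assoc a c e) (ℤ.+-assoc b d f)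

+ᵛ-comm : ∀ s u → s +ᵛ u ≡ u +ᵛ s
+ᵛ-comm (a , b) (c , d) = cong₂ _,_ (ℤ.+-comm a c) (ℤ.+-comm b d)

+ᵛ-swap : ∀ s u v → (s +ᵛ u) +ᵛ v ≡ (s +ᵛ v) +ᵛ u
+ᵛ-swap s u v = trans (+ᵛ-assoc s u v) (trans (cong (s +ᵛ_) (+ᵛ-comm u v)) (sym (+ᵛ-assoc s v u)))

-ᵛ-swap : ∀ s u v → (s -ᵛ u) +ᵛ v ≡ (s +ᵛ v) -ᵛ u
-ᵛ-swap (a , b) (c , d) (e , f) = cong₂ _,_ (i a c e) (i b d f)
  where
  i : ∀ a c e → (a - c) + e ≡ (a + e) - c
  i = solve-∀

infix 4 _≈_mod_
-- A record instead of the bare membership of the difference, so that s and r can be recovered from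
-- the type.
record _≈_mod_ (s r : ℤ²) (L : ValidLattice) : Set where
  constructor congruent
  field difference : s -ᵛ r ∈ᴸ L

open _≈_mod_ public

module _ (L : ValidLattice) where
  open ValidLattice L

  ∈ᴸ-+ : ∀ {u v} → u ∈ᴸ L → v ∈ᴸ L → u +ᵛ v ∈ᴸ L
  ∈ᴸ-+ (m , n , refl) (m′ , n′ , refl) = m + m′ , n + n′ ,
    cong₂ _,_ (collect m m′ n n′ (proj₁ g₁) (proj₁ g₂)) (collect m m′ n n′ (proj₂ g₁) (proj₂ g₂))
    where
    collect : ∀ m m′ n n′ a b → (m * a + n * b) + (m′ * a + n′ * b) ≡ (m + m′) * a + (n + n′) * b
    collect = solve-∀

  ∈ᴸ-· : ∀ k {v} → v ∈ᴸ L → k ·ᵛ v ∈ᴸ L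
  ∈ᴸ-· k (m , n , refl) = k * m , k * n ,
    cong₂ _,_ (collect k m n (proj₁ g₁) (proj₁ g₂)) (collect k m n (proj₂ g₁) (proj₂ g₂))
    where
    collect : ∀ k m n a b → k * (m * a + n * b) ≡ (k * m) * a + (k * n) * b
    collect = solve-∀

  private
    odd-valid : ∀ {g : ℤ²} → g ∈ 𝓔 ⊎ g ∈ 𝓞 → odd (proj₁ g) ≡ odd (proj₂ g)
    odd-valid {x , y} (inj₁ (p , q)) = trans (even⇒¬odd {x} p) (sym (even⇒¬odd {y} q))
    odd-valid {x , y} (inj₂ (p , q)) = trans (up p) (sym (up q))
      where
      shuffle : ∀ x → (x - 1ℤ) + + 2 ≡ x + 1ℤ
      shuffle = solve-∀
      up : ∀ {x} → + 2 ∣ x - 1ℤ → odd x ≡ true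
      up {x} p = suc-even⇒odd (subst (+ 2 ∣_) (shuffle x) (∣m∣n⇒∣m+n p (divides 1ℤ refl)))

  -- Each generator lies in `𝓔` or `𝓞`, hence has coordinates of equal parity. This is what makes
  -- translations by L preserve colors.
  ∈ᴸ-parity : ∀ {v} → v ∈ᴸ L → odd (proj₁ v) ≡ odd (proj₂ v)
  ∈ᴸ-parity (m , n , refl) = trans (expand (proj₁ g₁) (proj₁ g₂)) (trans
    (cong₂ (λ a b → (odd m ∧ a) xor (odd n ∧ b)) (odd-valid g₁-valid) (odd-valid g₂-valid))
    (sym (expand (proj₂ g₁) (proj₂ g₂))))
    where
    expand : ∀ a b → odd (m * a + n * b) ≡ (odd m ∧ odd a) xor (odd n ∧ odd b)
    expand a b = trans (odd-+ (m * a) (n * b)) (cong₂ _xor_ (odd-* m a) (odd-* n b))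

  black-periodic : ∀ {s v} → v ∈ᴸ L → black (s +ᵛ v) ≡ black s
  black-periodic {x , y} {a , b} v∈L
    rewrite black-odd (x + a) (y + b) | black-odd x y | odd-+ x a | odd-+ y b | ∈ᴸ-parity v∈L =
    agree 3 (λ x y c → not ((x xor c) xor (y xor c))) (λ x y c → not (x xor y)) refl (odd x) (odd y) (odd b)

module _ {L : ValidLattice} where
  ≈-refl : ∀ {s} → s ≈ s mod L
  ≈-refl {a , b} = congruent (0ℤ , 0ℤ , cong₂ _,_ (ℤ.+-inverseʳ a) (ℤ.+-inverseʳ b))

  ≈-reflexive : ∀ {s r} → s ≡ r → s ≈ r mod L
  ≈-reflexive refl = ≈-refl

  ≈-sym : ∀ {s r} → s ≈ r mod L → r ≈ s mod L
  ≈-sym {a , b} {c , d} (congruent p) =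
    congruent (subst (_∈ᴸ L) (cong₂ _,_ (i a c) (i b d)) (∈ᴸ-· L -1ℤ p))
    where
    i : ∀ a c → -1ℤ * (a - c) ≡ c - a
    i = solve-∀

  ≈-trans : ∀ {s r q} → s ≈ r mod L → r ≈ q mod L → s ≈ q mod L
  ≈-trans {a , b} {c , d} {e , f} (congruent p) (congruent q) =
    congruent (subst (_∈ᴸ L) (cong₂ _,_ (i a c e) (i b d f)) (∈ᴸ-+ L p q))
    where
    i : ∀ a c e → (a - c) + (c - e) ≡ a - e
    i = solve-∀

  ≈-+ : ∀ {s r} u → s ≈ r mod L → s +ᵛ u ≈ r +ᵛ u mod L
  ≈-+ {a , b} {c , d} (e , f) (congruent p) =
    congruent (subst (_∈ᴸ L) (cong₂ _,_ (i a c e) (i b d f)) p)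
    where
    i : ∀ a c e → a - c ≡ (a + e) - (c + e)
    i = solve-∀

  ≈-- : ∀ {s r} u → s ≈ r mod L → s -ᵛ u ≈ r -ᵛ u mod L
  ≈-- {a , b} {c , d} (e , f) (congruent p) =
    congruent (subst (_∈ᴸ L) (cong₂ _,_ (i a c e) (i b d f)) p)
    where
    i : ∀ a c e → a - c ≡ (a - e) - (c - e)
    i = solve-∀

  ≈-translate : ∀ {s r} → s ≈ r mod L → ∃[ v ] v ∈ᴸ L × s ≡ r +ᵛ v
  ≈-translate {s} {r} (congruent p) = s -ᵛ r , p , trans (sym (-ᵛ-+ᵛ s r)) (+ᵛ-comm (s -ᵛ r) r)

  +ᵛ-≈ : ∀ {s v} → v ∈ᴸ L → s +ᵛ v ≈ s mod L
  +ᵛ-≈ {s} {v} p = congruent (subst (_∈ᴸ L) (sym (+ᵛ-cancelˡ s v)) p)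

  black-≈ : ∀ {s r} → s ≈ r mod L → black s ≡ black r
  black-≈ {s} {r} p with ≈-translate p
  ... | v , v∈L , s≡r+v = trans (cong black s≡r+v) (black-periodic L {r} v∈L)

-- Division by the reduced basis and the fundamental domain

module _ {L : ValidLattice} (B : ReducedBasis L) where
  open ReducedBasis B

  private instance
    x₀-nonZero : ℕ.NonZero x₀
    x₀-nonZero = ℕ.>-nonZero x₀-pos
    y₁-nonZero : ℕ.NonZero y₁
    y₁-nonZero = ℕ.>-nonZero y₁-pos

  -- Rows of the torus close up compatibly with the coloring; an even distance between two squares
  -- of a row is thus even in both directions around the row.
  x₀-even : odd (+ x₀) ≡ false
  x₀-even = trans (∈ᴸ-parity L x₀-mem) (even⇒¬odd {n = 0ℤ} (divides 0ℤ refl))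

  opaque
    -- Division of the second coordinate by `y₁` and then of the first by `x₀`: minimality forces
    -- both remainders to vanish.
    generate : ∀ {v} → v ∈ᴸ L → ∃₂ λ m n → v ≡ m ·ᵛ v₀ +ᵛ n ·ᵛ v₁
    generate {x , y} v∈L = x′ /ℕ x₀ , q , cong₂ _,_ x-eq y-eq
      where
      q x′ : ℤ
      q = y /ℕ y₁
      x′ = x - q * + x₁
      residue-zero : ∀ {P : ℕ → Set} (n : ℤ) (d : ℕ) .{{_ : ℕ.NonZero d}} →
                     (∀ {k} → 0 ℕ.< k → P k → d ℕ.≤ k) → P (n %ℕ d) → n ≡ (n /ℕ d) * + d
      residue-zero n d minimal p with n %ℕ d | a≡a%ℕn+[a/ℕn]*n n d | n%ℕd<d n d
      ... | ℕ.zero  | eq | _   = trans eq (ℤ.+-identityˡ ((n /ℕ d) * + d))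
      ... | ℕ.suc k | _  | k<d = contradiction (minimal (s≤s z≤n) p) (ℕ.<⇒≱ k<d)
      subtract : ∀ y r c → y ≡ r + c → y + - c ≡ r
      subtract _ r c refl = i r c
        where
        i : ∀ r c → (r + c) + - c ≡ r
        i = solve-∀
      neg : ∀ x q a → x + (- q) * a ≡ x - q * a
      neg = solve-∀
      r₁∈L : (x′ , + (y %ℕ y₁)) ∈ᴸ L
      r₁∈L = subst (_∈ᴸ L)
        (cong₂ _,_ (neg x q (+ x₁))
          (trans (neg y q (+ y₁)) (subtract y (+ (y %ℕ y₁)) (q * + y₁) (a≡a%ℕn+[a/ℕn]*n y y₁))))
        (∈ᴸ-+ L v∈L (∈ᴸ-· L (- q) v₁-mem))
      y≡ : y ≡ q * + y₁
      y≡ = residue-zero {λ k → (x′ , + k) ∈ᴸ L} y y₁ y₁-minimal r₁∈L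
      cancel : ∀ c → c + - c ≡ 0ℤ
      cancel = ℤ.+-inverseʳ
      x′∈L : (x′ , 0ℤ) ∈ᴸ L
      x′∈L = subst (_∈ᴸ L)
        (cong₂ _,_ (neg x q (+ x₁))
          (trans (neg y q (+ y₁)) (subtract y 0ℤ (q * + y₁) (trans y≡ (sym (ℤ.+-identityˡ (q * + y₁)))))))
        (∈ᴸ-+ L v∈L (∈ᴸ-· L (- q) v₁-mem))
      q₀ : ℤ
      q₀ = x′ /ℕ x₀
      r₀∈L : (+ (x′ %ℕ x₀) , 0ℤ) ∈ᴸ L
      r₀∈L = subst (_∈ᴸ L)
        (cong₂ _,_ (trans (neg x′ q₀ (+ x₀)) (subtract x′ (+ (x′ %ℕ x₀)) (q₀ * + x₀) (a≡a%ℕn+[a/ℕn]*n x′ x₀)))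
                   (trans (ℤ.+-identityˡ ((- q₀) * 0ℤ)) (ℤ.*-zeroʳ (- q₀))))
        (∈ᴸ-+ L x′∈L (∈ᴸ-· L (- q₀) x₀-mem))
      x′≡ : x′ ≡ q₀ * + x₀
      x′≡ = residue-zero {λ k → (+ k , 0ℤ) ∈ᴸ L} x′ x₀ x₀-minimal r₀∈L
      restore : ∀ x a → x ≡ (x - a) + a
      restore = solve-∀
      x-eq : x ≡ q₀ * + x₀ + q * + x₁
      x-eq = trans (restore x (q * + x₁)) (cong (_+ q * + x₁) x′≡)
      y-eq : y ≡ q₀ * 0ℤ + q * + y₁
      y-eq = trans y≡ (sym (trans (cong (_+ q * + y₁) (ℤ.*-zeroʳ q₀)) (ℤ.+-identityˡ (q * + y₁))))

  opaque
    -- The same two divisions as in `generate`, with the remainders kept as the coordinates of the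
    -- representative.
    reduction : ∀ s → ∃[ r ] r ∈ Domain × s ≈ r mod L
    reduction (x , y) =
      (+ (x′ %ℕ x₀) , + (y %ℕ y₁)) ,
      ((ℤ.+≤+ z≤n , ℤ.+<+ (n%ℕd<d x′ x₀)) , (ℤ.+≤+ z≤n , ℤ.+<+ (n%ℕd<d y y₁))) ,
      congruent (subst (_∈ᴸ L) (cong₂ _,_ x-eq y-eq) (∈ᴸ-+ L (∈ᴸ-· L q₀ x₀-mem) (∈ᴸ-· L q v₁-mem)))
      where
      q x′ q₀ : ℤ
      q = y /ℕ y₁
      x′ = x - q * + x₁
      q₀ = x′ /ℕ x₀
      subtract : ∀ y r c → y ≡ r + c → c ≡ y - r
      subtract _ r c refl = i r c
        where
        i : ∀ r c → c ≡ (r + c) - r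
        i = solve-∀
      shuffle : ∀ x a r → ((x - a) - r) + a ≡ x - r
      shuffle = solve-∀
      x-eq : q₀ * + x₀ + q * + x₁ ≡ x - + (x′ %ℕ x₀)
      x-eq = trans (cong (_+ q * + x₁) (subtract x′ (+ (x′ %ℕ x₀)) (q₀ * + x₀) (a≡a%ℕn+[a/ℕn]*n x′ x₀)))
                   (shuffle x (q * + x₁) (+ (x′ %ℕ x₀)))
      y-eq : q₀ * 0ℤ + q * + y₁ ≡ y - + (y %ℕ y₁)
      y-eq = trans (cong (_+ q * + y₁) (ℤ.*-zeroʳ q₀)) (trans (ℤ.+-identityˡ (q * + y₁))
                   (subtract y (+ (y %ℕ y₁)) (q * + y₁) (a≡a%ℕn+[a/ℕn]*n y y₁)))

  reduce : ℤ² → ℤ²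
  reduce s = proj₁ (reduction s)

  reduce-∈ : ∀ s → reduce s ∈ Domain
  reduce-∈ s = proj₁ (proj₂ (reduction s))

  reduce-≈ : ∀ s → s ≈ reduce s mod L
  reduce-≈ s = proj₂ (proj₂ (reduction s))

  -- Coordinates of points of the domain differ by less than the minimal steps. Minimality speaks of
  -- positive steps, so r - s and s - r are both used; the second coordinates come first, as
  -- `x₀-minimal` applies only to vectors along a row.
  Domain-unique : ∀ {r s} → r ∈ Domain → s ∈ Domain → r ≈ s mod L → r ≡ s
  Domain-unique {a , b} {c , d} ((0≤a , a<x₀) , (0≤b , b<y₁)) ((0≤c , c<x₀) , (0≤d , d<y₁)) r∼s =
    cong₂ _,_ (ℤ.i-j≡0⇒i≡j a c a-c≡0) (ℤ.i-j≡0⇒i≡j b d b-d≡0)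
    where
    small : ∀ {P : ℤ → Set} {N} a c → 0ℤ ℤ.≤ a → a ℤ.< + N → 0ℤ ℤ.≤ c → c ℤ.< + N →
            (∀ {k} → 0 ℕ.< k → P (+ k) → N ℕ.≤ k) → P (a - c) → P (c - a) → a - c ≡ 0ℤ
    small {P} {N} a c 0≤a a<N 0≤c c<N minimal p q with a - c in eq | c - a in eq′
    ... | +0       | _ = refl
    ... | +[1+ k ] | _ = contradiction (minimal (s≤s z≤n) p) (ℕ.<⇒≱ (ℤ.drop‿+<+ (subst (ℤ._< + N) eq
            (ℤ.≤-<-trans (ℤ.≤-trans (ℤ.+-monoʳ-≤ a (ℤ.neg-mono-≤ 0≤c)) (ℤ.≤-reflexive (ℤ.+-identityʳ a))) a<N))))
    ... | -[1+ k ] | +[1+ l ] = contradiction (minimal (s≤s z≤n) q) (ℕ.<⇒≱ (ℤ.drop‿+<+ (subst (ℤ._< + N) eq′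
            (ℤ.≤-<-trans (ℤ.≤-trans (ℤ.+-monoʳ-≤ c (ℤ.neg-mono-≤ 0≤a)) (ℤ.≤-reflexive (ℤ.+-identityʳ c))) c<N))))
    ... | -[1+ k ] | +0       = contradiction (trans (sym eq) (trans (flip a c) (cong -_ eq′))) λ ()
      where
      flip : ∀ a c → a - c ≡ - (c - a)
      flip = solve-∀
    ... | -[1+ k ] | -[1+ l ] = contradiction (trans (sym eq) (trans (flip a c) (cong -_ eq′))) λ ()
      where
      flip : ∀ a c → a - c ≡ - (c - a)
      flip = solve-∀
    r≈s = difference r∼s
    s≈r = difference (≈-sym r∼s)
    b-d≡0 : b - d ≡ 0ℤ
    b-d≡0 = small {λ y → ∃[ x ] (x , y) ∈ᴸ L} b d 0≤b b<y₁ 0≤d d<y₁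
              (λ k>0 (x , p) → y₁-minimal k>0 p) (a - c , r≈s) (c - a , s≈r)
    a-c≡0 : a - c ≡ 0ℤ
    a-c≡0 = small {λ x → (x , 0ℤ) ∈ᴸ L} a c 0≤a a<x₀ 0≤c c<x₀ x₀-minimal
              (subst (λ y → (a - c , y) ∈ᴸ L) b-d≡0 r≈s)
              (subst (λ y → (c - a , y) ∈ᴸ L) (trans (flip d b) (cong -_ b-d≡0)) s≈r)
      where
      flip : ∀ d b → d - b ≡ - (b - d)
      flip = solve-∀

  module _ {P : Pred Square _} {m} (c : Enumeration (λ s → s ∈ Domain × s ∈ P) m) where
    open Enumeration c

    at-unique : ∀ {i j} → at i ≈ at j mod L → i ≡ j
    at-unique {i} {j} p = injective (Domain-unique (proj₁ (member i)) (proj₁ (member j)) p)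

    at-index : ∀ s → reduce s ∈ P → ∃[ i ] s ≈ at i mod L
    at-index s r∈P with exhaustive (reduce-∈ s , r∈P)
    ... | i , eq = i , ≈-trans (reduce-≈ s) (≈-reflexive (sym eq))

-- Tilings, direction fields and matchings

data Dir : Set where
  up dn lt rt : Dir

infix 4 _≟ᵈ_
_≟ᵈ_ : (d e : Dir) → Dec (d ≡ e)
up ≟ᵈ up = yes refl
up ≟ᵈ dn = no λ ()
up ≟ᵈ lt = no λ ()
up ≟ᵈ rt = no λ ()
dn ≟ᵈ up = no λ ()
dn ≟ᵈ dn = yes refl
dn ≟ᵈ lt = no λ ()
dn ≟ᵈ rt = no λ ()
lt ≟ᵈ up = no λ ()
lt ≟ᵈ dn = no λ ()
lt ≟ᵈ lt = yes refl
lt ≟ᵈ rt = no λ ()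
rt ≟ᵈ up = no λ ()
rt ≟ᵈ dn = no λ ()
rt ≟ᵈ lt = no λ ()
rt ≟ᵈ rt = yes refl

opposite : Dir → Dir
opposite up = dn
opposite dn = up
opposite lt = rt
opposite rt = lt

opposite-involutive : ∀ d → opposite (opposite d) ≡ d
opposite-involutive up = refl
opposite-involutive dn = refl
opposite-involutive lt = refl
opposite-involutive rt = refl

next : Square → Dir → Square
next s up = s +ᵛ unit ver
next s dn = s -ᵛ unit ver
next s lt = s -ᵛ unit hor
next s rt = s +ᵛ unit hor

domino : Square → Dir → Domino
domino s up = s , ver
domino s dn = s -ᵛ unit ver , ver
domino s lt = s -ᵛ unit hor , hor
domino s rt = s , hor

forward : Axis → Dir
forward hor = rt
forward ver = up

domino-forward : ∀ s a → domino s (forward a) ≡ (s , a)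
domino-forward s hor = refl
domino-forward s ver = refl

next-opposite : ∀ s d → next (next s d) (opposite d) ≡ s
next-opposite s up = +ᵛ--ᵛ s (unit ver)
next-opposite s dn = -ᵛ-+ᵛ s (unit ver)
next-opposite s lt = -ᵛ-+ᵛ s (unit hor)
next-opposite s rt = +ᵛ--ᵛ s (unit hor)

domino-next : ∀ s d → domino (next s d) (opposite d) ≡ domino s d
domino-next s up = cong (_, ver) (+ᵛ--ᵛ s (unit ver))
domino-next s dn = refl
domino-next s lt = refl
domino-next s rt = cong (_, hor) (+ᵛ--ᵛ s (unit hor))

next-translate : ∀ s d v → next (s +ᵛ v) d ≡ next s d +ᵛ v
next-translate s up v = +ᵛ-swap s v (unit ver)
next-translate s dn v = sym (-ᵛ-swap s (unit ver) v)
next-translate s lt v = sym (-ᵛ-swap s (unit hor) v)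
next-translate s rt v = +ᵛ-swap s v (unit hor)

∈ᵈ⇒domino : ∀ {s d} → s ∈ᵈ d → ∃[ x ] d ≡ domino s x
∈ᵈ⇒domino {s} {r , a}   (inj₁ refl) = forward a , sym (domino-forward s a)
∈ᵈ⇒domino {s} {r , hor} (inj₂ refl) = lt , cong (_, hor) (sym (+ᵛ--ᵛ r (unit hor)))
∈ᵈ⇒domino {s} {r , ver} (inj₂ refl) = dn , cong (_, ver) (sym (+ᵛ--ᵛ r (unit ver)))

∈ᵈ-domino : ∀ s d → s ∈ᵈ domino s d
∈ᵈ-domino s up = inj₁ refl
∈ᵈ-domino s dn = inj₂ (sym (-ᵛ-+ᵛ s (unit ver)))
∈ᵈ-domino s lt = inj₂ (sym (-ᵛ-+ᵛ s (unit hor)))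
∈ᵈ-domino s rt = inj₁ refl

black-next : ∀ s d → black (next s d) ≡ not (black s)
black-next s up = black-ver s
black-next s rt = black-hor s
black-next s dn = trans (sym (Bool.not-involutive _)) (cong not
  (trans (sym (black-ver (s -ᵛ unit ver))) (cong black (-ᵛ-+ᵛ s (unit ver)))))
black-next s lt = trans (sym (Bool.not-involutive _)) (cong not
  (trans (sym (black-hor (s -ᵛ unit hor))) (cong black (-ᵛ-+ᵛ s (unit hor)))))

next≢ : ∀ s d → next s d ≢ s
next≢ s d eq = contradiction (trans (sym (cong black eq)) (black-next s d)) (Bool.not-¬ refl)

domino-injective : ∀ s {d e} → domino s d ≡ domino s e → d ≡ e
domino-injective s {d} {e} eq with d ≟ᵈ e
... | yes d≡e = d≡e
domino-injective s {up} {up} eq | no _ = refl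
domino-injective s {dn} {dn} eq | no _ = refl
domino-injective s {lt} {lt} eq | no _ = refl
domino-injective s {rt} {rt} eq | no _ = refl
domino-injective s {up} {dn} eq | no _ = contradiction (sym (cong proj₁ eq)) (next≢ s dn)
domino-injective s {dn} {up} eq | no _ = contradiction (cong proj₁ eq) (next≢ s dn)
domino-injective s {lt} {rt} eq | no _ = contradiction (cong proj₁ eq) (next≢ s lt)
domino-injective s {rt} {lt} eq | no _ = contradiction (sym (cong proj₁ eq)) (next≢ s lt)

next-≈ : ∀ {L s r} d → s ≈ r mod L → next s d ≈ next r d mod L
next-≈ up = ≈-+ (unit ver)
next-≈ dn = ≈-- (unit ver)
next-≈ lt = ≈-- (unit hor)
next-≈ rt = ≈-+ (unit hor)

-- A tiling, seen from its squares: dir s points to the other square of the domino covering s.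
record Field (L : ValidLattice) : Set where
  field
    dir      : Square → Dir
    coherent : ∀ s → dir (next s (dir s)) ≡ opposite (dir s)
    dir-+    : ∀ {v} → v ∈ᴸ L → ∀ s → dir (s +ᵛ v) ≡ dir s

  dir-≈ : ∀ {s r} → s ≈ r mod L → dir s ≡ dir r
  dir-≈ {s} {r} s≈r with ≈-translate s≈r
  ... | v , v∈L , s≡r+v = trans (cong dir s≡r+v) (dir-+ v∈L r)

  dir-next : ∀ {s d} → dir s ≡ d → dir (next s d) ≡ opposite d
  dir-next {s} refl = coherent s

  tiles : Pred Domino _
  tiles (s , a) = dir s ≡ forward a

  ∈-tiles : ∀ {s d} → dir s ≡ d → domino s d ∈ tiles
  ∈-tiles {d = up} = λ eq → eq
  ∈-tiles {d = dn} = dir-next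
  ∈-tiles {d = lt} = dir-next
  ∈-tiles {d = rt} = λ eq → eq

  tiles-∈ : ∀ {s d} → domino s d ∈ tiles → dir s ≡ d
  tiles-∈ {s} {up} eq = eq
  tiles-∈ {s} {dn} eq = trans (cong dir (sym (-ᵛ-+ᵛ s (unit ver)))) (dir-next eq)
  tiles-∈ {s} {lt} eq = trans (cong dir (sym (-ᵛ-+ᵛ s (unit hor)))) (dir-next eq)
  tiles-∈ {s} {rt} eq = eq

  tiling : TorusTiling L
  tiling = record
    { dominoes = tiles
    ; isTiling = record
      { covers   = λ s → domino s (dir s) , ∈-tiles refl , ∈ᵈ-domino s (dir s)
      ; disjoint = disjoint
      }
    ; periodic = λ {v} {s} v∈L eq → trans (dir-+ v∈L s) eq
    }
    where
    disjoint : ∀ {d e s} → d ∈ tiles → e ∈ tiles → s ∈ᵈ d → s ∈ᵈ e → d ≡ e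
    disjoint {d} {e} {s} d∈ e∈ s∈d s∈e with ∈ᵈ⇒domino {s} {d} s∈d | ∈ᵈ⇒domino {s} {e} s∈e
    ... | x , refl | y , refl =
      cong (domino s) (trans (sym (tiles-∈ {s} {x} d∈)) (tiles-∈ {s} {y} e∈))

open Field public using (dir; tiles; tiling)

module _ {L : ValidLattice} (t : TorusTiling L) where
  open IsTiling (isTiling t)

  private
    found : ∀ s → ∃[ d ] domino s d ∈ dominoes t
    found s with covers s
    ... | d , d∈t , s∈d with ∈ᵈ⇒domino {s} {d} s∈d
    ...   | x , refl = x , d∈t

    found-unique : ∀ s {d} → domino s d ∈ dominoes t → proj₁ (found s) ≡ d
    found-unique s {d} d∈t = domino-injective s
      (disjoint (proj₂ (found s)) d∈t (∈ᵈ-domino s (proj₁ (found s))) (∈ᵈ-domino s d))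

    translate : ∀ {v} → v ∈ᴸ L → ∀ s d → domino s d ∈ dominoes t → domino (s +ᵛ v) d ∈ dominoes t
    translate v∈L s up p = periodic t v∈L p
    translate {v} v∈L s dn p = subst (λ r → (r , ver) ∈ dominoes t) (-ᵛ-swap s (unit ver) v) (periodic t v∈L p)
    translate {v} v∈L s lt p = subst (λ r → (r , hor) ∈ dominoes t) (-ᵛ-swap s (unit hor) v) (periodic t v∈L p)
    translate v∈L s rt p = periodic t v∈L p

  fieldOf : Field L
  fieldOf = record
    { dir      = proj₁ ∘ found
    ; coherent = λ s → found-unique _ (subst (_∈ dominoes t) (sym (domino-next s _)) (proj₂ (found s)))
    ; dir-+    = λ {v} v∈L s → found-unique (s +ᵛ v) (translate v∈L s _ (proj₂ (found s)))
    }

  fieldOf-domino : ∀ s → domino s (dir fieldOf s) ∈ dominoes t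
  fieldOf-domino s = proj₂ (found s)

  fieldOf-unique : ∀ s {d} → domino s d ∈ dominoes t → dir fieldOf s ≡ d
  fieldOf-unique = found-unique

  fieldOf-∈ : ∀ {s a} → dir fieldOf s ≡ forward a → (s , a) ∈ dominoes t
  fieldOf-∈ {s} {a} eq = subst (_∈ dominoes t)
    (trans (cong (domino s) eq) (domino-forward s a)) (proj₂ (found s))

  ∈-fieldOf : ∀ {s a} → (s , a) ∈ dominoes t → dir fieldOf s ≡ forward a
  ∈-fieldOf {s} {a} p = found-unique s (subst (_∈ dominoes t) (sym (domino-forward s a)) p)

module _ {L : ValidLattice} (B : ReducedBasis L) where
  open ReducedBasis B
  open Enumeration

  module _ {m} (b : Enumeration BlackDomain m) (w : Enumeration WhiteDomain m) where

    -- A term of the expanded determinant before its sign and weight are taken. The permutation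
    -- alone would not do: on a small torus several edges at one black square may end at translates
    -- of the same white square.
    record Matching : Set where
      field
        dirs : Fin m → Dir
        perm : Permutation′ m
        join : ∀ i → next (at b i) (dirs i) ≈ at w (perm ⟨$⟩ʳ i) mod L

    open Matching

    black-b : ∀ i → black (at b i) ≡ true
    black-b i = ∈⇒black (proj₂ (member b i))

    black-w : ∀ j → black (at w j) ≡ false
    black-w j = ∈⇒white (proj₂ (member w j))

    blackIndex : ∀ {s} → black s ≡ true → ∃[ i ] s ≈ at b i mod L
    blackIndex {s} eq = at-index B b s (black⇒∈ (trans (sym (black-≈ (reduce-≈ B s))) eq))

    whiteIndex : ∀ {s} → black s ≡ false → ∃[ j ] s ≈ at w j mod L
    whiteIndex {s} eq = at-index B w s (white⇒∈ (trans (sym (black-≈ (reduce-≈ B s))) eq))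

    blackIndex-unique : ∀ {s i j} → s ≈ at b i mod L → s ≈ at b j mod L → i ≡ j
    blackIndex-unique p q = at-unique B b (≈-trans (≈-sym p) q)

    whiteIndex-unique : ∀ {s i j} → s ≈ at w i mod L → s ≈ at w j mod L → i ≡ j
    whiteIndex-unique p q = at-unique B w (≈-trans (≈-sym p) q)

    next-black : ∀ {s} d → black s ≡ true → black (next s d) ≡ false
    next-black {s} d eq = trans (black-next s d) (cong not eq)

    next-white : ∀ {s} d → black s ≡ false → black (next s d) ≡ true
    next-white {s} d eq = trans (black-next s d) (cong not eq)

    module _ (F : Field L) where
      private
        to : ∀ i → ∃[ j ] next (at b i) (dir F (at b i)) ≈ at w j mod L
        to i = whiteIndex (next-black (dir F (at b i)) (black-b i))

        from : ∀ j → ∃[ i ] next (at w j) (dir F (at w j)) ≈ at b i mod L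
        from j = blackIndex (next-white (dir F (at w j)) (black-w j))

        back : ∀ {s r} → next s (dir F s) ≈ r mod L → s ≈ next r (dir F r) mod L
        back {s} {r} p = subst₂ (λ q d → q ≈ next r d mod L) (next-opposite s _)
          (trans (sym (Field.coherent F s)) (Field.dir-≈ F p)) (next-≈ _ p)

      matching : Matching
      matching = record
        { dirs = dir F ∘ at b
        ; perm = Perm.permutation (proj₁ ∘ to) (proj₁ ∘ from)
            (λ j → whiteIndex-unique (proj₂ (to _)) (≈-sym (back (proj₂ (from j)))))
            (λ i → blackIndex-unique (proj₂ (from _)) (≈-sym (back (proj₂ (to i)))))
        ; join = proj₂ ∘ to
        }

    module _ (M : Matching) where
      private
        partner : Fin m → Fin m
        partner j = perm M ⟨$⟩ˡ j

        join′ : ∀ j → next (at b (partner j)) (dirs M (partner j)) ≈ at w j mod L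
        join′ j = subst (λ k → next (at b (partner j)) (dirs M (partner j)) ≈ at w k mod L)
          (Perm.inverseʳ (perm M)) (join M (partner j))

        dirOf : ∀ s c → black s ≡ c → Dir
        dirOf s true  eq = dirs M (proj₁ (blackIndex eq))
        dirOf s false eq = opposite (dirs M (partner (proj₁ (whiteIndex eq))))

        direction : Square → Dir
        direction s = dirOf s (black s) refl

      direction-black : ∀ {s i} → s ≈ at b i mod L → direction s ≡ dirs M i
      direction-black {s} {i} s≈b = go (black s) refl
        where
        go : ∀ c (eq : black s ≡ c) → dirOf s c eq ≡ dirs M i
        go true  eq = cong (dirs M) (blackIndex-unique (proj₂ (blackIndex eq)) s≈b)
        go false eq = contradiction (trans (sym eq) (trans (black-≈ s≈b) (black-b i))) λ ()

      direction-white : ∀ {s j} → s ≈ at w j mod L → direction s ≡ opposite (dirs M (partner j))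
      direction-white {s} {j} s≈w = go (black s) refl
        where
        go : ∀ c (eq : black s ≡ c) → dirOf s c eq ≡ opposite (dirs M (partner j))
        go true  eq = contradiction (trans (sym eq) (trans (black-≈ s≈w) (black-w j))) λ ()
        go false eq = cong (opposite ∘ dirs M ∘ partner) (whiteIndex-unique (proj₂ (whiteIndex eq)) s≈w)

      private
        direction-≈ : ∀ {s r} → s ≈ r mod L → direction s ≡ direction r
        direction-≈ {s} {r} s≈r = go (black r) refl
          where
          go : ∀ c → black r ≡ c → direction s ≡ direction r
          go true  eq = let i , p = blackIndex eq in
            trans (direction-black (≈-trans s≈r p)) (sym (direction-black p))
          go false eq = let j , p = whiteIndex eq in
            trans (direction-white (≈-trans s≈r p)) (sym (direction-white p))

        direction-coherent : ∀ s d → direction s ≡ d → direction (next s d) ≡ opposite d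
        direction-coherent s d eqᵈ = go (black s) refl
          where
          go : ∀ c → black s ≡ c → direction (next s d) ≡ opposite d
          go true eq = trans (direction-white s′≈w)
                             (cong opposite (trans (cong (dirs M) (Perm.inverseˡ (perm M))) d-eq))
            where
            i = proj₁ (blackIndex eq)
            p = proj₂ (blackIndex eq)
            d-eq : dirs M i ≡ d
            d-eq = trans (sym (direction-black p)) eqᵈ
            s′≈w : next s d ≈ at w (perm M ⟨$⟩ʳ i) mod L
            s′≈w = ≈-trans (next-≈ d p) (subst (λ e → next (at b i) e ≈ at w (perm M ⟨$⟩ʳ i) mod L) d-eq (join M i))
          go false eq = trans (direction-black s′≈b) (trans (sym (opposite-involutive _)) (cong opposite d-eq))
            where
            j = proj₁ (whiteIndex eq)
            p = proj₂ (whiteIndex eq)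
            i = partner j
            d-eq : opposite (dirs M i) ≡ d
            d-eq = trans (sym (direction-white p)) eqᵈ
            s′≈b : next s d ≈ at b i mod L
            s′≈b = ≈-trans (next-≈ d (≈-trans p (≈-sym (join′ j))))
              (≈-reflexive (trans (cong (next (next (at b i) (dirs M i))) (sym d-eq))
                                  (next-opposite (at b i) (dirs M i))))

      matchedField : Field L
      matchedField = record
        { dir      = direction
        ; coherent = λ s → direction-coherent s (direction s) refl
        ; dir-+    = λ v∈L s → direction-≈ (+ᵛ-≈ v∈L)
        }

    -- Every square is equivalent to a black bᵢ, or the partner of a translate of one.
    dir-determined : ∀ (F G : Field L) → (∀ i → dir F (at b i) ≡ dir G (at b i)) → dir F ≗ dir G
    dir-determined F G eq s = go (black s) refl
      where
      onBlack : ∀ {r} → black r ≡ true → dir F r ≡ dir G r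
      onBlack p = let i , r≈b = blackIndex p in trans (Field.dir-≈ F r≈b) (trans (eq i) (sym (Field.dir-≈ G r≈b)))
      go : ∀ c → black s ≡ c → dir F s ≡ dir G s
      go true  p = onBlack p
      go false p = begin
        dir F s                        ≡⟨ sym (opposite-involutive _) ⟩
        opposite (opposite (dir F s))  ≡⟨ cong opposite (sym (Field.coherent F s)) ⟩
        opposite (dir F r)             ≡⟨ cong opposite (onBlack (next-white (dir F s) p)) ⟩
        opposite (dir G r)             ≡⟨ sym (Field.coherent G r) ⟩
        dir G (next r (dir G r))       ≡⟨ cong (λ d → dir G (next r d))
                                              (trans (sym (onBlack (next-white (dir F s) p))) (Field.coherent F s)) ⟩
        dir G (next r (opposite (dir F s))) ≡⟨ cong (dir G) (next-opposite s (dir F s)) ⟩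
        dir G s                        ∎
        where
        open ≡-Reasoning
        r = next s (dir F s)

-- Height functions

module +-group = GroupProperties (AbelianGroup.group ℤ.+-0-abelianGroup)

ℤ-induction : (P : ℤ → Set) → P 0ℤ → (∀ k → P k → P (k + 1ℤ)) → (∀ k → P (k + 1ℤ) → P k) → ∀ k → P k
ℤ-induction P base step back +0       = base
ℤ-induction P base step back +[1+ n ] =
  subst P (cong +_ (ℕ.+-comm n 1)) (step (+ n) (ℤ-induction P base step back (+ n)))
ℤ-induction P base step back -[1+ ℕ.zero ]  = back -[1+ 0 ] base
ℤ-induction P base step back -[1+ ℕ.suc n ] = back -[1+ ℕ.suc n ] (ℤ-induction P base step back -[1+ n ])

-- The discrete primitive of f on all of ℤ that vanishes at 0.
antidifference : (ℤ → ℤ) → ℤ → ℤ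
antidifference f +0                 = 0ℤ
antidifference f +[1+ n ]           = antidifference f (+ n) + f (+ n)
antidifference f -[1+ ℕ.zero ]      = 0ℤ - f -[1+ 0 ]
antidifference f -[1+ ℕ.suc n ]     = antidifference f -[1+ n ] - f -[1+ ℕ.suc n ]

antidifference-step : ∀ f k → antidifference f (k + 1ℤ) ≡ antidifference f k + f k
antidifference-step f (+ n)              = cong (λ k → antidifference f (+ k)) (ℕ.+-comm n 1)
antidifference-step f -[1+ ℕ.zero ]      = cancel 0ℤ (f -[1+ 0 ])
  where
  cancel : ∀ a b → a ≡ (a - b) + b
  cancel = solve-∀
antidifference-step f -[1+ ℕ.suc n ]     = cancel (antidifference f -[1+ n ]) (f -[1+ ℕ.suc n ])
  where
  cancel : ∀ a b → a ≡ (a - b) + b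
  cancel = solve-∀

+ᵛ-hor : ∀ (x y : ℤ) → (x , y) +ᵛ unit hor ≡ (x + 1ℤ , y)
+ᵛ-hor x y = cong (x + 1ℤ ,_) (ℤ.+-identityʳ y)

+ᵛ-ver : ∀ (x y : ℤ) → (x , y) +ᵛ unit ver ≡ (x , y + 1ℤ)
+ᵛ-ver x y = cong (_, y + 1ℤ) (ℤ.+-identityʳ x)

locally-constant : ∀ (f : ℤ² → ℤ) → (∀ p a → f (p +ᵛ unit a) ≡ f p) → ∀ p → f p ≡ f 0ᵛ
locally-constant f eq (x , y) = trans (column y) (row x)
  where
  hor-step : ∀ x → f (x + 1ℤ , 0ℤ) ≡ f (x , 0ℤ)
  hor-step x = trans (cong f (sym (+ᵛ-hor x 0ℤ))) (eq (x , 0ℤ) hor)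
  ver-step : ∀ y → f (x , y + 1ℤ) ≡ f (x , y)
  ver-step y = trans (cong f (sym (+ᵛ-ver x y))) (eq (x , y) ver)
  row : ∀ x → f (x , 0ℤ) ≡ f 0ᵛ
  row = ℤ-induction (λ x → f (x , 0ℤ) ≡ f 0ᵛ) refl
    (λ k → trans (hor-step k)) (λ k → trans (sym (hor-step k)))
  column : ∀ y → f (x , y) ≡ f (x , 0ℤ)
  column = ℤ-induction (λ y → f (x , y) ≡ f (x , 0ℤ)) refl
    (λ k → trans (ver-step k)) (λ k → trans (sym (ver-step k)))

⟦_⟧ : Bool → ℤ
⟦ true ⟧  = 1ℤ
⟦ false ⟧ = 0ℤ

sign : Bool → ℤ
sign true  = 1ℤ
sign false = -1ℤ

-- The square with corner p is adjacent to the edge `(p , a)`; this is the direction from that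
-- square across the edge.
crossDir : Axis → Dir
crossDir hor = dn
crossDir ver = lt

crossing-domino : ∀ p a → crossing (p , a) ≡ domino p (crossDir a)
crossing-domino p hor = refl
crossing-domino p ver = refl

black-rightOf : ∀ e → black (rightOf e) ≡ not (black (leftOf e))
black-rightOf (p , hor) = black-next p dn
black-rightOf (p , ver) = trans (sym (Bool.not-involutive _)) (cong not (sym (black-next p lt)))

module _ {L : ValidLattice} (F : Field L) where

  points : Square → Dir → Bool
  points s d = does (dir F s ≟ᵈ d)

  -- With a black square on the left, an edge is traversed against its orientation.
  increment : GridEdge → ℤ
  increment (p , a) = sign (black (leftOf (p , a))) * (+ 4 * ⟦ points p (crossDir a) ⟧ - 1ℤ)

  -- The height condition with every edge traversed in its positive direction rather than along its
  -- orientation, so that increments can be summed along lattice paths.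
  record IsPotential (h : ℤ² → ℤ) : Set where
    field
      origin : h 0ᵛ ≡ 0ℤ
      step   : ∀ p a → h (p +ᵛ unit a) ≡ h p + increment (p , a)

  points-next : ∀ s d → points (next s d) (opposite d) ≡ points s d
  points-next s d with dir F s ≟ᵈ d
  ... | yes eq = dec-true (_ ≟ᵈ _) (Field.dir-next F eq)
  ... | no neq = dec-false (_ ≟ᵈ _) λ eq → neq (trans
    (trans (cong (dir F) (sym (next-opposite s d))) (Field.dir-next F eq)) (opposite-involutive d))

  private
    from-crossed : ∀ {x y : ℤ} → x ≡ y - + 3 → y ≡ x + + 3
    from-crossed {_} {y} refl = i y
      where
      i : ∀ y → y ≡ (y - + 3) + + 3
      i = solve-∀
    from-uncrossed : ∀ {x y : ℤ} → x ≡ y + 1ℤ → y ≡ x + -1ℤ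
    from-uncrossed {_} {y} refl = i y
      where
      i : ∀ y → y ≡ (y + 1ℤ) + -1ℤ
      i = solve-∀

  height⇒potential : ∀ {h} → IsHeight (tiles F) h → IsPotential h
  height⇒potential {h} ht = record { origin = origin ; step = λ p a → edge p a (black (leftOf (p , a))) refl }
    where
    open IsHeight ht
    edge : ∀ p a c → black (leftOf (p , a)) ≡ c →
           h (p +ᵛ unit a) ≡ h p + sign (black (leftOf (p , a))) * (+ 4 * ⟦ points p (crossDir a) ⟧ - 1ℤ)
    edge p a c c-eq = subst (λ c → h (p +ᵛ unit a) ≡ h p + sign c * (+ 4 * ⟦ points p (crossDir a) ⟧ - 1ℤ)) (sym c-eq)
                        (by-membership (dir F p ≟ᵈ crossDir a))
      where
      right : does (black? (rightOf (p , a))) ≡ not c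
      right = trans (does-black (rightOf (p , a))) (trans (black-rightOf (p , a)) (cong not c-eq))
      ends : (R : ℤ² → ℤ² → Set) → R (head (p , a)) (tail (p , a)) →
             R (if not c then p +ᵛ unit a else p) (if not c then p else p +ᵛ unit a)
      ends R = subst (λ c → R (if c then p +ᵛ unit a else p) (if c then p else p +ᵛ unit a)) right
      by-membership : (D : Dec (dir F p ≡ crossDir a)) →
                 h (p +ᵛ unit a) ≡ h p + sign c * (+ 4 * ⟦ does D ⟧ - 1ℤ)
      by-membership (yes eq) = go c (ends (λ q r → h q ≡ h r - + 3)
          (crossed (p , a) (subst (_∈ tiles F) (sym (crossing-domino p a)) (Field.∈-tiles F eq))))
        where
        go : ∀ c → h (if not c then p +ᵛ unit a else p) ≡ h (if not c then p else p +ᵛ unit a) - + 3 →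
             h (p +ᵛ unit a) ≡ h p + sign c * + 3
        go true  = from-crossed
        go false = λ eq → eq
      by-membership (no neq) = go c (ends (λ q r → h q ≡ h r + 1ℤ)
          (uncrossed (p , a) λ p∈ → neq (Field.tiles-∈ F (subst (_∈ tiles F) (crossing-domino p a) p∈))))
        where
        go : ∀ c → h (if not c then p +ᵛ unit a else p) ≡ h (if not c then p else p +ᵛ unit a) + 1ℤ →
             h (p +ᵛ unit a) ≡ h p + sign c * -1ℤ
        go true  = from-uncrossed
        go false = λ eq → eq

  potential⇒height : ∀ {h} → IsPotential h → IsHeight (tiles F) h
  potential⇒height {h} pot = record
    { origin    = IsPotential.origin pot
    ; uncrossed = λ e@(p , a) e∉ → edge e (λ r x y → r ≡ false → x ≡ y + 1ℤ)
        (λ { {true} x ()  ; {false} x _ → i₁ x }) (λ { {true} x () ; {false} x _ → refl })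
        (dec-false (_ ≟ᵈ _) λ eq → e∉ (subst (_∈ tiles F) (sym (crossing-domino p a)) (Field.∈-tiles F eq)))
    ; crossed   = λ e@(p , a) e∈ → edge e (λ r x y → r ≡ true → x ≡ y - + 3)
        (λ { {true} x _ → i₂ x ; {false} x () }) (λ { {true} x _ → refl ; {false} x () })
        (dec-true (_ ≟ᵈ _) (Field.tiles-∈ F (subst (_∈ tiles F) (crossing-domino p a) e∈)))
    }
    where
    i₁ : ∀ x → x ≡ (x + (1ℤ * -1ℤ)) + 1ℤ
    i₁ = solve-∀
    i₂ : ∀ x → x ≡ (x + (1ℤ * + 3)) - + 3
    i₂ = solve-∀
    edge : ∀ e (P : Bool → ℤ → ℤ → Set) →
           (∀ {r} x → P r x (x + 1ℤ * (+ 4 * ⟦ r ⟧ - 1ℤ))) →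
           (∀ {r} x → P r (x + -1ℤ * (+ 4 * ⟦ r ⟧ - 1ℤ)) x) →
           P (points (proj₁ e) (crossDir (proj₂ e))) (h (head e)) (h (tail e))
    edge e@(p , a) P on-left on-right =
      subst (λ c → P r (h (if c then p +ᵛ unit a else p)) (h (if c then p else p +ᵛ unit a)))
        (sym (trans (does-black (rightOf e)) (black-rightOf e)))
        (go (black (leftOf e)) refl)
      where
      r = points p (crossDir a)
      go : ∀ c → black (leftOf e) ≡ c →
           P r (h (if not c then p +ᵛ unit a else p)) (h (if not c then p else p +ᵛ unit a))
      rise : ∀ {c} → black (leftOf e) ≡ c → h p + sign c * (+ 4 * ⟦ r ⟧ - 1ℤ) ≡ h (p +ᵛ unit a)
      rise refl = sym (IsPotential.step pot p a)
      go true  eq = subst (P r (h p)) (rise eq) (on-left {r} (h p))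
      go false eq = subst (λ y → P r y (h p)) (rise eq) (on-right {r} (h p))

  -- Exactly one of the four sides of the square p lies inside a domino.
  increment-closed : ∀ p → increment (p , hor) + increment (p +ᵛ unit hor , ver) ≡
                           increment (p , ver) + increment (p +ᵛ unit ver , hor)
  increment-closed p
    rewrite +ᵛ--ᵛ p (unit hor) | points-next p rt | points-next p up
          | black-next p lt | black-next p up = go (black p) (dir F p)
    where
    go : ∀ c d → sign c * (+ 4 * ⟦ does (d ≟ᵈ dn) ⟧ - 1ℤ) + sign c * (+ 4 * ⟦ does (d ≟ᵈ rt) ⟧ - 1ℤ) ≡
                 sign (not c) * (+ 4 * ⟦ does (d ≟ᵈ lt) ⟧ - 1ℤ) + sign (not c) * (+ 4 * ⟦ does (d ≟ᵈ up) ⟧ - 1ℤ)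
    go true  up = refl
    go true  dn = refl
    go true  lt = refl
    go true  rt = refl
    go false up = refl
    go false dn = refl
    go false lt = refl
    go false rt = refl

  -- Integration along the horizontal axis and then up the column. Vertical steps are right by
  -- construction; horizontal ones are right on the axis and spread to the other rows by
  -- `increment-closed`.
  potential : ℤ² → ℤ
  potential (x , y) = antidifference (λ k → increment ((k , 0ℤ) , hor)) x +
                      antidifference (λ k → increment ((x , k) , ver)) y

  potential-isPotential : IsPotential potential
  potential-isPotential = record { origin = refl ; step = λ { p hor → hor-step p ; p ver → ver-step p } }
    where
    X : ℤ → ℤ
    X = antidifference (λ k → increment ((k , 0ℤ) , hor))
    Y : ℤ → ℤ → ℤ
    Y x = antidifference (λ k → increment ((x , k) , ver))

    ver-step : ∀ p → potential (p +ᵛ unit ver) ≡ potential p + increment (p , ver)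
    ver-step (x , y) = begin
      potential ((x , y) +ᵛ unit ver)           ≡⟨ cong potential (+ᵛ-ver x y) ⟩
      X x + Y x (y + 1ℤ)                        ≡⟨ cong (λ c → X x + c) (antidifference-step _ y) ⟩
      X x + (Y x y + increment ((x , y) , ver)) ≡⟨ sym (ℤ.+-assoc (X x) _ _) ⟩
      potential (x , y) + increment ((x , y) , ver) ∎
      where open ≡-Reasoning

    hor-claim : ℤ → ℤ → Set
    hor-claim x y = potential (x + 1ℤ , y) ≡ potential (x , y) + increment ((x , y) , hor)

    ver-step′ : ∀ x y → potential (x , y + 1ℤ) ≡ potential (x , y) + increment ((x , y) , ver)
    ver-step′ x y = trans (cong potential (sym (+ᵛ-ver x y))) (ver-step (x , y))

    closed : ∀ x y → increment ((x , y) , hor) + increment ((x + 1ℤ , y) , ver) ≡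
                     increment ((x , y) , ver) + increment ((x , y + 1ℤ) , hor)
    closed x y = subst₂ (λ q r → increment ((x , y) , hor) + increment (q , ver) ≡
                                 increment ((x , y) , ver) + increment (r , hor))
                        (+ᵛ-hor x y) (+ᵛ-ver x y) (increment-closed (x , y))

    hor-claim-up : ∀ x y → hor-claim x y → hor-claim x (y + 1ℤ)
    hor-claim-up x y claim = begin
      potential (x + 1ℤ , y + 1ℤ)               ≡⟨ ver-step′ (x + 1ℤ) y ⟩
      potential (x + 1ℤ , y) + r                ≡⟨ cong (_+ r) claim ⟩
      (potential (x , y) + b) + r               ≡⟨ ℤ.+-assoc (potential (x , y)) b r ⟩
      potential (x , y) + (b + r)               ≡⟨ cong (λ c → potential (x , y) + c) (closed x y) ⟩
      potential (x , y) + (l + t)               ≡⟨ sym (ℤ.+-assoc (potential (x , y)) l t) ⟩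
      (potential (x , y) + l) + t               ≡⟨ cong (_+ t) (sym (ver-step′ x y)) ⟩
      potential (x , y + 1ℤ) + t                ∎
      where
      open ≡-Reasoning
      b = increment ((x , y) , hor)
      r = increment ((x + 1ℤ , y) , ver)
      l = increment ((x , y) , ver)
      t = increment ((x , y + 1ℤ) , hor)

    hor-claim-down : ∀ x y → hor-claim x (y + 1ℤ) → hor-claim x y
    hor-claim-down x y claim = +-group.∙-cancelʳ r _ _ (begin
      potential (x + 1ℤ , y) + r                ≡⟨ sym (ver-step′ (x + 1ℤ) y) ⟩
      potential (x + 1ℤ , y + 1ℤ)               ≡⟨ claim ⟩
      potential (x , y + 1ℤ) + t                ≡⟨ cong (_+ t) (ver-step′ x y) ⟩
      (potential (x , y) + l) + t               ≡⟨ ℤ.+-assoc (potential (x , y)) l t ⟩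
      potential (x , y) + (l + t)               ≡⟨ cong (λ c → potential (x , y) + c) (sym (closed x y)) ⟩
      potential (x , y) + (b + r)               ≡⟨ sym (ℤ.+-assoc (potential (x , y)) b r) ⟩
      (potential (x , y) + b) + r               ∎)
      where
      open ≡-Reasoning
      b = increment ((x , y) , hor)
      r = increment ((x + 1ℤ , y) , ver)
      l = increment ((x , y) , ver)
      t = increment ((x , y + 1ℤ) , hor)

    hor-base : ∀ x → hor-claim x 0ℤ
    hor-base x = trans (ℤ.+-identityʳ (X (x + 1ℤ))) (trans (antidifference-step _ x)
      (cong (_+ increment ((x , 0ℤ) , hor)) (sym (ℤ.+-identityʳ (X x)))))

    hor-step : ∀ p → potential (p +ᵛ unit hor) ≡ potential p + increment (p , hor)
    hor-step (x , y) = trans (cong potential (+ᵛ-hor x y))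
      (ℤ-induction (hor-claim x) (hor-base x) (hor-claim-up x) (hor-claim-down x) y)

  leftOf-translate : ∀ p a v → leftOf (p +ᵛ v , a) ≡ leftOf (p , a) +ᵛ v
  leftOf-translate p hor v = refl
  leftOf-translate p ver v = next-translate p lt v

  increment-periodic : ∀ {v} → v ∈ᴸ L → ∀ p a → increment (p +ᵛ v , a) ≡ increment (p , a)
  increment-periodic {v} v∈L p a = cong₂ (λ c d → sign c * (+ 4 * ⟦ does (d ≟ᵈ crossDir a) ⟧ - 1ℤ))
    (trans (cong black (leftOf-translate p a v)) (black-periodic L {leftOf (p , a)} v∈L))
    (Field.dir-+ F v∈L p)

  module _ {h} (pot : IsPotential h) where
    open IsPotential pot

    -- Increments are L-periodic, so h (u + v) - h u is locally constant in u and equals its value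
    -- at the origin.
    potential-+ : ∀ {v} → v ∈ᴸ L → ∀ u → h (u +ᵛ v) ≡ h u + h v
    potential-+ {v} v∈L u = begin
      h (u +ᵛ v)                  ≡⟨ restore (h (u +ᵛ v)) (h u) ⟩
      h u + (h (u +ᵛ v) - h u)    ≡⟨ cong (λ c → h u + c) (locally-constant (λ u → h (u +ᵛ v) - h u) constant u) ⟩
      h u + (h (0ᵛ +ᵛ v) - h 0ᵛ)  ≡⟨ cong₂ (λ q c → h u + (h q - c)) (cong₂ _,_ (ℤ.+-identityˡ _) (ℤ.+-identityˡ _)) origin ⟩
      h u + (h v - 0ℤ)            ≡⟨ cong (λ c → h u + c) (ℤ.+-identityʳ (h v)) ⟩
      h u + h v                   ∎
      where
      open ≡-Reasoning
      restore : ∀ a b → a ≡ b + (a - b)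
      restore = solve-∀
      cancel : ∀ a b c → (a + c) - (b + c) ≡ a - b
      cancel = solve-∀
      constant : ∀ p a → h ((p +ᵛ unit a) +ᵛ v) - h (p +ᵛ unit a) ≡ h (p +ᵛ v) - h p
      constant p a = trans
        (cong₂ _-_ (trans (cong h (+ᵛ-swap p (unit a) v))
                     (trans (step (p +ᵛ v) a) (cong (λ c → h (p +ᵛ v) + c) (increment-periodic v∈L p a))))
                   (step p a))
        (cancel (h (p +ᵛ v)) (h p) (increment (p , a)))

    potential-· : ∀ {v} → v ∈ᴸ L → ∀ m → h (m ·ᵛ v) ≡ m * h v
    potential-· {v} v∈L = ℤ-induction (λ m → h (m ·ᵛ v) ≡ m * h v) origin
      (λ m eq → trans (succ m) (trans (cong (_+ h v) eq) (collect m (h v))))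
      (λ m eq → +-group.∙-cancelʳ (h v) _ _ (trans (sym (succ m)) (trans eq (sym (collect m (h v))))))
      where
      distrib : ∀ m x → (m + 1ℤ) * x ≡ m * x + x
      distrib = solve-∀
      collect : ∀ m x → m * x + x ≡ (m + 1ℤ) * x
      collect m x = sym (distrib m x)
      succ : ∀ m → h ((m + 1ℤ) ·ᵛ v) ≡ h (m ·ᵛ v) + h v
      succ m = trans (cong h (cong₂ _,_ (distrib m (proj₁ v)) (distrib m (proj₂ v)))) (potential-+ v∈L (m ·ᵛ v))

module _ {L : ValidLattice} (B : ReducedBasis L) where
  open ReducedBasis B

  -- Potentials are additive on L, so their values at `v₀` and `v₁` determine all their periods.
  difference-periodic : ∀ {F G : Field L} {h k} → IsPotential F h → IsPotential G k →
                        h v₀ ≡ k v₀ → h v₁ ≡ k v₁ → ∀ {v} → v ∈ᴸ L → ∀ u →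
                        h (u +ᵛ v) - h u ≡ k (u +ᵛ v) - k u
  difference-periodic {F} {G} {h} {k} pot-h pot-k eq₀ eq₁ {v} v∈L u = begin
    h (u +ᵛ v) - h u   ≡⟨ cong (_- h u) (potential-+ F pot-h v∈L u) ⟩
    (h u + h v) - h u  ≡⟨ cancel (h u) (h v) ⟩
    h v                ≡⟨ agree-on-L ⟩
    k v                ≡⟨ sym (cancel (k u) (k v)) ⟩
    (k u + k v) - k u  ≡⟨ cong (_- k u) (sym (potential-+ G pot-k v∈L u)) ⟩
    k (u +ᵛ v) - k u   ∎
    where
    open ≡-Reasoning
    cancel : ∀ a b → (a + b) - a ≡ b
    cancel = solve-∀
    expand : ∀ {F : Field L} {h} → IsPotential F h → ∀ m n → h (m ·ᵛ v₀ +ᵛ n ·ᵛ v₁) ≡ m * h v₀ + n * h v₁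
    expand {F} {h} pot m n = trans (potential-+ F pot (∈ᴸ-· L n v₁-mem) (m ·ᵛ v₀))
      (cong₂ _+_ (potential-· F pot x₀-mem m) (potential-· F pot v₁-mem n))
    agree-on-L : h v ≡ k v
    agree-on-L = let m , n , eq = generate B v∈L in
      trans (cong h eq) (trans (expand pot-h m n) (trans
        (cong₂ (λ a b → m * a + n * b) eq₀ eq₁)
        (trans (sym (expand pot-k m n)) (cong k (sym eq)))))

-- Sums over the torus

module ∑ = SemiringSum ℤ.+-*-semiring

∑-sub : ∀ {n} (f g : Fin n → ℤ) → ∑.sum (λ i → f i - g i) ≡ ∑.sum f - ∑.sum g
∑-sub {ℕ.zero}  f g = refl
∑-sub {ℕ.suc n} f g = trans (cong (λ c → (f zero - g zero) + c) (∑-sub (f ∘ suc) (g ∘ suc)))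
  (shuffle (f zero) (g zero) (∑.sum (f ∘ suc)) (∑.sum (g ∘ suc)))
  where
  shuffle : ∀ a b c d → (a - b) + (c - d) ≡ (a + c) - (b + d)
  shuffle = solve-∀

odd-∑ : ∀ {n} (f : Fin n → ℤ) → odd (∑.sum f) ≡ ∑₂.sum (odd ∘ f)
odd-∑ {ℕ.zero}  f = even⇒¬odd {n = 0ℤ} (divides 0ℤ refl)
odd-∑ {ℕ.suc n} f = trans (odd-+ (f zero) (∑.sum (f ∘ suc))) (cong (odd (f zero) xor_) (odd-∑ (f ∘ suc)))

odd-⟦⟧ : ∀ b → odd ⟦ b ⟧ ≡ b
odd-⟦⟧ true  = odd-1
odd-⟦⟧ false = even⇒¬odd {n = 0ℤ} (divides 0ℤ refl)

uniformField : ∀ {L} → Dir → Field L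
uniformField {L} d = record
  { dir      = λ s → toward (black s)
  ; coherent = λ s → trans (cong toward (black-next s (toward (black s)))) (toward-not (black s))
  ; dir-+    = λ v∈L s → cong toward (black-periodic L {s} v∈L)
  }
  where
  toward : Bool → Dir
  toward c = if c then d else opposite d
  toward-not : ∀ c → toward (not c) ≡ opposite (toward c)
  toward-not true  = refl
  toward-not false = sym (opposite-involutive d)

module _ {L : ValidLattice} (B : ReducedBasis L) where
  open ReducedBasis B
  open Enumeration

  module _ {m} (b : Enumeration BlackDomain m) (w : Enumeration WhiteDomain m) where
    open Matching

    -- Translation by one step from black to white squares, written as a permutation of indices: it
    -- is the matching of the tiling in which all dominoes point the same way from their black
    -- squares.
    shiftPerm : Dir → Permutation′ m
    shiftPerm d = perm (matching B b w (uniformField d))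

    shiftPerm-join : ∀ d i → next (at b i) d ≈ at w (shiftPerm d ⟨$⟩ʳ i) mod L
    shiftPerm-join d i = subst
      (λ c → next (at b i) (if c then d else opposite d) ≈ at w (shiftPerm d ⟨$⟩ʳ i) mod L)
      (black-b B b w i)
      (join (matching B b w (uniformField d)) i)

    torusSum : (Square → ℤ) → ℤ
    torusSum f = ∑.sum (f ∘ at b) + ∑.sum (f ∘ at w)

    torusSum-cong : ∀ {f g} → f ≗ g → torusSum f ≡ torusSum g
    torusSum-cong eq = cong₂ _+_ (∑.sum-cong-≗ (eq ∘ at b)) (∑.sum-cong-≗ (eq ∘ at w))

    torusSum-matched : ∀ f (π : Permutation′ m) →
                       ∑.sum (λ i → f (at b i) + f (at w (π ⟨$⟩ʳ i))) ≡ torusSum f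
    torusSum-matched f π = trans (∑.∑-distrib-+ (f ∘ at b) _)
      (cong (λ c → ∑.sum (f ∘ at b) + c) (sym (∑.sum-permute (f ∘ at w) π)))

    -- A step in direction d maps the black squares of the torus bijectively to the white ones, by
    -- `shiftPerm d`, and the white ones back to the black ones, by the inverse of the opposite
    -- shift.
    torusSum-next : ∀ {f} → (∀ {s r} → s ≈ r mod L → f s ≡ f r) → ∀ d →
                    torusSum (λ s → f (next s d)) ≡ torusSum f
    torusSum-next {f} f-≈ d = begin
      ∑.sum (λ i → f (next (at b i) d)) + ∑.sum (λ j → f (next (at w j) d))
        ≡⟨ cong₂ _+_ (∑.sum-cong-≗ λ i → f-≈ (shiftPerm-join d i)) (∑.sum-permute _ (shiftPerm (opposite d))) ⟩
      ∑.sum (λ i → f (at w (shiftPerm d ⟨$⟩ʳ i))) +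
      ∑.sum (λ i → f (next (at w (shiftPerm (opposite d) ⟨$⟩ʳ i)) d))
        ≡⟨ cong₂ _+_ (sym (∑.sum-permute (f ∘ at w) (shiftPerm d))) (∑.sum-cong-≗ λ i → f-≈ (back i)) ⟩
      ∑.sum (f ∘ at w) + ∑.sum (f ∘ at b)
        ≡⟨ ℤ.+-comm (∑.sum (f ∘ at w)) _ ⟩
      torusSum f ∎
      where
      open ≡-Reasoning
      back : ∀ i → next (at w (shiftPerm (opposite d) ⟨$⟩ʳ i)) d ≈ at b i mod L
      back i = ≈-trans (next-≈ d (≈-sym (shiftPerm-join (opposite d) i)))
        (≈-reflexive (trans (cong (next (next (at b i) (opposite d))) (sym (opposite-involutive d)))
                            (next-opposite (at b i) (opposite d))))

    torusSum-sub : ∀ f g → torusSum (λ s → f s - g s) ≡ torusSum f - torusSum g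
    torusSum-sub f g = trans (cong₂ _+_ (∑-sub (f ∘ at b) (g ∘ at b)) (∑-sub (f ∘ at w) (g ∘ at w)))
      (shuffle (∑.sum (f ∘ at b)) (∑.sum (g ∘ at b)) (∑.sum (f ∘ at w)) (∑.sum (g ∘ at w)))
      where
      shuffle : ∀ a b c d → (a - b) + (c - d) ≡ (a + c) - (b + d)
      shuffle = solve-∀

    -- The sum of the periodic function h − k over the torus is invariant under translation.
    incrementSum-determined : ∀ {h k : ℤ² → ℤ} →
      (∀ {v} → v ∈ᴸ L → ∀ u → h (u +ᵛ v) - h u ≡ k (u +ᵛ v) - k u) → ∀ d a →
      torusSum (λ s → h (next s d +ᵛ unit a) - h (next s d)) ≡
      torusSum (λ s → k (next s d +ᵛ unit a) - k (next s d))
    incrementSum-determined {h} {k} hk d a = ℤ.i-j≡0⇒i≡j _ _ (begin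
      torusSum (Δ h) - torusSum (Δ k)
        ≡⟨ sym (torusSum-sub (Δ h) (Δ k)) ⟩
      torusSum (λ s → Δ h s - Δ k s)
        ≡⟨ torusSum-cong (λ s → trans
             (exchange (h (next s d +ᵛ unit a)) (h (next s d)) (k (next s d +ᵛ unit a)) (k (next s d)))
             (cong (λ p → (h p - k p) - g s)
               (sym (trans (cong (λ q → next q d) (next-forward s a)) (next-translate s d (unit a)))))) ⟩
      torusSum (λ s → g (next s (forward a)) - g s)
        ≡⟨ torusSum-sub (λ s → g (next s (forward a))) g ⟩
      torusSum (λ s → g (next s (forward a))) - torusSum g
        ≡⟨ cong (_- torusSum g) (torusSum-next g-≈ (forward a)) ⟩
      torusSum g - torusSum g
        ≡⟨ ℤ.+-inverseʳ (torusSum g) ⟩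
      0ℤ ∎)
      where
      open ≡-Reasoning
      Δ : (ℤ² → ℤ) → Square → ℤ
      Δ f s = f (next s d +ᵛ unit a) - f (next s d)
      g : Square → ℤ
      g s = h (next s d) - k (next s d)
      next-forward : ∀ s a → next s (forward a) ≡ s +ᵛ unit a
      next-forward s hor = refl
      next-forward s ver = refl
      exchange : ∀ a b c d → (a - b) - (c - d) ≡ (a - c) - (b - d)
      exchange = solve-∀
      periodic-shift : ∀ x y x′ y′ → x′ - x ≡ y′ - y → x′ - y′ ≡ x - y
      periodic-shift x y x′ y′ eq = trans (i x′ x y′) (trans (cong (λ c → (c + x) - y′) eq) (j x y y′))
        where
        i : ∀ x′ x y′ → x′ - y′ ≡ ((x′ - x) + x) - y′
        i = solve-∀
        j : ∀ x y y′ → ((y′ - y) + x) - y′ ≡ x - y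
        j = solve-∀
      hk-periodic : ∀ {v} → v ∈ᴸ L → ∀ u → h (u +ᵛ v) - k (u +ᵛ v) ≡ h u - k u
      hk-periodic {v} v∈L u = periodic-shift (h u) (k u) (h (u +ᵛ v)) (k (u +ᵛ v)) (hk v∈L u)
      g-≈ : ∀ {s r} → s ≈ r mod L → g s ≡ g r
      g-≈ {s} {r} s≈r with ≈-translate s≈r
      ... | v , v∈L , refl = trans (cong (λ p → h p - k p) (next-translate r d v)) (hk-periodic v∈L (next r d))

    module _ (M : Matching B b w) where

      is : Dir → Fin m → Bool
      is d i = does (dirs M i ≟ᵈ d)

      -- The number of particles, counted by dominoes: a black square carries one unless it is
      -- matched upwards, a white square carries one if its partner lies above it.
      movingCount : ℤ
      movingCount = ∑.sum λ i → ⟦ not (is up i) ⟧ + ⟦ is dn i ⟧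

      drift : ℤ
      drift = ∑.sum λ i → ⟦ is rt i ⟧ - ⟦ is lt i ⟧

      private
        F = matchedField B b w M

        points-b : ∀ d i → points F (at b i) d ≡ is d i
        points-b d i = cong (λ e → does (e ≟ᵈ d)) (direction-black B b w M ≈-refl)

        points-w : ∀ d i → points F (at w (perm M ⟨$⟩ʳ i)) (opposite d) ≡ is d i
        points-w d i = trans (cong (λ e → does (e ≟ᵈ opposite d)) (trans (direction-white B b w M ≈-refl)
          (cong (opposite ∘ dirs M) (Perm.inverseˡ (perm M))))) (opposite-does (dirs M i) d)
          where
          opposite-does : ∀ e d → does (opposite e ≟ᵈ opposite d) ≡ does (e ≟ᵈ d)
          opposite-does e d with e ≟ᵈ d
          ... | yes refl = dec-true (opposite e ≟ᵈ opposite e) refl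
          ... | no e≢d   = dec-false (_ ≟ᵈ _) λ eq → e≢d
            (trans (sym (opposite-involutive e)) (trans (cong opposite eq) (opposite-involutive d)))

        black-w′ : ∀ i → black (at w (perm M ⟨$⟩ʳ i)) ≡ false
        black-w′ i = black-w B b w (perm M ⟨$⟩ʳ i)

      module _ {h} (pot : IsPotential F h) where
        open IsPotential pot

        private
          rise : ∀ p a {c r} → black (leftOf (p , a)) ≡ c → points F p (crossDir a) ≡ r →
                       h (p +ᵛ unit a) - h p ≡ sign c * (+ 4 * ⟦ r ⟧ - 1ℤ)
          rise p a refl refl = trans (cong (_- h p) (step p a)) (cancel (h p) _)
            where
            cancel : ∀ a b → (a + b) - a ≡ b
            cancel = solve-∀

        -- With u and d the indicators of bᵢ being matched up and down, the upper side of bᵢ has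
        -- increment 1 - 4u and the upper side of its partner 4d - 1. Adding 4 gives four times the
        -- number of particles on the domino.
        movingCount-height : + 4 * movingCount ≡
          ∑.sum {m} (λ _ → + 4) + torusSum (λ s → h (next s up +ᵛ unit hor) - h (next s up))
        movingCount-height = begin
          + 4 * movingCount
            ≡⟨ ∑.*-distribˡ-sum (+ 4) (λ i → ⟦ not (is up i) ⟧ + ⟦ is dn i ⟧) ⟩
          ∑.sum (λ i → + 4 * (⟦ not (is up i) ⟧ + ⟦ is dn i ⟧))
            ≡⟨ ∑.sum-cong-≗ (λ i → trans (local (is up i) (is dn i)) (cong₂ (λ x y → + 4 + (x + y))
                 (sym (rise (next (at b i) up) hor
                   (next-black B b w up (black-b B b w i)) (trans (points-next F (at b i) up) (points-b up i))))
                 (sym (rise (next (at w (perm M ⟨$⟩ʳ i)) up) hor (next-white B b w up (black-w′ i))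
                   (trans (points-next F (at w (perm M ⟨$⟩ʳ i)) up) (points-w dn i)))))) ⟩
          ∑.sum (λ i → + 4 + (Δ (at b i) + Δ (at w (perm M ⟨$⟩ʳ i))))
            ≡⟨ ∑.∑-distrib-+ {m} (λ _ → + 4) _ ⟩
          ∑.sum {m} (λ _ → + 4) + ∑.sum (λ i → Δ (at b i) + Δ (at w (perm M ⟨$⟩ʳ i)))
            ≡⟨ cong (λ c → ∑.sum {m} (λ _ → + 4) + c) (torusSum-matched Δ (perm M)) ⟩
          ∑.sum {m} (λ _ → + 4) + torusSum Δ ∎
          where
          open ≡-Reasoning
          Δ : Square → ℤ
          Δ s = h (next s up +ᵛ unit hor) - h (next s up)
          local : ∀ u d → + 4 * (⟦ not u ⟧ + ⟦ d ⟧) ≡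
                  + 4 + (-1ℤ * (+ 4 * ⟦ u ⟧ - 1ℤ) + 1ℤ * (+ 4 * ⟦ d ⟧ - 1ℤ))
          local true  true  = refl
          local true  false = refl
          local false true  = refl
          local false false = refl

        -- The right sides of bᵢ and of its partner have increments 4r - 1 and 1 - 4l, with r and l
        -- the indicators of bᵢ being matched to the right and to the left.
        drift-height : + 4 * drift ≡ torusSum (λ s → h (next s rt +ᵛ unit ver) - h (next s rt))
        drift-height = begin
          + 4 * drift
            ≡⟨ ∑.*-distribˡ-sum (+ 4) (λ i → ⟦ is rt i ⟧ - ⟦ is lt i ⟧) ⟩
          ∑.sum (λ i → + 4 * (⟦ is rt i ⟧ - ⟦ is lt i ⟧))
            ≡⟨ ∑.sum-cong-≗ (λ i → trans (local (is rt i) (is lt i)) (cong₂ _+_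
                 (sym (rise (next (at b i) rt) ver
                   (trans (cong black (next-opposite (at b i) rt)) (black-b B b w i))
                   (trans (points-next F (at b i) rt) (points-b rt i))))
                 (sym (rise (next (at w (perm M ⟨$⟩ʳ i)) rt) ver
                   (trans (cong black (next-opposite (at w (perm M ⟨$⟩ʳ i)) rt)) (black-w′ i))
                   (trans (points-next F (at w (perm M ⟨$⟩ʳ i)) rt) (points-w lt i)))))) ⟩
          ∑.sum (λ i → Δ (at b i) + Δ (at w (perm M ⟨$⟩ʳ i)))
            ≡⟨ torusSum-matched Δ (perm M) ⟩
          torusSum Δ ∎
          where
          open ≡-Reasoning
          Δ : Square → ℤ
          Δ s = h (next s rt +ᵛ unit ver) - h (next s rt)
          local : ∀ r l → + 4 * (⟦ r ⟧ - ⟦ l ⟧) ≡ 1ℤ * (+ 4 * ⟦ r ⟧ - 1ℤ) + -1ℤ * (+ 4 * ⟦ l ⟧ - 1ℤ)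
          local true  true  = refl
          local true  false = refl
          local false true  = refl
          local false false = refl

-- The motion of particles

-- A strict inequality becomes nonnegativity of an integer expression. Linear inequalities are then
-- derived by adding nonnegative expressions and normalizing the sum with the ring solver.
<⇒0≤ : ∀ {i j} → i ℤ.< j → 0ℤ ℤ.≤ (j - i) - 1ℤ
<⇒0≤ {i} {j} i<j = subst (0ℤ ℤ.≤_) (shuffle i j) (ℤ.i≤j⇒0≤j-i (ℤ.i<j⇒suc[i]≤j i<j))
  where
  shuffle : ∀ i j → j - (1ℤ + i) ≡ (j - i) - 1ℤ
  shuffle = solve-∀

0≤⇒< : ∀ {i j} → 0ℤ ℤ.≤ (j - i) - 1ℤ → i ℤ.< j
0≤⇒< {i} {j} p = ℤ.suc[i]≤j⇒i<j (ℤ.0≤i-j⇒j≤i (subst (0ℤ ℤ.≤_) (shuffle i j) p))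
  where
  shuffle : ∀ i j → (j - i) - 1ℤ ≡ j - (1ℤ + i)
  shuffle = solve-∀

quotient-−1-0 : ∀ n .{{_ : ℕ.NonZero n}} {e k} → e ≡ k * + n → - + n ℤ.≤ e → e ℤ.< + n → k ≡ 0ℤ ⊎ k ≡ -1ℤ
quotient-−1-0 n@(ℕ.suc _) {_} {k} refl -n≤ <n = range k
  (ℤ.*-cancelʳ-≤-pos -1ℤ k (+ n) (subst (ℤ._≤ k * + n) (sym (ℤ.-1*i≡-i (+ n))) -n≤))
  (ℤ.*-cancelʳ-<-nonNeg {k} {1ℤ} (+ n) (subst (k * + n ℤ.<_) (sym (ℤ.*-identityˡ (+ n))) <n))
  where
  range : ∀ k → -1ℤ ℤ.≤ k → k ℤ.< 1ℤ → k ≡ 0ℤ ⊎ k ≡ -1ℤ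
  range +0           _ _ = inj₁ refl
  range +[1+ _ ]     _ (ℤ.+<+ (s≤s ()))
  range -[1+ ℕ.zero ]  _ _ = inj₂ refl
  range -[1+ ℕ.suc _ ] (ℤ.-≤- ()) _

quotient-0-1 : ∀ n .{{_ : ℕ.NonZero n}} {e k} → e ≡ k * + n → - + n ℤ.< e → e ℤ.< + 2 * + n → k ≡ 0ℤ ⊎ k ≡ 1ℤ
quotient-0-1 n@(ℕ.suc _) {_} {k} refl -n< <2n = range k
  (ℤ.*-cancelʳ-<-nonNeg {_} {k} (+ n) (subst (ℤ._< k * + n) (sym (ℤ.-1*i≡-i (+ n))) -n<))
  (ℤ.*-cancelʳ-<-nonNeg {k} {+ 2} (+ n) <2n)
  where
  range : ∀ k → -1ℤ ℤ.< k → k ℤ.< + 2 → k ≡ 0ℤ ⊎ k ≡ 1ℤ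
  range +0                 _ _ = inj₁ refl
  range +[1+ ℕ.zero ]      _ _ = inj₂ refl
  range +[1+ ℕ.suc _ ]     _ (ℤ.+<+ (s≤s (s≤s ())))
  range -[1+ _ ]           (ℤ.-<- ()) _

-- One step down from row y leads to row g modulo n. The difference y - 1 - g is at least -n, with
-- equality only for a step from row 0 to the top row.
row-drop : ∀ n .{{_ : ℕ.NonZero n}} {y g k} → 0ℤ ℤ.≤ y → 0ℤ ℤ.≤ g → y ℤ.< + n → g ℤ.< + n →
           (y - 1ℤ) - g ≡ k * + n → (k ≡ 0ℤ × y ≡ g + 1ℤ) ⊎ (k ≡ -1ℤ × y ≡ 0ℤ × g + 1ℤ ≡ + n)
row-drop n {y} {g} {k} 0≤y 0≤g y<n g<n eq with quotient-−1-0 n {(y - 1ℤ) - g} {k} eq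
  (ℤ.0≤i-j⇒j≤i (subst (0ℤ ℤ.≤_) (i₁ y g (+ n)) (ℤ.+-mono-≤ 0≤y (<⇒0≤ g<n))))
  (0≤⇒< (subst (0ℤ ℤ.≤_) (i₂ y g (+ n)) (ℤ.+-mono-≤ (ℤ.+-mono-≤ (<⇒0≤ y<n) 0≤g) (ℤ.+≤+ (z≤n {1})))))
  where
  i₁ : ∀ y g n → y + ((n - g) - 1ℤ) ≡ ((y - 1ℤ) - g) - - n
  i₁ = solve-∀
  i₂ : ∀ y g n → (((n - y) - 1ℤ) + g) + 1ℤ ≡ (n - ((y - 1ℤ) - g)) - 1ℤ
  i₂ = solve-∀
... | inj₁ refl = inj₁ (refl , trans (restore y g) (trans (cong (_+ (g + 1ℤ)) eq) (ℤ.+-identityˡ (g + 1ℤ))))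
  where
  restore : ∀ y g → y ≡ ((y - 1ℤ) - g) + (g + 1ℤ)
  restore = solve-∀
... | inj₂ refl = inj₂ (refl , y≡0 , trans (restore y g) (trans (cong₂ _-_ y≡0 eq′) (minus (+ n))))
  where
  eq′ : (y - 1ℤ) - g ≡ - + n
  eq′ = trans eq (ℤ.-1*i≡-i (+ n))
  restore : ∀ y g → g + 1ℤ ≡ y - ((y - 1ℤ) - g)
  restore = solve-∀
  minus : ∀ n → 0ℤ - - n ≡ n
  minus = solve-∀
  i₃ : ∀ y g n → (n - g) - 1ℤ ≡ (((y - 1ℤ) - g) - - n) + - y
  i₃ = solve-∀
  y≤0 : y ℤ.≤ 0ℤ
  y≤0 = ℤ.neg-cancel-≤ (subst (0ℤ ℤ.≤_) (trans (i₃ y g (+ n)) (trans (cong (λ c → (c - - + n) + - y) eq′)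
    (trans (cong (_+ - y) (ℤ.+-inverseʳ (- + n))) (ℤ.+-identityˡ (- y))))) (<⇒0≤ g<n))
  y≡0 : y ≡ 0ℤ
  y≡0 = ℤ.≤-antisym y≤0 0≤y

-- Row-major order and the steps of particles

rowMajor : ℤ² → ℤ² → Bool
rowMajor (x , y) (x′ , y′) = does (y ℤ.<? y′) ∨ (does (y ℤ.≟ y′) ∧ does (x ℤ.<? x′))

rowMajor-< : ∀ {p q} → proj₂ p ℤ.< proj₂ q → rowMajor p q ≡ true
rowMajor-< {x , y} {x′ , y′} y<y′ rewrite dec-true (y ℤ.<? y′) y<y′ = refl

rowMajor-> : ∀ {p q} → proj₂ q ℤ.< proj₂ p → rowMajor p q ≡ false
rowMajor-> {x , y} {x′ , y′} y>y′
  rewrite dec-false (y ℤ.<? y′) (ℤ.<-asym y>y′) | dec-false (y ℤ.≟ y′) (ℤ.<⇒≢ y>y′ ∘ sym) = refl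

rowMajor-≡ : ∀ {p q} → proj₂ p ≡ proj₂ q → rowMajor p q ≡ does (proj₁ p ℤ.<? proj₁ q)
rowMajor-≡ {x , y} {x′ , y′} refl
  rewrite dec-false (y ℤ.<? y) (ℤ.<-irrefl refl) | dec-true (y ℤ.≟ y) refl = refl

rowMajor-tournament : IsTournament rowMajor
rowMajor-tournament = record
  { irreflexive = λ p → trans (rowMajor-≡ {p} {p} refl) (dec-false (proj₁ p ℤ.<? proj₁ p) (ℤ.<-irrefl refl))
  ; converse    = λ {p} {q} → conv p q
  }
  where
  conv : ∀ p q → p ≢ q → rowMajor q p ≡ not (rowMajor p q)
  conv p@(x , y) q@(x′ , y′) p≢q with ℤ.<-cmp y y′
  ... | tri< y<y′ _ _ = trans (rowMajor-> {q} {p} y<y′) (cong not (sym (rowMajor-< {p} {q} y<y′)))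
  ... | tri> _ _ y>y′ = trans (rowMajor-< {q} {p} y>y′) (cong not (sym (rowMajor-> {p} {q} y>y′)))
  ... | tri≈ _ refl _ = trans (rowMajor-≡ {q} {p} refl) (trans columns (cong not (sym (rowMajor-≡ {p} {q} refl))))
    where
    columns : does (x′ ℤ.<? x) ≡ not (does (x ℤ.<? x′))
    columns with ℤ.<-cmp x x′
    ... | tri< x<x′ _ x≯x′ = trans (dec-false (x′ ℤ.<? x) x≯x′) (cong not (sym (dec-true (x ℤ.<? x′) x<x′)))
    ... | tri≈ _ x≡x′ _    = contradiction (cong (_, y) x≡x′) p≢q
    ... | tri> x≮x′ _ x>x′ = trans (dec-true (x′ ℤ.<? x) x>x′) (cong not (sym (dec-false (x ℤ.<? x′) x≮x′)))

shiftX : Dir → ℤ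
shiftX rt = 1ℤ
shiftX lt = -1ℤ
shiftX up = 0ℤ
shiftX dn = 0ℤ

module _ {L : ValidLattice} (B : ReducedBasis L) where
  open ReducedBasis B
  open Enumeration

  private instance
    x₀-nonZero : ℕ.NonZero x₀
    x₀-nonZero = ℕ.>-nonZero x₀-pos
    y₁-nonZero : ℕ.NonZero y₁
    y₁-nonZero = ℕ.>-nonZero y₁-pos

  module Particles {m} (b : Enumeration BlackDomain m) (w : Enumeration WhiteDomain m) where
    open Matching

    -- Reduced to the domain, so that the motion takes its values in the same finite set of squares
    -- as the sites.
    below : Fin m → ℤ²
    below j = reduce B (next (at w j) dn)

    below-injective : Injective _≡_ _≡_ below
    below-injective {i} {j} eq = at-unique B w (subst₂ (λ s r → s ≈ r mod L)
      (next-opposite (at w i) dn) (next-opposite (at w j) dn) (next-≈ up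
      (≈-trans (reduce-≈ B _) (≈-trans (≈-reflexive eq) (≈-sym (reduce-≈ B _))))))

    black-below : ∀ j → black (below j) ≡ true
    black-below j = trans (sym (black-≈ (reduce-≈ B (next (at w j) dn)))) (next-white B b w dn (black-w B b w j))

    below≢w : ∀ {i j} → below i ≢ at w j
    below≢w {i} {j} eq = contradiction (trans (sym (black-below i)) (trans (cong black eq) (black-w B b w j))) λ ()

    b≢w : ∀ {i j} → at b i ≢ at w j
    b≢w {i} {j} eq = contradiction (trans (sym (black-b B b w i)) (trans (cong black eq) (black-w B b w j))) λ ()

    S₂ = doubleSummation (finSummation m)
    open Summation S₂ using () renaming (∑ to ∑²)

    both : (Fin m × Bool → ℤ) → Fin m → ℤ
    both f i = f (i , true) + f (i , false)

    ∑ᶻ : (Fin m × Bool → ℤ) → ℤ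
    ∑ᶻ f = ∑.sum (both f)

    ∑ᶻ-cong : ∀ {f g} → f ≗ g → ∑ᶻ f ≡ ∑ᶻ g
    ∑ᶻ-cong eq = ∑.sum-cong-≗ λ i → cong₂ _+_ (eq (i , true)) (eq (i , false))

    ∑ᶻ-sub : ∀ f g → ∑ᶻ (λ z → f z - g z) ≡ ∑ᶻ f - ∑ᶻ g
    ∑ᶻ-sub f g = trans (∑.sum-cong-≗ λ i → shuffle (f (i , true)) (g (i , true)) (f (i , false)) (g (i , false)))
                       (∑-sub (both f) (both g))
      where
      shuffle : ∀ a b c d → (a - b) + (c - d) ≡ (a + c) - (b + d)
      shuffle = solve-∀

    ∑ᶻ-+ : ∀ f g → ∑ᶻ (λ z → f z + g z) ≡ ∑ᶻ f + ∑ᶻ g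
    ∑ᶻ-+ f g = trans (∑.sum-cong-≗ λ i → shuffle (f (i , true)) (g (i , true)) (f (i , false)) (g (i , false)))
                     (∑.∑-distrib-+ (both f) (both g))
      where
      shuffle : ∀ a b c d → (a + b) + (c + d) ≡ (a + c) + (b + d)
      shuffle = solve-∀

    ∑ᶻ-*ʳ : ∀ f c → ∑ᶻ (λ z → f z * c) ≡ ∑ᶻ f * c
    ∑ᶻ-*ʳ f c = trans (∑.sum-cong-≗ λ i → sym (ℤ.*-distribʳ-+ c (f (i , true)) (f (i , false))))
                      (sym (∑.*-distribʳ-sum c (both f)))

    odd-∑ᶻ : ∀ f → odd (∑ᶻ f) ≡ ∑² (odd ∘ f)
    odd-∑ᶻ f = trans (odd-∑ (both f)) (∑₂.sum-cong-≗ λ i → odd-+ (f (i , true)) (f (i , false)))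

even-gap : ∀ {n} → 0ℤ ℤ.< n → odd n ≡ false → 0ℤ ℤ.≤ n - + 2
even-gap {n} 0<n n-even = subst (0ℤ ℤ.≤_) (shuffle n) (<⇒0≤ (ℤ.≤∧≢⇒< (ℤ.i<j⇒suc[i]≤j 0<n) 1≢n))
  where
  shuffle : ∀ n → (n - 1ℤ) - 1ℤ ≡ n - + 2
  shuffle = solve-∀
  1≢n : 1ℤ ≢ n
  1≢n refl = contradiction (trans (sym odd-1) n-even) λ ()

Step : ℤ → Set
Step t = t ≡ 0ℤ ⊎ (t ≡ 1ℤ ⊎ t ≡ -1ℤ)

-- Two particles in a row can collide or swap under a step only if both move,
-- and then they are an even distance apart.
gap-range : ∀ {n d s t} → 0ℤ ℤ.< d → d ℤ.< n → odd n ≡ false → Step s → Step t →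
            (s ≢ 0ℤ → t ≢ 0ℤ → odd d ≡ false) →
            0ℤ ℤ.≤ d + (t - s) × 0ℤ ℤ.≤ n - (d + (t - s))
gap-range {n} {d} {s} {t} 0<d d<n n-even s-step t-step even-d = go s-step t-step
  where
  small : ∀ u → 0ℤ ℤ.≤ u + 1ℤ → 0ℤ ℤ.≤ 1ℤ - u → 0ℤ ℤ.≤ d + u × 0ℤ ℤ.≤ n - (d + u)
  small u p q = subst (0ℤ ℤ.≤_) (i₁ d u) (ℤ.+-mono-≤ (<⇒0≤ 0<d) p) ,
                subst (0ℤ ℤ.≤_) (i₂ n d u) (ℤ.+-mono-≤ (<⇒0≤ d<n) q)
    where
    i₁ : ∀ d u → ((d - 0ℤ) - 1ℤ) + (u + 1ℤ) ≡ d + u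
    i₁ = solve-∀
    i₂ : ∀ n d u → ((n - d) - 1ℤ) + (1ℤ - u) ≡ n - (d + u)
    i₂ = solve-∀
  large : ∀ u → odd d ≡ false → 0ℤ ℤ.≤ u + + 2 → 0ℤ ℤ.≤ + 2 - u → 0ℤ ℤ.≤ d + u × 0ℤ ℤ.≤ n - (d + u)
  large u e p q = subst (0ℤ ℤ.≤_) (i₁ d u) (ℤ.+-mono-≤ (even-gap 0<d e) p) ,
                  subst (0ℤ ℤ.≤_) (i₂ n d u) (ℤ.+-mono-≤ (even-gap 0<n-d n-d-even) q)
    where
    i₁ : ∀ d u → (d - + 2) + (u + + 2) ≡ d + u
    i₁ = solve-∀
    i₂ : ∀ n d u → ((n - d) - + 2) + (+ 2 - u) ≡ n - (d + u)
    i₂ = solve-∀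
    i₃ : ∀ n d → (n - d) - 1ℤ ≡ ((n - d) - 0ℤ) - 1ℤ
    i₃ = solve-∀
    0<n-d : 0ℤ ℤ.< n - d
    0<n-d = 0≤⇒< (subst (0ℤ ℤ.≤_) (i₃ n d) (<⇒0≤ d<n))
    n-d-even : odd (n - d) ≡ false
    n-d-even = trans (odd-+ n (- d)) (cong₂ _xor_ n-even (trans (odd-neg d) e))
  go : Step s → Step t → 0ℤ ℤ.≤ d + (t - s) × 0ℤ ℤ.≤ n - (d + (t - s))
  go (inj₁ refl)        (inj₁ refl)        = small _ (ℤ.+≤+ z≤n) (ℤ.+≤+ z≤n)
  go (inj₁ refl)        (inj₂ (inj₁ refl)) = small _ (ℤ.+≤+ z≤n) (ℤ.+≤+ z≤n)
  go (inj₁ refl)        (inj₂ (inj₂ refl)) = small _ (ℤ.+≤+ z≤n) (ℤ.+≤+ z≤n)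
  go (inj₂ (inj₁ refl)) (inj₁ refl)        = small _ (ℤ.+≤+ z≤n) (ℤ.+≤+ z≤n)
  go (inj₂ (inj₂ refl)) (inj₁ refl)        = small _ (ℤ.+≤+ z≤n) (ℤ.+≤+ z≤n)
  go (inj₂ (inj₁ refl)) (inj₂ (inj₁ refl)) = small _ (ℤ.+≤+ z≤n) (ℤ.+≤+ z≤n)
  go (inj₂ (inj₂ refl)) (inj₂ (inj₂ refl)) = small _ (ℤ.+≤+ z≤n) (ℤ.+≤+ z≤n)
  go (inj₂ (inj₁ refl)) (inj₂ (inj₂ refl)) = large _ (even-d (λ ()) λ ()) (ℤ.+≤+ z≤n) (ℤ.+≤+ z≤n)
  go (inj₂ (inj₂ refl)) (inj₂ (inj₁ refl)) = large _ (even-d (λ ()) λ ()) (ℤ.+≤+ z≤n) (ℤ.+≤+ z≤n)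

shiftX-step : ∀ d → Step (shiftX d)
shiftX-step up = inj₁ refl
shiftX-step dn = inj₁ refl
shiftX-step rt = inj₂ (inj₁ refl)
shiftX-step lt = inj₂ (inj₂ refl)

module _ {L : ValidLattice} (B : ReducedBasis L) where
  open ReducedBasis B
  open Enumeration

  private instance
    x₀-nonZero : ℕ.NonZero x₀
    x₀-nonZero = ℕ.>-nonZero x₀-pos
    y₁-nonZero : ℕ.NonZero y₁
    y₁-nonZero = ℕ.>-nonZero y₁-pos

  module Motion {m} (b : Enumeration BlackDomain m) (w : Enumeration WhiteDomain m)
                (M : Matching B b w) where
    open Matching
    open Particles B b w

    pos img : Fin m × Bool → ℤ²
    pos = Sites.site (at b) (at w) below (perm M)
    img = Sites.moved (at b) (at w) below (perm M) (is B b w M dn)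

    -- A site moves if exactly one of the tiling and the tiling uniformField up crosses its
    -- upper side; img is the site it moves to.
    moving : Fin m × Bool → Bool
    moving (i , true)  = not (is B b w M up i)
    moving (i , false) = is B b w M dn i

    dx : Fin m × Bool → ℤ
    dx (i , true)  = shiftX (dirs M i)
    dx (i , false) = 0ℤ

    private
      shift′ : Fin m × Bool → ℤ²
      shift′ = Sites.shift (at b) (at w) below (perm M)

      below-≈ : ∀ i d → next (at b i) d ≈ at w (perm M ⟨$⟩ʳ i) mod L →
                below (perm M ⟨$⟩ʳ i) ≈ next (next (at b i) d) dn mod L
      below-≈ i d j = ≈-trans (≈-sym (reduce-≈ B _)) (next-≈ dn (≈-sym j))

      shift-hor : ∀ p → (p +ᵛ unit hor) -ᵛ unit ver ≡ p +ᵛ (1ℤ , -1ℤ)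
      shift-hor (x , y) = cong₂ _,_ (i₁ x) (i₂ y)
        where
        i₁ : ∀ x → (x + 1ℤ) - 0ℤ ≡ x + 1ℤ
        i₁ = solve-∀
        i₂ : ∀ y → (y + 0ℤ) - 1ℤ ≡ y + -1ℤ
        i₂ = solve-∀

      shift-hor⁻ : ∀ p → (p -ᵛ unit hor) -ᵛ unit ver ≡ p +ᵛ (-1ℤ , -1ℤ)
      shift-hor⁻ (x , y) = cong₂ _,_ (i₁ x) (i₂ y)
        where
        i₁ : ∀ x → (x - 1ℤ) - 0ℤ ≡ x + -1ℤ
        i₁ = solve-∀
        i₂ : ∀ y → (y - 0ℤ) - 1ℤ ≡ y + -1ℤ
        i₂ = solve-∀

    -- If the domino is horizontal, the image of its black square is the square below the partner:
    -- one row down and one column aside. If the black square is matched downwards, the image is the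
    -- partner itself.
    image-≈ : ∀ z → moving z ≡ true → img z ≈ pos z +ᵛ (dx z , -1ℤ) mod L
    image-≈ (i , true) = go (dirs M i) (join M i)
      where
      go : ∀ d → next (at b i) d ≈ at w (perm M ⟨$⟩ʳ i) mod L → not (does (d ≟ᵈ up)) ≡ true →
           shift′ (i , not (does (d ≟ᵈ dn)) xor true) ≈ at b i +ᵛ (shiftX d , -1ℤ) mod L
      go dn j _ = ≈-sym j
      go rt j _ = ≈-trans (below-≈ i rt j) (≈-reflexive (shift-hor (at b i)))
      go lt j _ = ≈-trans (below-≈ i lt j) (≈-reflexive (shift-hor⁻ (at b i)))
    image-≈ (i , false) p = go (is B b w M dn i) p
      where
      go : ∀ c → c ≡ true → shift′ (i , not c xor false) ≈ at w (perm M ⟨$⟩ʳ i) +ᵛ (0ℤ , -1ℤ) mod L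
      go true _ = ≈-sym (reduce-≈ B _)

    -- A black square matched upwards is the square below its own partner. This holds modulo L,
    -- hence exactly, both squares being in the domain.
    image-fixed : ∀ z → moving z ≡ false → img z ≡ pos z
    image-fixed (i , true) = go (dirs M i) (join M i)
      where
      go : ∀ d → next (at b i) d ≈ at w (perm M ⟨$⟩ʳ i) mod L → not (does (d ≟ᵈ up)) ≡ false →
           shift′ (i , not (does (d ≟ᵈ dn)) xor true) ≡ at b i
      go up j _ = Domain-unique B (reduce-∈ B _) (proj₁ (member b i))
        (≈-trans (below-≈ i up j) (≈-reflexive (next-opposite (at b i) up)))
    image-fixed (i , false) p = go (is B b w M dn i) p
      where
      go : ∀ c → c ≡ false → shift′ (i , not c xor false) ≡ at w (perm M ⟨$⟩ʳ i)
      go false _ = refl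

    pos-∈ : ∀ z → pos z ∈ Domain
    pos-∈ (i , true)  = proj₁ (member b i)
    pos-∈ (i , false) = proj₁ (member w _)

    img-∈ : ∀ z → img z ∈ Domain
    img-∈ (i , c) = go (not (is B b w M dn i) xor c)
      where
      go : ∀ c → shift′ (i , c) ∈ Domain
      go true  = proj₁ (member w _)
      go false = reduce-∈ B _

    img-injective : Injective _≡_ _≡_ img
    img-injective = moved-injective rowMajor-tournament (injective b) (injective w) below-injective b≢w below≢w
                      (perm M) (is B b w M dn)

    pos-injective : Injective _≡_ _≡_ pos
    pos-injective = site-injective rowMajor-tournament (injective b) (injective w) below-injective b≢w below≢w
                      (perm M)

    posX posY imgX imgY : Fin m × Bool → ℤ
    posX = proj₁ ∘ pos
    posY = proj₂ ∘ pos
    imgX = proj₁ ∘ img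
    imgY = proj₂ ∘ img

    -- The coordinates, with respect to v₀ and v₁, of the translation that brings the square
    -- reached from pos z back into the fundamental domain.
    record Winding (z : Fin m × Bool) : Set where
      field
        col row : ℤ
        x-eq    : moving z ≡ true → (posX z + dx z) - imgX z ≡ col * + x₀ + row * + x₁
        y-eq    : moving z ≡ true → (posY z - 1ℤ) - imgY z ≡ row * + y₁

    opaque
      winding : ∀ z → Winding z
      winding z = go (moving z) refl
        where
        go : ∀ c → moving z ≡ c → Winding z
        go true p = record
          { col  = proj₁ g
          ; row  = proj₁ (proj₂ g)
          ; x-eq = λ _ → cong proj₁ (proj₂ (proj₂ g))
          ; y-eq = λ _ → trans (cong proj₂ (proj₂ (proj₂ g)))
              (trans (cong (_+ proj₁ (proj₂ g) * + y₁) (ℤ.*-zeroʳ (proj₁ g))) (ℤ.+-identityˡ (proj₁ (proj₂ g) * + y₁)))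
          }
          where
          g : ∃₂ λ c k → (pos z +ᵛ (dx z , -1ℤ)) -ᵛ img z ≡ c ·ᵛ v₀ +ᵛ k ·ᵛ v₁
          g = generate B (difference (≈-sym (image-≈ z p)))
        -- A default: windings are used only for moving sites, for which this case does not arise.
        go false p = record
          { col  = 0ℤ
          ; row  = 0ℤ
          ; x-eq = λ q → contradiction (trans (sym p) q) λ ()
          ; y-eq = λ q → contradiction (trans (sym p) q) λ ()
          }

    open module winding z = Winding (winding z) public

    RowStep : Fin m × Bool → Set
    RowStep z = (row z ≡ 0ℤ × posY z ≡ imgY z + 1ℤ) ⊎ (row z ≡ -1ℤ × posY z ≡ 0ℤ × imgY z + 1ℤ ≡ + y₁)

    row-cases : ∀ z → moving z ≡ true → RowStep z
    row-cases z p = row-drop y₁ {k = row z} (proj₁ (proj₂ (pos-∈ z))) (proj₁ (proj₂ (img-∈ z)))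
      (proj₂ (proj₂ (pos-∈ z))) (proj₂ (proj₂ (img-∈ z))) (y-eq z p)

    dx-black : ∀ z → dx z ≢ 0ℤ → black (pos z) ≡ true
    dx-black (i , true)  _    = black-b B b w i
    dx-black (i , false) dx≢0 = contradiction refl dx≢0

    dx-step : ∀ z → Step (dx z)
    dx-step (i , true)  = shiftX-step (dirs M i)
    dx-step (i , false) = inj₁ refl

    -- Absence of collisions on the torus: `img` is injective with values in the domain, where
    -- congruent squares coincide.
    image-≈⇒≡ : ∀ {z z′ v} → moving z ≡ true → moving z′ ≡ true → v ∈ᴸ L →
                pos z′ +ᵛ (dx z′ , -1ℤ) ≡ (pos z +ᵛ (dx z , -1ℤ)) +ᵛ v → z ≡ z′
    image-≈⇒≡ {z} {z′} p p′ v∈L eq = img-injective (Domain-unique B (img-∈ z) (img-∈ z′)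
      (≈-trans (image-≈ z p) (≈-trans (≈-sym (+ᵛ-≈ v∈L)) (≈-trans (≈-reflexive (sym eq)) (≈-sym (image-≈ z′ p′))))))

    -- `gap-range` leaves the closed range from 0 to `x₀`. At either end the two particles would
    -- land on the same square of the torus. The evenness it asks for holds since sites that step
    -- sideways are black.
    same-row-gap : ∀ {z z′} → moving z ≡ true → moving z′ ≡ true → posY z ≡ posY z′ → posX z ℤ.< posX z′ →
                   let e = (posX z′ + dx z′) - (posX z + dx z) in 0ℤ ℤ.< e × e ℤ.< + x₀
    same-row-gap {z} {z′} p p′ y≡ x<x′ =
      ℤ.≤∧≢⇒< (subst (0ℤ ℤ.≤_) (sym e-eq) (proj₁ range)) 0≢e ,
      ℤ.≤∧≢⇒< (ℤ.0≤i-j⇒j≤i (subst (λ e → 0ℤ ℤ.≤ + x₀ - e) (sym e-eq) (proj₂ range))) e≢x₀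
      where
      x = posX z
      x′ = posX z′
      e = (x′ + dx z′) - (x + dx z)
      0<d : 0ℤ ℤ.< x′ - x
      0<d = 0≤⇒< (subst (0ℤ ℤ.≤_) (i x x′) (<⇒0≤ x<x′))
        where
        i : ∀ x x′ → (x′ - x) - 1ℤ ≡ ((x′ - x) - 0ℤ) - 1ℤ
        i = solve-∀
      d<x₀ : x′ - x ℤ.< + x₀
      d<x₀ = ℤ.≤-<-trans (ℤ.≤-trans (ℤ.+-monoʳ-≤ x′ (ℤ.neg-mono-≤ (proj₁ (proj₁ (pos-∈ z)))))
        (ℤ.≤-reflexive (ℤ.+-identityʳ x′))) (proj₂ (proj₁ (pos-∈ z′)))
      even-d : dx z ≢ 0ℤ → dx z′ ≢ 0ℤ → odd (x′ - x) ≡ false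
      even-d dx≢0 dx′≢0 = trans (odd-+ x′ (- x)) (trans (cong (odd x′ xor_) (odd-neg x))
        (same-color (odd x) (odd x′) (odd (posY z)) (trans (sym (black-odd x (posY z))) (dx-black z dx≢0))
           (trans (cong (λ y → not (odd x′ xor odd y)) y≡) (trans (sym (black-odd x′ (posY z′))) (dx-black z′ dx′≢0)))))
        where
        same-color : ∀ a b c → not (a xor c) ≡ true → not (b xor c) ≡ true → b xor a ≡ false
        same-color true  true  _     _  _  = refl
        same-color false false _     _  _  = refl
        same-color true  false true  _  ()
        same-color true  false false () _
        same-color false true  true  () _
        same-color false true  false _  ()
      range = gap-range 0<d d<x₀ (x₀-even B) (dx-step z) (dx-step z′) even-d
      e-eq : e ≡ (x′ - x) + (dx z′ - dx z)
      e-eq = i x′ (dx z′) x (dx z)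
        where
        i : ∀ a b c d → (a + b) - (c + d) ≡ (a - c) + (b - d)
        i = solve-∀
      z≢z′ : z ≢ z′
      z≢z′ refl = ℤ.<-irrefl refl x<x′
      restore : ∀ a b → a ≡ b + (a - b)
      restore = solve-∀
      landing : ∀ {c} → e ≡ c → (c , 0ℤ) ∈ᴸ L → z ≡ z′
      landing {c} eq c∈L = image-≈⇒≡ p p′ c∈L (cong₂ _,_
        (trans (restore (x′ + dx z′) (x + dx z)) (cong (λ e → (x + dx z) + e) eq))
        (trans (cong (_+ -1ℤ) (sym y≡)) (sym (ℤ.+-identityʳ (posY z + -1ℤ)))))
      0≢e : 0ℤ ≢ e
      0≢e eq = z≢z′ (landing (sym eq) (0ℤ , 0ℤ , refl))
      e≢x₀ : e ≢ + x₀
      e≢x₀ eq = z≢z′ (landing eq x₀-mem)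

    sameRow : Fin m × Bool → Fin m × Bool → Bool
    sameRow z z′ = does (posY z ℤ.≟ posY z′)

    -- Particles of one row are exchanged when their column windings differ in parity, their row
    -- windings being equal. Particles of different rows are exchanged when just one of them passes
    -- from the bottom row to the top.
    flip : Fin m × Bool → Fin m × Bool → Bool
    flip z z′ = (sameRow z z′ ∧ (odd (col z) xor odd (col z′))) xor (odd (row z) xor odd (row z′))

    -- In different rows only the lower particle can wrap around, and it then lands above the other.
    -- In one row the new gap differs from the unreduced one, which lies strictly between 0 and
    -- `x₀`, by `col z′ - col z` times `x₀`. This multiple can only be 0, which keeps the order, or
    -- 1, which reverses it.
    order-flip : ∀ {z z′} → moving z ≡ true → moving z′ ≡ true → rowMajor (pos z) (pos z′) ≡ true →
                 rowMajor (img z) (img z′) ≡ not (flip z z′)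
    order-flip {z} {z′} p p′ z<z′ with ℤ.<-cmp (posY z) (posY z′)
    ... | tri> _ _ y>y′ = contradiction (trans (sym z<z′) (rowMajor-> {pos z} {pos z′} y>y′)) λ ()
    ... | tri< y<y′ y≢y′ _ = trans (go (row-cases z p) (row-cases z′ p′))
        (cong (λ E → not ((E ∧ (odd (col z) xor odd (col z′))) xor (odd (row z) xor odd (row z′))))
              (sym (dec-false (posY z ℤ.≟ posY z′) y≢y′)))
      where
      odds : ∀ {k k′ j j′} → k ≡ j → k′ ≡ j′ → not (odd j xor odd j′) ≡ not (odd k xor odd k′)
      odds refl refl = refl
      unsuc : ∀ {g g′} → g + 1ℤ ℤ.< g′ + 1ℤ → g ℤ.< g′
      unsuc {g} {g′} g<g′ = 0≤⇒< (subst (0ℤ ℤ.≤_) (i g g′) (<⇒0≤ g<g′))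
        where
        i : ∀ g g′ → ((g′ + 1ℤ) - (g + 1ℤ)) - 1ℤ ≡ (g′ - g) - 1ℤ
        i = solve-∀
      odd-0 : odd 0ℤ ≡ false
      odd-0 = odd-⟦⟧ false
      odd-−1 : odd -1ℤ ≡ true
      odd-−1 = trans (odd-neg 1ℤ) odd-1
      go : RowStep z → RowStep z′ →
           rowMajor (img z) (img z′) ≡ not (odd (row z) xor odd (row z′))
      go (inj₁ (k , y)) (inj₁ (k′ , y′)) = trans
        (rowMajor-< {img z} {img z′} (unsuc (subst₂ ℤ._<_ y y′ y<y′)))
        (trans (cong not (sym (cong₂ _xor_ odd-0 odd-0))) (odds k k′))
      -- z drops from row 0 to the top row, while z′ ends at least one row below the top.
      go (inj₂ (k , _ , g)) (inj₁ (k′ , y′)) = trans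
        (rowMajor-> {img z} {img z′} (unsuc (subst₂ ℤ._<_ y′ (sym g) (proj₂ (proj₂ (pos-∈ z′))))))
        (trans (cong not (sym (cong₂ _xor_ odd-−1 odd-0))) (odds k k′))
      -- If z′ wrapped, it would be in row 0, and z would have to lie in a lower row.
      go _ (inj₂ (_ , y′ , _)) = contradiction (proj₁ (proj₂ (pos-∈ z)))
        (ℤ.<⇒≱ (subst (posY z ℤ.<_) y′ y<y′))
    ... | tri≈ _ y≡y′ _ = trans (rowMajor-≡ {img z} {img z′} g≡g′) (trans (go (quotient-0-1 x₀ κ-eq lower upper))
        (trans (cong not (flip-eq (odd (col z)) (odd (col z′)) (odd (row z))))
          (cong₂ (λ E r → not ((E ∧ (odd (col z) xor odd (col z′))) xor (odd (row z) xor r)))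
               (sym (dec-true (posY z ℤ.≟ posY z′) y≡y′)) (cong odd k≡k′))))
      where
      flip-eq : ∀ a b c → b xor a ≡ (true ∧ (a xor b)) xor (c xor c)
      flip-eq = agree 3 (λ a b c → b xor a) (λ a b c → (true ∧ (a xor b)) xor (c xor c)) refl
      x<x′ : posX z ℤ.< posX z′
      x<x′ = does-true (posX z ℤ.<? posX z′) (trans (sym (rowMajor-≡ {pos z} {pos z′} y≡y′)) z<z′)
      gap = same-row-gap {z} {z′} p p′ y≡y′ x<x′
      e = (posX z′ + dx z′) - (posX z + dx z)
      impossible : ∀ {y g : ℤ} → 0ℤ ℤ.≤ g → y ≡ g + 1ℤ → y ≢ 0ℤ
      impossible (ℤ.+≤+ _) refl eq = contradiction (trans (cong +_ (ℕ.+-comm 1 _)) eq) λ ()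
      rows : row z ≡ row z′ × imgY z ≡ imgY z′
      rows = by (row-cases z p) (row-cases z′ p′)
        where
        by : RowStep z → RowStep z′ →
           row z ≡ row z′ × imgY z ≡ imgY z′
        by (inj₁ (k , y)) (inj₁ (k′ , y′)) =
          trans k (sym k′) , +-group.∙-cancelʳ 1ℤ _ _ (trans (sym y) (trans y≡y′ y′))
        by (inj₂ (k , _ , g)) (inj₂ (k′ , _ , g′)) =
          trans k (sym k′) , +-group.∙-cancelʳ 1ℤ _ _ (trans g (sym g′))
        by (inj₁ (_ , y)) (inj₂ (_ , y′ , _)) =
          contradiction (trans y≡y′ y′) (impossible (proj₁ (proj₂ (img-∈ z))) y)
        by (inj₂ (_ , y , _)) (inj₁ (_ , y′)) =
          contradiction (trans (sym y≡y′) y) (impossible (proj₁ (proj₂ (img-∈ z′))) y′)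
      k≡k′ = proj₁ rows
      g≡g′ = proj₂ rows
      κ-eq : e - (imgX z′ - imgX z) ≡ (col z′ - col z) * + x₀
      κ-eq = begin
        e - (imgX z′ - imgX z)
          ≡⟨ i₁ (posX z′ + dx z′) (posX z + dx z) (imgX z′) (imgX z) ⟩
        ((posX z′ + dx z′) - imgX z′) - ((posX z + dx z) - imgX z)
          ≡⟨ cong₂ _-_ (trans (x-eq z′ p′) (cong (λ k → col z′ * + x₀ + k * + x₁) (sym k≡k′))) (x-eq z p) ⟩
        (col z′ * + x₀ + row z * + x₁) - (col z * + x₀ + row z * + x₁)
          ≡⟨ i₂ (col z′) (col z) (row z * + x₁) (+ x₀) ⟩
        (col z′ - col z) * + x₀ ∎
        where
        open ≡-Reasoning
        i₁ : ∀ a b c d → (a - b) - (c - d) ≡ (a - c) - (b - d)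
        i₁ = solve-∀
        i₂ : ∀ a b k x → (a * x + k) - (b * x + k) ≡ (a - b) * x
        i₂ = solve-∀
      lower : - + x₀ ℤ.< e - (imgX z′ - imgX z)
      lower = 0≤⇒< (subst (0ℤ ℤ.≤_) (i (+ x₀) e (imgX z′) (imgX z)) (ℤ.+-mono-≤ (ℤ.+-mono-≤ (ℤ.+-mono-≤
        (<⇒0≤ (proj₂ (proj₁ (img-∈ z′)))) (<⇒0≤ (proj₁ gap))) (proj₁ (proj₁ (img-∈ z)))) (ℤ.+≤+ (z≤n {1}))))
        where
        i : ∀ x e a b → ((((x - a) - 1ℤ) + ((e - 0ℤ) - 1ℤ)) + b) + 1ℤ ≡ ((e - (a - b)) - - x) - 1ℤ
        i = solve-∀
      upper : e - (imgX z′ - imgX z) ℤ.< + 2 * + x₀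
      upper = 0≤⇒< (subst (0ℤ ℤ.≤_) (i (+ x₀) e (imgX z′) (imgX z)) (ℤ.+-mono-≤ (ℤ.+-mono-≤ (ℤ.+-mono-≤
        (<⇒0≤ (proj₂ (proj₁ (img-∈ z)))) (<⇒0≤ (proj₂ gap))) (proj₁ (proj₁ (img-∈ z′)))) (ℤ.+≤+ (z≤n {1}))))
        where
        i : ∀ x e a b → ((((x - b) - 1ℤ) + ((x - e) - 1ℤ)) + a) + 1ℤ ≡ (+ 2 * x - (e - (a - b))) - 1ℤ
        i = solve-∀
      go : col z′ - col z ≡ 0ℤ ⊎ col z′ - col z ≡ 1ℤ →
           does (imgX z ℤ.<? imgX z′) ≡ not (odd (col z′) xor odd (col z))
      go (inj₁ κ) = trans (dec-true (imgX z ℤ.<? imgX z′) (0≤⇒< (subst (0ℤ ℤ.≤_)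
          (trans (cong (λ e → (e - 0ℤ) - 1ℤ) e≡) (i (imgX z′) (imgX z))) (<⇒0≤ (proj₁ gap)))))
        (cong not (trans (sym (odd-⟦⟧ false)) (trans (cong odd (sym κ))
          (trans (odd-+ (col z′) (- col z)) (cong (odd (col z′) xor_) (odd-neg (col z)))))))
        where
        i : ∀ a b → ((a - b) - 0ℤ) - 1ℤ ≡ (a - b) - 1ℤ
        i = solve-∀
        e≡ : e ≡ imgX z′ - imgX z
        e≡ = ℤ.i-j≡0⇒i≡j _ _ (trans κ-eq (cong (_* + x₀) κ))
      go (inj₂ κ) = trans (dec-false (imgX z ℤ.<? imgX z′) (ℤ.<-asym (0≤⇒< (subst (0ℤ ℤ.≤_)
          (trans (cong (λ x → (x - e) - 1ℤ) x₀≡) (i e (imgX z′) (imgX z))) (<⇒0≤ (proj₂ gap))))))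
        (cong not (trans (sym odd-1) (trans (cong odd (sym κ))
          (trans (odd-+ (col z′) (- col z)) (cong (odd (col z′) xor_) (odd-neg (col z)))))))
        where
        i : ∀ e a b → ((e - (a - b)) - e) - 1ℤ ≡ (b - a) - 1ℤ
        i = solve-∀
        x₀≡ : + x₀ ≡ e - (imgX z′ - imgX z)
        x₀≡ = sym (trans κ-eq (trans (cong (_* + x₀) κ) (ℤ.*-identityˡ (+ x₀))))

-- Parity of the inversions of the motion

module _ {L : ValidLattice} (B : ReducedBasis L) where
  open ReducedBasis B
  open Enumeration

  private instance
    x₀-nonZero : ℕ.NonZero x₀
    x₀-nonZero = ℕ.>-nonZero x₀-pos
    y₁-nonZero : ℕ.NonZero y₁
    y₁-nonZero = ℕ.>-nonZero y₁-pos

  module Parities {m} (b : Enumeration BlackDomain m) (w : Enumeration WhiteDomain m) (M : Matching B b w) where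
    open Matching
    open Particles B b w
    open Motion B b w M
    open Summation S₂ using (∑-cong; ∑-xor; ∑-∧; ∑∑-cong; ∑∑-xor; ∑-zero) renaming (∑ to ∑²; _≟_ to _≟ᶻ_)
    open ≡-Reasoning

    private
      P = movingCount B b w M
      Δ = drift B b w M

      points-to : Dir → Fin m → Bool
      points-to = is B b w M

    -- `img` takes every white square and every square below a white one exactly once, and the
    -- latter are the black squares, listed through `shiftPerm`. Hence `img` and `pos` run through
    -- the same squares.
    image-sum : ∀ f → ∑ᶻ (f ∘ img) ≡ ∑ᶻ (f ∘ pos)
    image-sum f = begin
      ∑.sum (both (f ∘ img))
        ≡⟨ ∑.sum-cong-≗ (λ i → untwist i (points-to dn i)) ⟩
      ∑.sum (λ i → f (at w (perm M ⟨$⟩ʳ i)) + f (below (perm M ⟨$⟩ʳ i)))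
        ≡⟨ ∑.∑-distrib-+ {m} (λ i → f (at w (perm M ⟨$⟩ʳ i))) (λ i → f (below (perm M ⟨$⟩ʳ i))) ⟩
      ∑.sum (λ i → f (at w (perm M ⟨$⟩ʳ i))) + ∑.sum (λ i → f (below (perm M ⟨$⟩ʳ i)))
        ≡⟨ cong₂ _+_ (sym (∑.sum-permute (f ∘ at w) (perm M)))
             (trans (sym (∑.sum-permute (f ∘ below) (perm M))) (∑.sum-permute (f ∘ below) (shiftPerm B b w up))) ⟩
      ∑.sum (f ∘ at w) + ∑.sum (λ i → f (below (shiftPerm B b w up ⟨$⟩ʳ i)))
        ≡⟨ cong (λ c → ∑.sum (f ∘ at w) + c) (∑.sum-cong-≗ λ i → cong f (below-shift i)) ⟩
      ∑.sum (f ∘ at w) + ∑.sum (f ∘ at b)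
        ≡⟨ ℤ.+-comm (∑.sum (f ∘ at w)) (∑.sum (f ∘ at b)) ⟩
      torusSum B b w f
        ≡⟨ sym (torusSum-matched B b w f (perm M)) ⟩
      ∑.sum (both (f ∘ pos)) ∎
      where
      shift′ : Fin m × Bool → ℤ²
      shift′ = Sites.shift (at b) (at w) below (perm M)
      untwist : ∀ i c → f (shift′ (i , not c xor true)) + f (shift′ (i , not c xor false)) ≡
                        f (at w (perm M ⟨$⟩ʳ i)) + f (below (perm M ⟨$⟩ʳ i))
      untwist i true  = refl
      untwist i false = ℤ.+-comm (f (below (perm M ⟨$⟩ʳ i))) (f (at w (perm M ⟨$⟩ʳ i)))
      below-shift : ∀ i → below (shiftPerm B b w up ⟨$⟩ʳ i) ≡ at b i
      below-shift i = Domain-unique B (reduce-∈ B _) (proj₁ (member b i))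
        (≈-trans (≈-sym (reduce-≈ B _)) (≈-trans (next-≈ dn (≈-sym (shiftPerm-join B b w up i)))
          (≈-reflexive (next-opposite (at b i) up))))

    restrict : (Fin m × Bool → ℤ) → Fin m × Bool → ℤ
    restrict f z = ⟦ moving z ⟧ * f z

    -- The contribution of the fixed sites is the same for `img` and `pos` and is subtracted from
    -- `image-sum`.
    moving-sum : ∀ f → ∑ᶻ (restrict (f ∘ img)) ≡ ∑ᶻ (restrict (f ∘ pos))
    moving-sum f = begin
      ∑ᶻ (restrict (f ∘ img))
        ≡⟨ ∑ᶻ-cong (λ z → split z (moving z) refl) ⟩
      ∑ᶻ (λ z → f (img z) - fixedPart z)
        ≡⟨ ∑ᶻ-sub (f ∘ img) fixedPart ⟩
      ∑ᶻ (f ∘ img) - ∑ᶻ fixedPart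
        ≡⟨ cong (_- ∑ᶻ fixedPart) (image-sum f) ⟩
      ∑ᶻ (f ∘ pos) - ∑ᶻ fixedPart
        ≡⟨ sym (∑ᶻ-sub (f ∘ pos) fixedPart) ⟩
      ∑ᶻ (λ z → f (pos z) - fixedPart z)
        ≡⟨ ∑ᶻ-cong (λ z → unsplit (moving z) (f (pos z))) ⟩
      ∑ᶻ (restrict (f ∘ pos)) ∎
      where
      fixedPart : Fin m × Bool → ℤ
      fixedPart z = ⟦ not (moving z) ⟧ * f (pos z)
      i₁ : ∀ a b → 1ℤ * a ≡ a - 0ℤ * b
      i₁ = solve-∀
      i₂ : ∀ a → 0ℤ * a ≡ a - 1ℤ * a
      i₂ = solve-∀
      split : ∀ z c → moving z ≡ c → ⟦ c ⟧ * f (img z) ≡ f (img z) - ⟦ not c ⟧ * f (pos z)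
      split z true  _  = i₁ (f (img z)) (f (pos z))
      split z false eq = trans (i₂ (f (img z))) (cong (λ p → f (img z) - 1ℤ * f p) (image-fixed z eq))
      unsplit : ∀ c a → a - ⟦ not c ⟧ * a ≡ ⟦ c ⟧ * a
      unsplit true  a = sym (i₁ a a)
      unsplit false a = sym (i₂ a)

    odd-restrict : ∀ c a → odd (⟦ c ⟧ * a) ≡ c ∧ odd a
    odd-restrict c a = trans (odd-* ⟦ c ⟧ a) (cong (_∧ odd a) (odd-⟦⟧ c))

    moving-sum₂ : ∀ (f : ℤ² → Bool) → ∑² (λ z → moving z ∧ f (img z)) ≡ ∑² (λ z → moving z ∧ f (pos z))
    moving-sum₂ f = trans (sym (parity img)) (trans (cong odd (moving-sum (λ p → ⟦ f p ⟧))) (parity pos))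
      where
      parity : ∀ g → odd (∑ᶻ λ z → ⟦ moving z ⟧ * ⟦ f (g z) ⟧) ≡ ∑² (λ z → moving z ∧ f (g z))
      parity g = trans (odd-∑ᶻ (λ z → ⟦ moving z ⟧ * ⟦ f (g z) ⟧)) (∑-cong λ z →
        trans (odd-restrict (moving z) ⟦ f (g z) ⟧) (cong (moving z ∧_) (odd-⟦⟧ (f (g z)))))

    colSum rowSum : ℤ
    colSum = ∑ᶻ (restrict col)
    rowSum = ∑ᶻ (restrict row)

    -- Sum of `y-eq` over the particles: old and new rows cancel by `moving-sum`, and each particle
    -- contributes its descent by one.
    rowSum-movingCount : rowSum * + y₁ ≡ - P
    rowSum-movingCount = begin
      rowSum * + y₁
        ≡⟨ sym (∑ᶻ-*ʳ (restrict row) (+ y₁)) ⟩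
      ∑ᶻ (λ z → (restrict row z) * + y₁)
        ≡⟨ ∑ᶻ-cong (λ z → local z (moving z) refl) ⟩
      ∑ᶻ (λ z → (restrict posY z - restrict imgY z) - ⟦ moving z ⟧)
        ≡⟨ trans (∑ᶻ-sub (λ z → restrict posY z - restrict imgY z) (λ z → ⟦ moving z ⟧))
             (cong (_- P) (∑ᶻ-sub (restrict posY) (restrict imgY))) ⟩
      (∑ᶻ (restrict posY) - ∑ᶻ (restrict imgY)) - P
        ≡⟨ cong (λ c → (∑ᶻ (restrict posY) - c) - P) (moving-sum proj₂) ⟩
      (∑ᶻ (restrict posY) - ∑ᶻ (restrict posY)) - P
        ≡⟨ cong (_- P) (ℤ.+-inverseʳ (∑ᶻ (restrict posY))) ⟩
      0ℤ - P
        ≡⟨ ℤ.+-identityˡ (- P) ⟩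
      - P ∎
      where
      i₁ : ∀ k y → (1ℤ * k) * y ≡ k * y
      i₁ = solve-∀
      i₂ : ∀ y g → (y - 1ℤ) - g ≡ (1ℤ * y - 1ℤ * g) - 1ℤ
      i₂ = solve-∀
      local : ∀ z c → moving z ≡ c → (⟦ c ⟧ * row z) * + y₁ ≡ (⟦ c ⟧ * posY z - ⟦ c ⟧ * imgY z) - ⟦ c ⟧
      local z true  p = trans (i₁ (row z) (+ y₁)) (trans (sym (y-eq z p)) (i₂ (posY z) (imgY z)))
      local z false _ = refl

    -- Sum of `x-eq` over the particles: old and new columns cancel, which leaves the sideways
    -- steps.
    colSum-drift : colSum * + x₀ + rowSum * + x₁ ≡ Δ
    colSum-drift = begin
      colSum * + x₀ + rowSum * + x₁
        ≡⟨ cong₂ _+_ (sym (∑ᶻ-*ʳ (restrict col) (+ x₀)))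
                     (sym (∑ᶻ-*ʳ (restrict row) (+ x₁))) ⟩
      ∑ᶻ (λ z → (restrict col z) * + x₀) + ∑ᶻ (λ z → (restrict row z) * + x₁)
        ≡⟨ sym (∑ᶻ-+ (λ z → (restrict col z) * + x₀) (λ z → (restrict row z) * + x₁)) ⟩
      ∑ᶻ (λ z → (restrict col z) * + x₀ + (restrict row z) * + x₁)
        ≡⟨ ∑ᶻ-cong (λ z → local z (moving z) refl) ⟩
      ∑ᶻ (λ z → (restrict posX z - restrict imgX z) + restrict dx z)
        ≡⟨ trans (∑ᶻ-+ (λ z → restrict posX z - restrict imgX z) (restrict dx))
             (cong (_+ ∑ᶻ (restrict dx)) (trans
               (∑ᶻ-sub (restrict posX) (restrict imgX))
               (trans (cong (λ c → ∑ᶻ (restrict posX) - c) (moving-sum proj₁))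
                      (ℤ.+-inverseʳ (∑ᶻ (restrict posX)))))) ⟩
      0ℤ + ∑ᶻ (restrict dx)
        ≡⟨ ℤ.+-identityˡ (∑ᶻ (restrict dx)) ⟩
      ∑ᶻ (restrict dx)
        ≡⟨ ∑.sum-cong-≗ (λ i → drift-at (dirs M i)) ⟩
      Δ ∎
      where
      i₁ : ∀ c k x y → (1ℤ * c) * x + (1ℤ * k) * y ≡ c * x + k * y
      i₁ = solve-∀
      i₂ : ∀ x d g → (x + d) - g ≡ (1ℤ * x - 1ℤ * g) + 1ℤ * d
      i₂ = solve-∀
      local : ∀ z c → moving z ≡ c → (⟦ c ⟧ * col z) * + x₀ + (⟦ c ⟧ * row z) * + x₁ ≡
                                     (⟦ c ⟧ * posX z - ⟦ c ⟧ * imgX z) + ⟦ c ⟧ * dx z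
      local z true  p = trans (i₁ (col z) (row z) (+ x₀) (+ x₁)) (trans (sym (x-eq z p)) (i₂ (posX z) (dx z) (imgX z)))
      local z false _ = refl
      drift-at : ∀ d → ⟦ not (does (d ≟ᵈ up)) ⟧ * shiftX d + ⟦ does (d ≟ᵈ dn) ⟧ * 0ℤ ≡
                       ⟦ does (d ≟ᵈ rt) ⟧ - ⟦ does (d ≟ᵈ lt) ⟧
      drift-at up = refl
      drift-at dn = refl
      drift-at lt = refl
      drift-at rt = refl

    rowCount : ℤ → Bool
    rowCount y = ∑² λ z → moving z ∧ does (y ℤ.≟ posY z)

    restrict-cong : ∀ {z} {a c : Bool} → (moving z ≡ true → a ≡ c) → moving z ∧ a ≡ moving z ∧ c
    restrict-cong {z} f with moving z
    ... | true  = f refl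
    ... | false = refl

    does-⇔ : ∀ {P Q : Set} (P? : Dec P) (Q? : Dec Q) → (P → Q) → (Q → P) → does P? ≡ does Q?
    does-⇔ (yes p) Q? f g = sym (dec-true Q? (f p))
    does-⇔ (no ¬p) Q? f g = sym (dec-false Q? (¬p ∘ g))

    -- A particle is in row n + 1 exactly if it steps into row n, which is not the top row. By
    -- `moving-sum₂` as many particles, modulo 2, step into row n as start from it.
    rowCount-suc : ∀ n → ℕ.suc n ℕ.< y₁ → rowCount (+ ℕ.suc n) ≡ rowCount (+ n)
    rowCount-suc n n<y₁ = trans (∑-cong λ z → restrict-cong {z} λ p →
        does-⇔ (+ ℕ.suc n ℤ.≟ posY z) (+ n ℤ.≟ imgY z) (to z (row-cases z p)) (from z (row-cases z p)))
      (moving-sum₂ (λ q → does (+ n ℤ.≟ proj₂ q)))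
      where
      suc≡ : + ℕ.suc n ≡ + n + 1ℤ
      suc≡ = cong +_ (ℕ.+-comm 1 n)
      to : ∀ z → RowStep z →
           + ℕ.suc n ≡ posY z → + n ≡ imgY z
      to z (inj₁ (_ , y))     eq = +-group.∙-cancelʳ 1ℤ (+ n) (imgY z) (trans (sym suc≡) (trans eq y))
      to z (inj₂ (_ , y , _)) eq = contradiction (trans eq y) λ ()
      from : ∀ z → RowStep z →
             + n ≡ imgY z → + ℕ.suc n ≡ posY z
      from z (inj₁ (_ , y))     eq = trans suc≡ (trans (cong (_+ 1ℤ) eq) (sym y))
      from z (inj₂ (_ , _ , g)) eq = contradiction (ℤ.+-injective (trans suc≡ (trans (cong (_+ 1ℤ) eq) g)))
                                       (ℕ.<⇒≢ n<y₁)

    rowCount-const : ∀ n → n ℕ.< y₁ → rowCount (+ n) ≡ rowCount 0ℤ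
    rowCount-const ℕ.zero    _    = refl
    rowCount-const (ℕ.suc n) n<y₁ = trans (rowCount-suc n n<y₁) (rowCount-const n (ℕ.<-trans (ℕ.n<1+n n) n<y₁))

    rowCount-posY : ∀ z → rowCount (posY z) ≡ rowCount 0ℤ
    rowCount-posY z = go (proj₁ (proj₂ (pos-∈ z))) (proj₂ (proj₂ (pos-∈ z)))
      where
      go : ∀ {y} → 0ℤ ℤ.≤ y → y ℤ.< + y₁ → rowCount y ≡ rowCount 0ℤ
      go (ℤ.+≤+ _) (ℤ.+<+ n<y₁) = rowCount-const _ n<y₁

    odd-rowSum : ∑² (λ z → moving z ∧ odd (row z)) ≡ odd rowSum
    odd-rowSum = sym (trans (odd-∑ᶻ (restrict row)) (∑-cong λ z → odd-restrict (moving z) (row z)))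

    odd-colSum : ∑² (λ z → moving z ∧ odd (col z)) ≡ odd colSum
    odd-colSum = sym (trans (odd-∑ᶻ (restrict col)) (∑-cong λ z → odd-restrict (moving z) (col z)))

    odd-movingCount : ∑² moving ≡ odd P
    odd-movingCount = sym (trans (odd-∑ᶻ (λ z → ⟦ moving z ⟧)) (∑-cong λ z → odd-⟦⟧ (moving z)))

    -- The particles in row 0 are those that wrap around, each with row winding -1.
    rowCount-0 : rowCount 0ℤ ≡ odd rowSum
    rowCount-0 = trans (∑-cong λ z → restrict-cong {z} λ p → bottom z (row-cases z p)) odd-rowSum
      where
      bottom : ∀ z → RowStep z →
               does (0ℤ ℤ.≟ posY z) ≡ odd (row z)
      bottom z (inj₁ (k , y)) = trans (dec-false (0ℤ ℤ.≟ posY z) (above (proj₁ (proj₂ (img-∈ z)))))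
                                      (sym (trans (cong odd k) (odd-⟦⟧ false)))
        where
        above : 0ℤ ℤ.≤ imgY z → 0ℤ ≢ posY z
        above 0≤g eq = contradiction 0≤g (ℤ.<⇒≱ (subst (ℤ._< 0ℤ) (sym g≡) ℤ.-<+))
          where
          g≡ : imgY z ≡ -1ℤ
          g≡ = +-group.∙-cancelʳ 1ℤ (imgY z) -1ℤ (sym (trans eq y))
      bottom z (inj₂ (k , y , _)) = trans (dec-true (0ℤ ℤ.≟ posY z) (sym y))
                                      (sym (trans (cong odd k) (trans (odd-neg 1ℤ) odd-1)))

    reversal : Bool
    reversal = Inv S₂ (rowMajor on pos) (rowMajor on img)

    -- By `order-flip` a pair counts according to `flip`, a difference of windings, and `∑-halve`
    -- turns this into a sum over single particles. Each winding is weighted by the number of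
    -- possible partners: the other particles of the row for `col`, all other particles for `row`. A
    -- row holds `rowSum` particles modulo 2, and "other" accounts for the negations.
    reversal-value : reversal ≡ (not (odd rowSum) ∧ odd colSum) xor (not (odd P) ∧ odd rowSum)
    reversal-value = begin
      reversal
        ≡⟨ Inv-moving S₂ rowMajor-tournament {pos} {img} (λ {z} {z′} → pos-injective {z} {z′})
             (λ {z} {z′} → img-injective {z} {z′}) moving image-fixed moving-sum₂ ⟩
      ∑² (λ z → ∑² λ z′ → (moving z ∧ moving z′) ∧ (A z z′ ∧ rowMajor (img z′) (img z)))
        ≡⟨ ∑∑-cong (λ z z′ → trans (local z z′) (spread (A z z′) (moving z ∧ moving z′) (sameRow z z′)
             (odd (col z) xor odd (col z′)) (odd (row z) xor odd (row z′)))) ⟩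
      ∑² (λ z → ∑² λ z′ → (A z z′ ∧ (s₁ z z′ ∧ (odd (col z) xor odd (col z′)))) xor
                          (A z z′ ∧ (s₂ z z′ ∧ (odd (row z) xor odd (row z′)))))
        ≡⟨ ∑∑-xor (λ z z′ → A z z′ ∧ (s₁ z z′ ∧ (odd (col z) xor odd (col z′))))
                  (λ z z′ → A z z′ ∧ (s₂ z z′ ∧ (odd (row z) xor odd (row z′)))) ⟩
      ∑² (λ z → ∑² λ z′ → A z z′ ∧ (s₁ z z′ ∧ (odd (col z) xor odd (col z′)))) xor
      ∑² (λ z → ∑² λ z′ → A z z′ ∧ (s₂ z z′ ∧ (odd (row z) xor odd (row z′))))
        ≡⟨ cong₂ _xor_ (∑-halve S₂ A-t s₁ (odd ∘ col) s₁-sym)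
                       (∑-halve S₂ A-t s₂ (odd ∘ row) (λ z z′ → Bool.∧-comm (moving z) (moving z′))) ⟩
      ∑² (λ z → odd (col z) ∧ (∑² (s₁ z) xor s₁ z z)) xor ∑² (λ z → odd (row z) ∧ (∑² (s₂ z) xor s₂ z z))
        ≡⟨ cong₂ _xor_
             (collect (odd ∘ col) (λ z → cong₂ _xor_ (∑s₁ z) (s₁-diag z)) odd-colSum)
             (collect (odd ∘ row) (λ z → cong₂ _xor_ (∑s₂ z) (Bool.∧-idem (moving z))) odd-rowSum) ⟩
      (not (odd rowSum) ∧ odd colSum) xor (not (odd P) ∧ odd rowSum) ∎
      where
      A : Fin m × Bool → Fin m × Bool → Bool
      A z z′ = rowMajor (pos z) (pos z′)
      A-t : IsTournament A
      A-t = pullback rowMajor-tournament (λ {z} {z′} → pos-injective {z} {z′})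
      s₁ s₂ : Fin m × Bool → Fin m × Bool → Bool
      s₁ z z′ = (moving z ∧ moving z′) ∧ sameRow z z′
      s₂ z z′ = moving z ∧ moving z′
      s₁-sym : ∀ z z′ → s₁ z z′ ≡ s₁ z′ z
      s₁-sym z z′ = cong₂ _∧_ (Bool.∧-comm (moving z) (moving z′))
        (does-⇔ (posY z ℤ.≟ posY z′) (posY z′ ℤ.≟ posY z) sym sym)
      ∑s₁ : ∀ z → ∑² (s₁ z) ≡ moving z ∧ odd rowSum
      ∑s₁ z = trans (∑-cong λ z′ → Bool.∧-assoc (moving z) (moving z′) (sameRow z z′))
        (trans (∑-∧ (moving z) (λ z′ → moving z′ ∧ sameRow z z′)) (cong (moving z ∧_) (trans (rowCount-posY z) rowCount-0)))
      s₁-diag : ∀ z → s₁ z z ≡ moving z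
      s₁-diag z = trans (cong₂ _∧_ (Bool.∧-idem (moving z)) (dec-true (posY z ℤ.≟ posY z) refl)) (Bool.∧-identityʳ _)
      ∑s₂ : ∀ z → ∑² (s₂ z) ≡ moving z ∧ odd P
      ∑s₂ z = trans (∑-∧ (moving z) moving) (cong (moving z ∧_) odd-movingCount)
      factor : ∀ c p n → c ∧ ((p ∧ n) xor p) ≡ not n ∧ (p ∧ c)
      factor = agree 3 (λ c p n → c ∧ ((p ∧ n) xor p)) (λ c p n → not n ∧ (p ∧ c)) refl
      collect : ∀ (c : Fin m × Bool → Bool) {t : Fin m × Bool → Bool} {n e} →
                (∀ z → t z ≡ (moving z ∧ n) xor moving z) → ∑² (λ z → moving z ∧ c z) ≡ e →
                ∑² (λ z → c z ∧ t z) ≡ not n ∧ e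
      collect c {n = n} t≡ e≡ = trans
        (∑-cong λ z → trans (cong (c z ∧_) (t≡ z)) (factor (c z) (moving z) n))
        (trans (∑-∧ (not n) (λ z → moving z ∧ c z)) (cong (not n ∧_) e≡))
      spread : ∀ a p e c k → a ∧ (p ∧ ((e ∧ c) xor k)) ≡ (a ∧ ((p ∧ e) ∧ c)) xor (a ∧ (p ∧ k))
      spread = agree 5 (λ a p e c k → a ∧ (p ∧ ((e ∧ c) xor k)))
                       (λ a p e c k → (a ∧ ((p ∧ e) ∧ c)) xor (a ∧ (p ∧ k))) refl
      local : ∀ z z′ → (moving z ∧ moving z′) ∧ (A z z′ ∧ rowMajor (img z′) (img z)) ≡
                       A z z′ ∧ ((moving z ∧ moving z′) ∧ flip z z′)
      local z z′ = go (moving z) (moving z′) (A z z′) refl refl refl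
        where
        go : ∀ p p′ a → moving z ≡ p → moving z′ ≡ p′ → A z z′ ≡ a →
             (p ∧ p′) ∧ (a ∧ rowMajor (img z′) (img z)) ≡ a ∧ ((p ∧ p′) ∧ flip z z′)
        go false _     true  _ _ _ = refl
        go true  false true  _ _ _ = refl
        go p     p′    false _ _ _ = Bool.∧-zeroʳ (p ∧ p′)
        go true  true  true p p′ a = trans
          (IsTournament.converse rowMajor-tournament {img z} {img z′} λ eq →
            contradiction (trans (sym a) (trans (cong (A z) (sym (img-injective {z} {z′} eq)))
              (IsTournament.irreflexive A-t z))) λ ())
          (trans (cong not (order-flip {z} {z′} p p′ a)) (Bool.not-involutive _))

    -- The sign of a term of the determinant: the inversions of the permutation and a factor -1 for
    -- every horizontal edge with black left endpoint.
    signParity : Bool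
    signParity = inversionParity (perm M) xor ∑₂.sum (points-to rt)

    -- The discrepancy between the inversions of the motion, which see the dominoes pointing down,
    -- and the Kasteleyn signs, which see those pointing right.
    turns : ℤ
    turns = ∑.sum λ i → ⟦ points-to dn i ⟧ + ⟦ points-to rt i ⟧

    turns-value : turns * + 2 ≡ P + Δ
    turns-value = trans (∑.*-distribʳ-sum (+ 2) (λ i → ⟦ points-to dn i ⟧ + ⟦ points-to rt i ⟧))
      (trans (∑.sum-cong-≗ λ i → local (dirs M i))
        (∑.∑-distrib-+ {m} (λ i → ⟦ not (points-to up i) ⟧ + ⟦ points-to dn i ⟧)
                           (λ i → ⟦ points-to rt i ⟧ - ⟦ points-to lt i ⟧)))
      where
      local : ∀ d → (⟦ does (d ≟ᵈ dn) ⟧ + ⟦ does (d ≟ᵈ rt) ⟧) * + 2 ≡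
              (⟦ not (does (d ≟ᵈ up)) ⟧ + ⟦ does (d ≟ᵈ dn) ⟧) + (⟦ does (d ≟ᵈ rt) ⟧ - ⟦ does (d ≟ᵈ lt) ⟧)
      local up = refl
      local dn = refl
      local lt = refl
      local rt = refl

    signConstant : Bool
    signConstant = siteConstant rowMajor-tournament (injective b) (injective w) below-injective b≢w below≢w xor
                   ∑₂.sum {m} (λ _ → true)

    -- `Inv-moved` expresses `reversal` by the inversions of the permutation and the dominoes not
    -- pointing down. Their number is m minus those pointing down, so adding the ones pointing right
    -- leaves `turns`.
    signParity-value : signParity ≡ (reversal xor odd turns) xor signConstant
    signParity-value = begin
      signParity
        ≡⟨ regroup (inversionParity (perm M)) (∑₂.sum (points-to rt)) (∑₂.sum (points-to dn)) s t ⟩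
      ((((inversionParity (perm M) xor (t xor ∑₂.sum (points-to dn))) xor s) xor
         (∑₂.sum (points-to dn) xor ∑₂.sum (points-to rt))) xor (s xor t))
        ≡⟨ cong₂ (λ x y → (((inversionParity (perm M) xor x) xor s) xor y) xor (s xor t)) (sym nots) (sym odd-turns) ⟩
      ((((inversionParity (perm M) xor ∑₂.sum (λ i → not (points-to dn i))) xor s) xor odd turns) xor (s xor t))
        ≡⟨ cong (λ x → (x xor odd turns) xor (s xor t)) (sym
             (Inv-moved rowMajor-tournament (injective b) (injective w) below-injective b≢w below≢w
               (perm M) (points-to dn))) ⟩
      (reversal xor odd turns) xor signConstant ∎
      where
      s = siteConstant rowMajor-tournament (injective b) (injective w) below-injective b≢w below≢w
      t = ∑₂.sum {m} (λ _ → true)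
      regroup : ∀ i r d s t → i xor r ≡ (((i xor (t xor d)) xor s) xor (d xor r)) xor (s xor t)
      regroup = agree 5 (λ i r d s t → i xor r)
        (λ i r d s t → (((i xor (t xor d)) xor s) xor (d xor r)) xor (s xor t)) refl
      nots : ∑₂.sum (λ i → not (points-to dn i)) ≡ t xor ∑₂.sum (points-to dn)
      nots = trans (∑₂.sum-cong-≗ λ i → sym (Bool.true-xor (points-to dn i)))
                   (∑₂.∑-distrib-+ {m} (λ _ → true) (points-to dn))
      odd-turns : odd turns ≡ ∑₂.sum (points-to dn) xor ∑₂.sum (points-to rt)
      odd-turns = trans (odd-∑ (λ i → ⟦ points-to dn i ⟧ + ⟦ points-to rt i ⟧)) (trans
        (∑₂.sum-cong-≗ λ i → trans (odd-+ ⟦ points-to dn i ⟧ ⟦ points-to rt i ⟧)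
          (cong₂ _xor_ (odd-⟦⟧ (points-to dn i)) (odd-⟦⟧ (points-to rt i))))
        (∑₂.∑-distrib-+ {m} (points-to dn) (points-to rt)))

  module _ {m} (b : Enumeration BlackDomain m) (w : Enumeration WhiteDomain m) where

    -- The windings and `turns` solve linear equations in `movingCount` and `drift` with nonzero
    -- coefficients `y₁`, `x₀` and 2. The remaining constant depends on the enumerations only.
    signParity-determined : ∀ M M′ → movingCount B b w M ≡ movingCount B b w M′ → drift B b w M ≡ drift B b w M′ →
                            Parities.signParity b w M ≡ Parities.signParity b w M′
    signParity-determined M M′ P≡P′ Δ≡Δ′ = trans N.signParity-value (trans
      (cong₂ (λ r t → (r xor odd t) xor N.signConstant) reversal≡ turns≡) (sym N′.signParity-value))
      where
      module N = Parities b w M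
      module N′ = Parities b w M′
      row≡ : N.rowSum ≡ N′.rowSum
      row≡ = ℤ.*-cancelʳ-≡ N.rowSum N′.rowSum (+ y₁)
        (trans N.rowSum-movingCount (trans (cong -_ P≡P′) (sym N′.rowSum-movingCount)))
      col≡ : N.colSum ≡ N′.colSum
      col≡ = ℤ.*-cancelʳ-≡ N.colSum N′.colSum (+ x₀) (+-group.∙-cancelʳ (N.rowSum * + x₁) _ _
        (trans N.colSum-drift (trans Δ≡Δ′ (trans (sym N′.colSum-drift)
          (cong (λ k → N′.colSum * + x₀ + k * + x₁) (sym row≡))))))
      turns≡ : N.turns ≡ N′.turns
      turns≡ = ℤ.*-cancelʳ-≡ N.turns N′.turns (+ 2)
        (trans N.turns-value (trans (cong₂ _+_ P≡P′ Δ≡Δ′) (sym N′.turns-value)))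
      reversal≡ : N.reversal ≡ N′.reversal
      reversal≡ = trans N.reversal-value (trans
        (cong₂ (λ c e → c xor e)
          (cong₂ (λ k j → not (odd k) ∧ odd j) row≡ col≡)
          (cong₂ (λ p k → not (odd p) ∧ odd k) P≡P′ row≡))
        (sym N′.reversal-value))

-- Exponents of monomials

listSum : ∀ {A : Set} → (A → ℤ) → List A → ℤ
listSum f []       = 0ℤ
listSum f (x ∷ xs) = f x + listSum f xs

listSum-cong : ∀ {A : Set} {f g : A → ℤ} → f ≗ g → ∀ xs → listSum f xs ≡ listSum g xs
listSum-cong eq []       = refl
listSum-cong eq (x ∷ xs) = cong₂ _+_ (eq x) (listSum-cong eq xs)

listSum-++ : ∀ {A : Set} (f : A → ℤ) xs ys → listSum f (xs ++ ys) ≡ listSum f xs + listSum f ys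
listSum-++ f []       ys = sym (ℤ.+-identityˡ (listSum f ys))
listSum-++ f (x ∷ xs) ys = trans (cong (λ c → f x + c) (listSum-++ f xs ys)) (sym (ℤ.+-assoc (f x) _ _))

listSum-∑ : ∀ {A : Set} {n} (f : Fin n → A → ℤ) xs →
            ∑.sum (λ i → listSum (f i) xs) ≡ listSum (λ x → ∑.sum (λ i → f i x)) xs
listSum-∑ {n = n} f []       = ∑.sum-replicate-zero n
listSum-∑ f (x ∷ xs) = trans (∑.∑-distrib-+ (λ i → f i x) (λ i → listSum (f i) xs))
                             (cong (λ c → ∑.sum (λ i → f i x) + c) (listSum-∑ f xs))

telescope : ∀ {A : Set} (g : ℕ → A) (f : A → ℤ) (F : ℕ → ℤ) → (∀ k → f (g k) ≡ F (ℕ.suc k) - F k) →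
            ∀ n → listSum f (map g (upTo n)) ≡ F n - F 0
telescope g f F eq n = trans (cong (listSum f) (List.map-upTo g n)) (go g F eq n)
  where
  collapse : ∀ a b c → (b - a) + (c - b) ≡ c - a
  collapse = solve-∀
  go : ∀ g F → (∀ k → f (g k) ≡ F (ℕ.suc k) - F k) → ∀ n → listSum f (applyUpTo g n) ≡ F n - F 0
  go g F eq ℕ.zero    = sym (ℤ.+-inverseʳ (F 0))
  go g F eq (ℕ.suc n) = trans (cong₂ _+_ (eq 0) (go (g ∘ ℕ.suc) (F ∘ ℕ.suc) (eq ∘ ℕ.suc) n))
                              (collapse (F 0) (F 1) (F (ℕ.suc n)))

odd-suc : ∀ n → odd (+ ℕ.suc n) ≡ not (odd (+ n))
odd-suc n = trans (cong (odd ∘ +_) (ℕ.+-comm 1 n)) (trans (odd-+ (+ n) 1ℤ)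
  (trans (cong (odd (+ n) xor_) odd-1) (Bool.xor-comm (odd (+ n)) true)))

-- Colors alternate along a straight path, so the partial sums of the signs alternate between 0 and
-- `sign c`.
alternating-sum : ∀ {A : Set} (g : ℕ → A) (f : A → Bool) c → (∀ k → f (g k) ≡ c xor odd (+ k)) →
                  ∀ n → listSum (sign ∘ f) (map g (upTo n)) ≡ ⟦ odd (+ n) ⟧ * sign c
alternating-sum g f c eq n = trans
  (telescope g (sign ∘ f) (λ k → ⟦ odd (+ k) ⟧ * sign c)
    (λ k → trans (cong sign (eq k)) (trans (local c (odd (+ k)))
      (cong (λ o → ⟦ o ⟧ * sign c - ⟦ odd (+ k) ⟧ * sign c) (sym (odd-suc k))))) n)
  (trans (cong (λ o → ⟦ odd (+ n) ⟧ * sign c - ⟦ o ⟧ * sign c) (odd-⟦⟧ false)) (ℤ.+-identityʳ _))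
  where
  local : ∀ c o → sign (c xor o) ≡ ⟦ not o ⟧ * sign c - ⟦ o ⟧ * sign c
  local true  true  = refl
  local true  false = refl
  local false true  = refl
  local false false = refl

∑-indicator : ∀ {n} (f : Fin n → Bool) k → f k ≡ true → (∀ i → f i ≡ true → i ≡ k) → ∑.sum (⟦_⟧ ∘ f) ≡ 1ℤ
∑-indicator {ℕ.suc n} f zero    fk unique = cong₂ (λ c d → ⟦ c ⟧ + d) fk (trans
  (∑.sum-cong-≗ λ i → cong ⟦_⟧ (others (f (suc i)) refl)) (∑.sum-replicate-zero n))
  where
  others : ∀ {i} c → f (suc i) ≡ c → f (suc i) ≡ false
  others {i} true  eq = contradiction (unique (suc i) eq) λ ()
  others     false eq = eq
∑-indicator {ℕ.suc n} f (suc k) fk unique = cong₂ (λ c d → ⟦ c ⟧ + d) (first (f zero) refl)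
  (∑-indicator (f ∘ suc) k fk λ i eq → Fin.suc-injective (unique (suc i) eq))
  where
  first : ∀ c → f zero ≡ c → f zero ≡ false
  first true  eq = contradiction (unique zero eq) λ ()
  first false eq = eq

-- A domino has one black square and translations by L preserve colors, so equivalent dominoes have
-- equivalent black squares and extend from them in the same direction.
sameOrbit-black : ∀ {L q r} x y → black q ≡ true → black r ≡ true →
                  SameOrbit L (domino q x) (domino r y) → q ≈ r mod L × x ≡ y
sameOrbit-black {L} {q} {r} = go
  where
  mixed : ∀ d {s s′} → black s ≡ true → black s′ ≡ true → ¬ s ≈ next s′ d mod L
  mixed d p p′ s≈ = contradiction (trans (sym p) (trans (black-≈ s≈) (trans (black-next _ d) (cong not p′)))) λ ()
  mixed′ : ∀ d {s s′} → black s ≡ true → black s′ ≡ true → ¬ next s d ≈ s′ mod L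
  mixed′ d p p′ s≈ = mixed d p′ p (≈-sym s≈)
  cancel : ∀ d → next q d ≈ next r d mod L → q ≈ r mod L
  cancel d s≈ = subst₂ (λ s s′ → s ≈ s′ mod L) (next-opposite q d) (next-opposite r d) (next-≈ (opposite d) s≈)
  go : ∀ x y → black q ≡ true → black r ≡ true → SameOrbit L (domino q x) (domino r y) → q ≈ r mod L × x ≡ y
  go up up p p′ (_ , s) = congruent s , refl
  go dn dn p p′ (_ , s) = cancel dn (congruent s) , refl
  go rt rt p p′ (_ , s) = congruent s , refl
  go lt lt p p′ (_ , s) = cancel lt (congruent s) , refl
  go up dn p p′ (_ , s) = contradiction (congruent s) (mixed dn p p′)
  go dn up p p′ (_ , s) = contradiction (congruent s) (mixed′ dn p p′)
  go rt lt p p′ (_ , s) = contradiction (congruent s) (mixed lt p p′)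
  go lt rt p p′ (_ , s) = contradiction (congruent s) (mixed′ lt p p′)
  go up rt p p′ (() , _)
  go up lt p p′ (() , _)
  go dn rt p p′ (() , _)
  go dn lt p p′ (() , _)
  go rt up p p′ (() , _)
  go rt dn p p′ (() , _)
  go lt up p p′ (() , _)
  go lt dn p p′ (() , _)

sameOrbit-≈ : ∀ {L q r} x → q ≈ r mod L → SameOrbit L (domino q x) (domino r x)
sameOrbit-≈ up s≈ = refl , difference s≈
sameOrbit-≈ dn s≈ = refl , difference (next-≈ dn s≈)
sameOrbit-≈ lt s≈ = refl , difference (next-≈ lt s≈)
sameOrbit-≈ rt s≈ = refl , difference s≈

module _ {L : ValidLattice} (B : ReducedBasis L) where
  open ReducedBasis B
  open Enumeration

  private
    sameOrbit-trans : ∀ {d e f} → SameOrbit L d f → SameOrbit L e f → SameOrbit L d e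
    sameOrbit-trans {d} {e} {f} (p , s) (q , r) = trans p (sym q) ,
      difference {proj₁ d} {proj₁ e} {L} (≈-trans {s = proj₁ d} {proj₁ f} {proj₁ e} (congruent s) (≈-sym (congruent r)))

    Distinct : GridEdge → GridEdge → Set
    Distinct e f = ¬ SameOrbit L (crossing e) (crossing f)

    signOf : GridEdge → ℤ
    signOf e = sign (black (leftOf e))

    hits : Domino → GridEdge → Bool
    hits d e = does (sameOrbit? L (crossing e) d)

    no-hit : ∀ d (C : GridEdge → Square) u → All (λ e → hits d e ≡ false) u →
             does (any? (λ e → sameOrbit? L (crossing e) d ×-dec black? (C e)) u) ≡ false
    no-hit d C []      []         = refl
    no-hit d C (e ∷ u) (eq ∷ eqs) =
      cong₂ (λ h a → (h ∧ does (black? (C e))) ∨ a) eq (no-hit d C u eqs)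

    no-hit-sum : ∀ d u → All (λ e → hits d e ≡ false) u → listSum (λ e → ⟦ hits d e ⟧ * signOf e) u ≡ 0ℤ
    no-hit-sum d []      []         = refl
    no-hit-sum d (e ∷ u) (eq ∷ eqs) = cong₂ (λ c s → ⟦ c ⟧ * signOf e + s) eq (no-hit-sum d u eqs)

  -- An orbit of dominoes meets at most one step of the path, so the search for a left or a right
  -- crossing amounts to a signed sum. The sum, unlike the search, is linear and can be exchanged
  -- with the sum over dominoes.
  crossingExponent-sum : ∀ {u} → AllPairs Distinct u → ∀ d →
                         crossingExponent u d ≡ listSum (λ e → ⟦ hits d e ⟧ * signOf e) u
  crossingExponent-sum {[]} [] d = refl
  crossingExponent-sum {e ∷ u} (e# ∷ u#) d = go (hits d e) refl
    where
    leftAny = does (any? (λ e → sameOrbit? L (crossing e) d ×-dec black? (leftOf e)) u)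
    rightAny = does (any? (λ e → sameOrbit? L (crossing e) d ×-dec black? (rightOf e)) u)
    value : Bool → Bool → Bool → Bool → Bool → ℤ
    value h l r a c = if (h ∧ l) ∨ a then 1ℤ else if (h ∧ r) ∨ c then -1ℤ else 0ℤ
    unfold : crossingExponent (e ∷ u) d ≡ value (hits d e) (black (leftOf e)) (not (black (leftOf e))) leftAny rightAny
    unfold = cong₂ (λ l r → value (hits d e) l r leftAny rightAny) (does-black (leftOf e))
                   (trans (does-black (rightOf e)) (black-rightOf e))
    go : ∀ c → hits d e ≡ c → crossingExponent (e ∷ u) d ≡
         ⟦ hits d e ⟧ * signOf e + listSum (λ e → ⟦ hits d e ⟧ * signOf e) u
    go true hit = begin
      crossingExponent (e ∷ u) d
        ≡⟨ unfold ⟩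
      value (hits d e) (black (leftOf e)) (not (black (leftOf e))) leftAny rightAny
        ≡⟨ cong (λ h → value h (black (leftOf e)) (not (black (leftOf e))) leftAny rightAny) hit ⟩
      value true (black (leftOf e)) (not (black (leftOf e))) leftAny rightAny
        ≡⟨ cong₂ (value true (black (leftOf e)) (not (black (leftOf e))))
                 (no-hit d leftOf u missed) (no-hit d rightOf u missed) ⟩
      value true (black (leftOf e)) (not (black (leftOf e))) false false
        ≡⟨ by-color (black (leftOf e)) ⟩
      ⟦ true ⟧ * signOf e + 0ℤ
        ≡⟨ cong₂ (λ c s → ⟦ c ⟧ * signOf e + s) (sym hit) (sym (no-hit-sum d u missed)) ⟩
      _ ∎
      where
      open ≡-Reasoning
      missed : All (λ f → hits d f ≡ false) u
      missed = All.map (λ {f} e#f → dec-false (sameOrbit? L (crossing f) d) λ so →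
        e#f (sameOrbit-trans {crossing e} {crossing f} {d} (does-true (sameOrbit? L (crossing e) d) hit) so)) e#
      by-color : ∀ c → value true c (not c) false false ≡ 1ℤ * sign c + 0ℤ
      by-color true  = refl
      by-color false = refl
    go false miss = trans unfold (trans
      (cong (λ h → value h (black (leftOf e)) (not (black (leftOf e))) leftAny rightAny) miss)
      (trans (crossingExponent-sum {u} u# d) (trans (sym (ℤ.+-identityˡ _))
        (cong (λ h → ⟦ h ⟧ * signOf e + listSum (λ e → ⟦ hits d e ⟧ * signOf e) u) (sym miss)))))

  -- Opaque, since comparing unfolded crossing exponents is prohibitively slow.
  opaque
    crossingNumber : List GridEdge → Domino → ℤ
    crossingNumber = crossingExponent

    crossingNumber-sum : ∀ {u} → AllPairs Distinct u → ∀ d →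
                         crossingNumber u d ≡ listSum (λ e → ⟦ hits d e ⟧ * signOf e) u
    crossingNumber-sum = crossingExponent-sum

    weight-crossingNumber : ∀ d → weight d ≡ (edgeSign d , crossingNumber path₀ d , crossingNumber path₁ d)
    weight-crossingNumber d = refl

  private
    path₀-distinct : ∀ {n} → n ℕ.≤ x₀ → ∀ y {j k} → j ℕ.< k → k ℕ.< n → Distinct ((+ j , y) , hor) ((+ k , y) , hor)
    path₀-distinct n≤x₀ y {j} {k} j<k k<n (_ , s) = contradiction
      (ℤ.+-injective (cong proj₁ (Domain-unique B {+ j , 0ℤ} {+ k , 0ℤ} (inDomain (ℕ.<-trans j<k k<n)) (inDomain k<n)
        (congruent (subst (_∈ᴸ L) (cong₂ _,_ (i₁ (+ j) (+ k)) (i₂ y)) s))))) (ℕ.<⇒≢ j<k)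
      where
      i₁ : ∀ j k → (j - 0ℤ) - (k - 0ℤ) ≡ j - k
      i₁ = solve-∀
      i₂ : ∀ y → (y - 1ℤ) - (y - 1ℤ) ≡ 0ℤ - 0ℤ
      i₂ = solve-∀
      inDomain : ∀ {k} → k ℕ.< _ → (+ k , 0ℤ) ∈ Domain
      inDomain k<n = (ℤ.+≤+ z≤n , ℤ.+<+ (ℕ.<-≤-trans k<n n≤x₀)) , (ℤ.+≤+ z≤n , ℤ.+<+ y₁-pos)

    path-ver-distinct : ∀ {j k} → j ℕ.< k → k ℕ.< y₁ → Distinct ((0ℤ , + j) , ver) ((0ℤ , + k) , ver)
    path-ver-distinct {j} {k} j<k k<n (_ , s) = contradiction
      (ℤ.+-injective (cong proj₂ (Domain-unique B {0ℤ , + j} {0ℤ , + k} (inDomain (ℕ.<-trans j<k k<n)) (inDomain k<n)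
        (congruent (subst (_∈ᴸ L) (cong (0ℤ ,_) (i (+ j) (+ k))) s))))) (ℕ.<⇒≢ j<k)
      where
      i : ∀ j k → (j - 0ℤ) - (k - 0ℤ) ≡ j - k
      i = solve-∀
      inDomain : ∀ {k} → k ℕ.< y₁ → (0ℤ , + k) ∈ Domain
      inDomain k<n = (ℤ.+≤+ z≤n , ℤ.+<+ x₀-pos) , (ℤ.+≤+ z≤n , ℤ.+<+ k<n)

    map-distinct : ∀ (g : ℕ → GridEdge) n → (∀ {j k} → j ℕ.< k → k ℕ.< n → Distinct (g j) (g k)) →
                   AllPairs Distinct (map g (upTo n))
    map-distinct g n d = subst (AllPairs Distinct) (sym (List.map-upTo g n)) (AllPairs.applyUpTo⁺₁ g n d)

  path₀-AllPairs : AllPairs Distinct path₀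
  path₀-AllPairs = map-distinct _ x₀ (path₀-distinct ℕ.≤-refl 0ℤ)

  path₁-AllPairs : AllPairs Distinct path₁
  path₁-AllPairs = AllPairs.++⁺ (map-distinct _ y₁ path-ver-distinct)
    (map-distinct _ x₁ (path₀-distinct (ℕ.<⇒≤ x₁-bound) (+ y₁)))
    -- The two pieces share no orbit: vertical steps cross horizontal dominoes, and horizontal steps
    -- cross vertical ones.
    (All.map⁺ (All.universal (λ _ → All.map⁺ (All.universal (λ { _ (() , _) }) (upTo x₁))) (upTo y₁)))

  module _ {m} (b : Enumeration BlackDomain m) (w : Enumeration WhiteDomain m) (M : Matching B b w) where
    open Matching

    placed : Fin m → Domino
    placed i = domino (at b i) (dirs M i)

    private
      F = matchedField B b w M

      crossed : GridEdge → Bool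
      crossed (p , a) = points F p (crossDir a)

      hits-domino : ∀ q x → black q ≡ true →
                    ∑.sum (λ i → ⟦ does (sameOrbit? L (domino q x) (placed i)) ⟧) ≡ ⟦ points F q x ⟧
      hits-domino q x q-black = go (dir F q ≟ᵈ x)
        where
        k = proj₁ (blackIndex B b w q-black)
        q≈b = proj₂ (blackIndex B b w q-black)
        hit : ∀ i → does (sameOrbit? L (domino q x) (placed i)) ≡ true → q ≈ at b i mod L × x ≡ dirs M i
        hit i eq = sameOrbit-black x (dirs M i) q-black (black-b B b w i)
          (does-true (sameOrbit? L (domino q x) (placed i)) eq)
        go : (D : Dec (dir F q ≡ x)) → ∑.sum (λ i → ⟦ does (sameOrbit? L (domino q x) (placed i)) ⟧) ≡ ⟦ does D ⟧
        go (yes eq) = ∑-indicator (λ i → does (sameOrbit? L (domino q x) (placed i))) k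
          (dec-true (sameOrbit? L (domino q x) (placed k))
            (subst (λ y → SameOrbit L (domino q x) (domino (at b k) y))
              (trans (sym eq) (direction-black B b w M q≈b)) (sameOrbit-≈ x q≈b)))
          (λ i eq → blackIndex-unique B b w (proj₁ (hit i eq)) q≈b)
        go (no neq) = trans (∑.sum-cong-≗ λ i → cong ⟦_⟧ (miss i _ refl)) (∑.sum-replicate-zero m)
          where
          miss : ∀ i c → does (sameOrbit? L (domino q x) (placed i)) ≡ c →
                 does (sameOrbit? L (domino q x) (placed i)) ≡ false
          miss i true  eq = contradiction (trans (direction-black B b w M (proj₁ (hit i eq))) (sym (proj₂ (hit i eq)))) neq
          miss i false eq = eq

      -- Each orbit of dominoes of the tiling is placed once, at its black square in the domain. If
      -- the square at p is white, the domino is described from its other end.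
      hits-crossed : ∀ e → ∑.sum (λ i → ⟦ hits (placed i) e ⟧) ≡ ⟦ crossed e ⟧
      hits-crossed (p , a) = trans
        (cong (λ d → ∑.sum (λ i → ⟦ does (sameOrbit? L d (placed i)) ⟧)) (crossing-domino p a))
        (go (black p) refl)
        where
        x = crossDir a
        go : ∀ c → black p ≡ c → ∑.sum (λ i → ⟦ does (sameOrbit? L (domino p x) (placed i)) ⟧) ≡ ⟦ points F p x ⟧
        go true  eq = hits-domino p x eq
        go false eq = trans
          (cong (λ d → ∑.sum (λ i → ⟦ does (sameOrbit? L d (placed i)) ⟧)) (sym (domino-next p x)))
          (trans (hits-domino (next p x) (opposite x) (next-white B b w x eq)) (cong ⟦_⟧ (points-next F p x)))

    exponent : List GridEdge → ℤ
    exponent u = ∑.sum (λ i → crossingNumber u (placed i))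

    private
      crossed-sum : ∀ e → ∑.sum (λ i → ⟦ hits (placed i) e ⟧ * signOf e) ≡ ⟦ crossed e ⟧ * signOf e
      crossed-sum e = trans (sym (∑.*-distribʳ-sum (signOf e) (λ i → ⟦ hits (placed i) e ⟧)))
                            (cong (_* signOf e) (hits-crossed e))

      exponent-crossed : ∀ u → AllPairs Distinct u → exponent u ≡ listSum (λ e → ⟦ crossed e ⟧ * signOf e) u
      exponent-crossed u u# = trans
        (∑.sum-cong-≗ {m} {λ i → crossingNumber u (placed i)} {λ i → listSum (λ e → ⟦ hits (placed i) e ⟧ * signOf e) u}
          (λ i → crossingNumber-sum {u} u# (placed i)))
        (trans (listSum-∑ (λ i e → ⟦ hits (placed i) e ⟧ * signOf e) u) (listSum-cong crossed-sum u))

    -- An increment is four times the signed crossing minus the sign of the step; the crossings add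
    -- up to the exponent, and the signs depend on the path alone.
    exponent-increment : ∀ {u} → AllPairs Distinct u →
                         listSum (increment F) u ≡ + 4 * exponent u - listSum signOf u
    exponent-increment {u} u# = trans (local u) (cong (λ c → + 4 * c - listSum signOf u) (sym (exponent-crossed u u#)))
      where
      rearrange : ∀ s r a c → s * (+ 4 * r - 1ℤ) + (+ 4 * a - c) ≡ + 4 * (r * s + a) - (s + c)
      rearrange = solve-∀
      local : ∀ u → listSum (increment F) u ≡ + 4 * listSum (λ e → ⟦ crossed e ⟧ * signOf e) u - listSum signOf u
      local []            = refl
      local (e@(p , a) ∷ u) = trans (cong (λ c → increment F e + c) (local u))
        (rearrange (signOf e) ⟦ crossed e ⟧ (listSum (λ e → ⟦ crossed e ⟧ * signOf e) u) (listSum signOf u))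

    module _ {h} (pot : IsPotential F h) where
      open IsPotential pot

      private
        difference-step : ∀ p a {q} → p +ᵛ unit a ≡ q → increment F (p , a) ≡ h q - h p
        difference-step p a refl = sym (trans (cong (_- h p) (step p a)) (cancel (h p) (increment F (p , a))))
          where
          cancel : ∀ x y → (x + y) - x ≡ y
          cancel = solve-∀

        suc-hor : ∀ k y → (+ k , y) +ᵛ unit hor ≡ (+ ℕ.suc k , y)
        suc-hor k y = trans (+ᵛ-hor (+ k) y) (cong (λ n → (+ n , y)) (ℕ.+-comm k 1))

        suc-ver : ∀ k → (0ℤ , + k) +ᵛ unit ver ≡ (0ℤ , + ℕ.suc k)
        suc-ver k = trans (+ᵛ-ver 0ℤ (+ k)) (cong (λ n → (0ℤ , + n)) (ℕ.+-comm k 1))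

        hor-run : ∀ n y → listSum (increment F) (map (λ k → (+ k , y) , hor) (upTo n)) ≡ h (+ n , y) - h (0ℤ , y)
        hor-run n y = telescope _ (increment F) (λ k → h (+ k , y)) (λ k → difference-step _ hor (suc-hor k y)) n

        ver-run : ∀ n → listSum (increment F) (map (λ k → (0ℤ , + k) , ver) (upTo n)) ≡ h (0ℤ , + n) - h (0ℤ , 0ℤ)
        ver-run n = telescope _ (increment F) (λ k → h (0ℤ , + k)) (λ k → difference-step _ ver (suc-ver k)) n

        hor-signs : ∀ n y → listSum signOf (map (λ k → (+ k , y) , hor) (upTo n)) ≡ ⟦ odd (+ n) ⟧ * sign (not (odd y))
        hor-signs n y = alternating-sum _ (λ e → black (leftOf e)) (not (odd y))
          (λ k → trans (black-odd (+ k) y)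
            (agree 2 (λ a c → not (a xor c)) (λ a c → not c xor a) refl (odd (+ k)) (odd y))) n

        ver-signs : ∀ n → listSum signOf (map (λ k → (0ℤ , + k) , ver) (upTo n)) ≡ ⟦ odd (+ n) ⟧ * -1ℤ
        ver-signs n = alternating-sum _ (λ e → black (leftOf e)) false
          (λ k → trans (black-next (0ℤ , + k) lt) (trans (cong not (black-odd 0ℤ (+ k)))
            (trans (Bool.not-involutive _) (cong (_xor odd (+ k)) (odd-⟦⟧ false))))) n

        h-0 : ∀ c → c - h (0ℤ , 0ℤ) ≡ c
        h-0 c = trans (cong (λ d → c - d) origin) (ℤ.+-identityʳ c)

      -- The signs along `path₀` cancel because `x₀` is even.
      height-v₀ : h v₀ ≡ + 4 * exponent path₀
      height-v₀ = begin
        h v₀                                          ≡⟨ sym (h-0 (h v₀)) ⟩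
        h v₀ - h (0ℤ , 0ℤ)                            ≡⟨ sym (hor-run x₀ 0ℤ) ⟩
        listSum (increment F) path₀                   ≡⟨ exponent-increment path₀-AllPairs ⟩
        + 4 * exponent path₀ - listSum signOf path₀   ≡⟨ cong (λ c → + 4 * exponent path₀ - c) (trans (hor-signs x₀ 0ℤ)
                                                           (cong (λ o → ⟦ o ⟧ * sign (not (odd 0ℤ))) (x₀-even B))) ⟩
        + 4 * exponent path₀ - 0ℤ                     ≡⟨ ℤ.+-identityʳ _ ⟩
        + 4 * exponent path₀                          ∎
        where open ≡-Reasoning

      -- If `x₁` and `y₁` are odd, the signs on each straight piece of `path₁` add up to -1, the
      -- sign of an edge with a white square on its left. The resulting 2 is the origin of the ½ in
      -- the correspondence for `v₁` in `𝓞`.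
      height-v₁ : h v₁ ≡ + 4 * exponent path₁ + ⟦ odd (+ x₁) ⟧ * + 2
      height-v₁ = begin
        h v₁
          ≡⟨ sym (h-0 (h v₁)) ⟩
        h v₁ - h (0ℤ , 0ℤ)
          ≡⟨ collapse (h (0ℤ , 0ℤ)) (h (0ℤ , + y₁)) (h v₁) ⟩
        (h (0ℤ , + y₁) - h (0ℤ , 0ℤ)) + (h v₁ - h (0ℤ , + y₁))
          ≡⟨ sym (trans (listSum-++ (increment F) (map (λ k → (0ℤ , + k) , ver) (upTo y₁)) _)
               (cong₂ _+_ (ver-run y₁) (hor-run x₁ (+ y₁)))) ⟩
        listSum (increment F) path₁
          ≡⟨ exponent-increment path₁-AllPairs ⟩
        + 4 * exponent path₁ - listSum signOf path₁
          ≡⟨ cong (λ c → + 4 * exponent path₁ + c) signs ⟩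
        + 4 * exponent path₁ + ⟦ odd (+ x₁) ⟧ * + 2 ∎
        where
        open ≡-Reasoning
        collapse : ∀ a b c → c - a ≡ (b - a) + (c - b)
        collapse = solve-∀
        corner : ∀ o → - (⟦ o ⟧ * -1ℤ + ⟦ o ⟧ * sign (not o)) ≡ ⟦ o ⟧ * + 2
        corner true  = refl
        corner false = refl
        signs : - listSum signOf path₁ ≡ ⟦ odd (+ x₁) ⟧ * + 2
        signs = trans (cong -_ (trans (listSum-++ signOf (map (λ k → (0ℤ , + k) , ver) (upTo y₁)) _)
          (cong₂ _+_ (ver-signs y₁) (hor-signs x₁ (+ y₁)))))
          (trans (cong (λ o → - (⟦ o ⟧ * -1ℤ + ⟦ odd (+ x₁) ⟧ * sign (not o))) (sym (∈ᴸ-parity L v₁-mem)))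
                 (corner (odd (+ x₁))))

-- Expansion of the determinant

filter-map : ∀ {A B : Set} {P : B → Set} (P? : Decidable P) (f : A → B) xs →
             filter P? (map f xs) ≡ map f (filter (P? ∘ f) xs)
filter-map P? f []       = refl
filter-map P? f (x ∷ xs) with does (P? (f x))
... | true  = cong (f x ∷_) (filter-map P? f xs)
... | false = filter-map P? f xs

xorSum : ∀ {A : Set} → (A → Bool) → List A → Bool
xorSum f []       = false
xorSum f (x ∷ xs) = f x xor xorSum f xs

xorSum-++ : ∀ {A : Set} (f : A → Bool) xs ys → xorSum f (xs ++ ys) ≡ xorSum f xs xor xorSum f ys
xorSum-++ f []       ys = refl
xorSum-++ f (x ∷ xs) ys = trans (cong (f x xor_) (xorSum-++ f xs ys)) (sym (Bool.xor-assoc (f x) _ _))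

xorSum-cartesianProduct : ∀ {A B : Set} (f : A × B → Bool) xs ys →
                          xorSum f (cartesianProduct xs ys) ≡ xorSum (λ x → xorSum (λ y → f (x , y)) ys) xs
xorSum-cartesianProduct f []       ys = refl
xorSum-cartesianProduct f (x ∷ xs) ys = trans (xorSum-++ f (map (x ,_) ys) _)
  (cong₂ _xor_ (row ys) (xorSum-cartesianProduct f xs ys))
  where
  row : ∀ ys → xorSum f (map (x ,_) ys) ≡ xorSum (λ y → f (x , y)) ys
  row []       = refl
  row (y ∷ ys) = cong (f (x , y) xor_) (row ys)

xorSum-allFin : ∀ {n} (f : Fin n → Bool) → xorSum f (allFin n) ≡ ∑₂.sum f
xorSum-allFin f = go f (λ i → i)
  where
  go : ∀ {n} {A : Set} (f : A → Bool) (g : Fin n → A) → xorSum f (List.tabulate g) ≡ ∑₂.sum (f ∘ g)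
  go {ℕ.zero}  f g = refl
  go {ℕ.suc n} f g = cong (f (g zero) xor_) (go f (g ∘ suc))

odd-length-filter : ∀ {A : Set} {P : A → Set} (P? : Decidable P) xs →
                    odd (+ length (filter P? xs)) ≡ xorSum (does ∘ P?) xs
odd-length-filter P? []       = odd-⟦⟧ false
odd-length-filter P? (x ∷ xs) with does (P? x)
... | false = odd-length-filter P? xs
... | true  = trans (odd-+ 1ℤ (+ length (filter P? xs))) (cong₂ _xor_ odd-1 (odd-length-filter P? xs))

odd-inversions : ∀ {n} (π : Permutation′ n) → odd (+ inversions π) ≡ inversionParity π
odd-inversions {n} π = trans (odd-length-filter {P = λ (i , j) → i Fin.< j × (π ⟨$⟩ʳ j) Fin.< (π ⟨$⟩ʳ i)}
    (λ (i , j) → i Fin.<? j ×-dec (π ⟨$⟩ʳ j) Fin.<? (π ⟨$⟩ʳ i)) (cartesianProduct (allFin n) (allFin n)))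
  (trans (xorSum-cartesianProduct (λ (i , j) → before i j ∧ before (π ⟨$⟩ʳ j) (π ⟨$⟩ʳ i)) (allFin n) (allFin n))
  (trans (xorSum-allFin (λ i → xorSum (inverted i) (allFin n))) (∑₂.sum-cong-≗ λ i → xorSum-allFin (inverted i))))
  where
  inverted : Fin n → Fin n → Bool
  inverted i j = before i j ∧ before (π ⟨$⟩ʳ j) (π ⟨$⟩ʳ i)

parityOf : Bool → ℤ
parityOf b = sign (not b)

parityOf-xor : ∀ a b → parityOf (a xor b) ≡ parityOf a * parityOf b
parityOf-xor true  true  = refl
parityOf-xor true  false = refl
parityOf-xor false true  = refl
parityOf-xor false false = refl

-- Permutations are compared through their values, since equality of the records would demand
-- equality of functions and of proofs.
permutationSetoid : ℕ → Setoid 0ℓ 0ℓ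
permutationSetoid n = record
  { Carrier       = Permutation′ n
  ; _≈_           = λ π ρ → ∀ i → π ⟨$⟩ʳ i ≡ ρ ⟨$⟩ʳ i
  ; isEquivalence = record
    { refl  = λ i → refl
    ; sym   = λ eq i → sym (eq i)
    ; trans = λ p q i → trans (p i) (q i)
    }
  }

permutations-unique : ∀ n → AllPairs (λ π ρ → ¬ (∀ i → π ⟨$⟩ʳ i ≡ ρ ⟨$⟩ʳ i)) (permutations n)
permutations-unique ℕ.zero    = [] ∷ []
permutations-unique (ℕ.suc n) = UniqueSetoid.cartesianProductWith⁺
  (setoid (Fin (ℕ.suc n))) (permutationSetoid n) (permutationSetoid (ℕ.suc n)) (Perm.insert zero)
  (λ {a} {b} {π} {ρ} → insert-injective a b π ρ) (Unique.allFin⁺ (ℕ.suc n)) (permutations-unique n)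
  where
  insert-injective : ∀ a b (π ρ : Permutation′ n) →
                     (∀ i → Perm.insert zero a π ⟨$⟩ʳ i ≡ Perm.insert zero b ρ ⟨$⟩ʳ i) →
                     a ≡ b × (∀ i → π ⟨$⟩ʳ i ≡ ρ ⟨$⟩ʳ i)
  insert-injective a b π ρ eq with eq zero
  ... | refl = refl , λ i → Fin.punchIn-injective a _ _
    (trans (sym (Perm.insert-punchIn zero a π i)) (trans (eq (suc i)) (Perm.insert-punchIn zero a ρ i)))

permutations-complete : ∀ {n} (π : Permutation′ n) → ∃[ ρ ] ρ ∈ˡ permutations n × (∀ i → ρ ⟨$⟩ʳ i ≡ π ⟨$⟩ʳ i)
permutations-complete {ℕ.zero}  π = Perm.id , here refl , λ ()
permutations-complete {ℕ.suc n} π with permutations-complete (Perm.remove zero π)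
... | ρ , ρ∈ , ρ≡ = Perm.insert zero (π ⟨$⟩ʳ zero) ρ ,
  List.∈-cartesianProductWith⁺ (Perm.insert zero) (List.∈-allFin (π ⟨$⟩ʳ zero)) ρ∈ , eq
  where
  eq : ∀ i → Perm.insert zero (π ⟨$⟩ʳ zero) ρ ⟨$⟩ʳ i ≡ π ⟨$⟩ʳ i
  eq zero    = refl
  eq (suc i) = trans (Perm.insert-punchIn zero (π ⟨$⟩ʳ zero) ρ i) (trans
    (cong (punchIn (π ⟨$⟩ʳ zero)) (ρ≡ i))
    (trans (sym (Perm.insert-punchIn zero (π ⟨$⟩ʳ zero) (Perm.remove zero π) i)) (Perm.insert-remove zero π (suc i))))

-- Terms of the determinant of a matrix of formal sums

module Laurent = RawRing laurentRing
open RawSemiringDefs Laurent.rawSemiring using (product) renaming (_^_ to _^ᴸ_)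

infixl 7 _⊗_
_⊗_ : Monomial → Monomial → Monomial
(c , i , j) ⊗ (c′ , i′ , j′) = c * c′ , i + i′ , j + j′

power-−1 : ∀ n → (Laurent.- Laurent.1#) ^ᴸ n ≡ (parityOf (odd (+ n)) , 0ℤ , 0ℤ) ∷ []
power-−1 ℕ.zero    = cong (λ o → (parityOf o , 0ℤ , 0ℤ) ∷ []) (sym (odd-⟦⟧ false))
power-−1 (ℕ.suc n) = trans (cong ((Laurent.- Laurent.1#) Laurent.*_) (power-−1 n))
  (cong (λ c → (c , 0ℤ , 0ℤ) ∷ []) (trans (sym (parityOf-xor true (odd (+ n))))
    (cong parityOf (trans (cong (_xor odd (+ n)) (sym odd-1)) (sym (odd-+ 1ℤ (+ n)))))))

module _ {X : Set} where

  selections : ∀ {n} → (Fin n → List X) → List (Vec X n)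
  selections {ℕ.zero}  A = [] ∷ []
  selections {ℕ.suc n} A = cartesianProductWith _∷_ (A zero) (selections (A ∘ suc))

  selections-∈⁺ : ∀ {n} (A : Fin n → List X) v → (∀ i → Vec.lookup v i ∈ˡ A i) → v ∈ˡ selections A
  selections-∈⁺ A []      v∈ = here refl
  selections-∈⁺ A (x ∷ v) v∈ = List.∈-cartesianProductWith⁺ _∷_ (v∈ zero) (selections-∈⁺ (A ∘ suc) v (v∈ ∘ suc))

  selections-∈⁻ : ∀ {n} (A : Fin n → List X) {v} → v ∈ˡ selections A → ∀ i → Vec.lookup v i ∈ˡ A i
  selections-∈⁻ {ℕ.suc n} A v∈ i
    with List.∈-cartesianProductWith⁻ _∷_ (A zero) (selections (A ∘ suc)) v∈
  selections-∈⁻ {ℕ.suc n} A v∈ zero    | x , v , x∈ , _  , refl = x∈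
  selections-∈⁻ {ℕ.suc n} A v∈ (suc i) | x , v , _  , v∈′ , refl = selections-∈⁻ (A ∘ suc) v∈′ i

  selections-unique : ∀ {n} (A : Fin n → List X) → (∀ i → Unique (A i)) → Unique (selections A)
  selections-unique {ℕ.zero}  A A! = [] ∷ []
  selections-unique {ℕ.suc n} A A! = Unique.cartesianProductWith⁺ _∷_
    (λ eq → Vec.∷-injective eq) (A! zero) (selections-unique (A ∘ suc) (A! ∘ suc))

  Term : ℕ → Set
  Term n = Permutation′ n × Vec X n

  row : ∀ {n} → (Fin n → Fin n → List X) → Permutation′ n → List (Vec X n)
  row A π = selections λ i → A i (π ⟨$⟩ʳ i)

  expansion : ∀ {n} → (Fin n → Fin n → List X) → List (Term n)
  expansion {n} A = concat (map (λ π → map (π ,_) (row A π)) (permutations n))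

  expansion-∈⁺ : ∀ {n} {A : Fin n → Fin n → List X} {π v} → π ∈ˡ permutations n →
                 (∀ i → Vec.lookup v i ∈ˡ A i (π ⟨$⟩ʳ i)) → (π , v) ∈ˡ expansion A
  expansion-∈⁺ {A = A} {π} {v} π∈ v∈ = List.∈-concat⁺′
    (List.∈-map⁺ (π ,_) (selections-∈⁺ (λ i → A i (π ⟨$⟩ʳ i)) v v∈))
    (List.∈-map⁺ (λ π → map (π ,_) (row A π)) π∈)

  expansion-∈⁻ : ∀ {n} {A : Fin n → Fin n → List X} {τ} → τ ∈ˡ expansion A →
                 ∀ i → Vec.lookup (proj₂ τ) i ∈ˡ A i (proj₁ τ ⟨$⟩ʳ i)
  expansion-∈⁻ {n} {A} τ∈ with List.∈-concat⁻′ (map (λ π → map (π ,_) (row A π)) (permutations n)) τ∈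
  ... | _ , τ∈′ , row∈ with List.∈-map⁻ (λ π → map (π ,_) (row A π)) row∈
  ...   | π , _ , refl with List.∈-map⁻ (π ,_) τ∈′
  ...     | v , v∈ , refl = selections-∈⁻ (λ i → A i (π ⟨$⟩ʳ i)) v∈

  -- An entry determines its column, so the selected entries determine the values of the
  -- permutation. Terms can therefore be told apart by their selections alone.
  expansion-unique : ∀ {n} (A : Fin n → Fin n → List X) → (∀ i j → Unique (A i j)) →
                     (∀ {i j k x} → x ∈ˡ A i j → x ∈ˡ A i k → j ≡ k) →
                     AllPairs (λ σ τ → proj₂ σ ≢ proj₂ τ) (expansion A)
  expansion-unique {n} A A! column = AllPairs.concat⁺
    (All.map⁺ (All.universal
      (λ π → AllPairs.map⁺ (selections-unique (λ i → A i (π ⟨$⟩ʳ i)) λ i → A! i (π ⟨$⟩ʳ i)))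
      (permutations n)))
    (AllPairs.map⁺ (AllPairs.map apart (permutations-unique n)))
    where
    apart : ∀ {π ρ} → ¬ (∀ i → π ⟨$⟩ʳ i ≡ ρ ⟨$⟩ʳ i) →
            All (λ σ → All (λ τ → proj₂ σ ≢ proj₂ τ) (map (ρ ,_) (row A ρ))) (map (π ,_) (row A π))
    apart {π} {ρ} π≢ρ = All.map⁺ (All.tabulate λ {v} v∈ → All.map⁺ (All.tabulate λ {v′} v′∈ v≡v′ →
      π≢ρ λ i → column (selections-∈⁻ (λ i → A i (π ⟨$⟩ʳ i)) v∈ i)
        (subst (λ u → Vec.lookup u i ∈ˡ A i (ρ ⟨$⟩ʳ i)) (sym v≡v′) (selections-∈⁻ (λ i → A i (ρ ⟨$⟩ʳ i)) v′∈ i))))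

  module _ (μ : X → Monomial) where

    selectionMonomial : ∀ {n} → Vec X n → Monomial
    selectionMonomial []      = 1ℤ , 0ℤ , 0ℤ
    selectionMonomial (x ∷ v) = μ x ⊗ selectionMonomial v

    termMonomial : ∀ {n} → Term n → Monomial
    termMonomial (π , v) = (parityOf (inversionParity π) , 0ℤ , 0ℤ) ⊗ selectionMonomial v

    private
      multiply-map : ∀ {n} (xs : List X) (vs : List (Vec X n)) →
                     map μ xs Laurent.* map selectionMonomial vs ≡ map selectionMonomial (cartesianProductWith _∷_ xs vs)
      multiply-map []       vs = refl
      multiply-map (x ∷ xs) vs = trans
        (cong₂ _++_ (trans (sym (List.map-∘ vs)) (List.map-∘ vs)) (multiply-map xs vs))
        (sym (List.map-++ selectionMonomial (map (x ∷_) vs) (cartesianProductWith _∷_ xs vs)))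

    product-selections : ∀ {n} (A : Fin n → List X) →
                         product (λ i → map μ (A i)) ≡ map selectionMonomial (selections A)
    product-selections {ℕ.zero}  A = refl
    product-selections {ℕ.suc n} A = trans (cong (map μ (A zero) Laurent.*_) (product-selections (A ∘ suc)))
      (multiply-map (A zero) (selections (A ∘ suc)))

    -- Formal sums do not collect equal exponents, so the determinant is literally the list of the
    -- monomials of its terms and every term can be counted.
    det-expansion : ∀ {n} (A : Fin n → Fin n → List X) →
                    det laurentRing (λ i j → map μ (A i j)) ≡ map termMonomial (expansion A)
    det-expansion {n} A = trans
      (cong concat (trans (List.map-cong term (permutations n)) (List.map-∘ (permutations n))))
      (List.concat-map (map (λ π → map (π ,_) (row A π)) (permutations n)))
      where
      term : ∀ π → ((Laurent.- Laurent.1#) ^ᴸ inversions π) Laurent.* product (λ i → map μ (A i (π ⟨$⟩ʳ i))) ≡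
                   map termMonomial (map (π ,_) (row A π))
      term π = trans (cong₂ Laurent._*_
          (trans (power-−1 (inversions π)) (cong (λ o → (parityOf o , 0ℤ , 0ℤ) ∷ []) (odd-inversions π)))
          (product-selections (λ i → A i (π ⟨$⟩ʳ i))))
        (trans (List.++-identityʳ _) (trans (sym (List.map-∘ vs)) (List.map-∘ vs)))
        where vs = row A π

    termExponents : ∀ {n} → Term n → ℤ × ℤ
    termExponents = proj₂ ∘ termMonomial

    exponents? : ∀ {n} (e : ℤ × ℤ) → Decidable (λ (τ : Term n) → termExponents τ ≡ e)
    exponents? e τ = ≡-dec ℤ._≟_ ℤ._≟_ (termExponents τ) e

    private
      sum-equal : ∀ {A : Set} (f : A → ℤ) c xs → (∀ {x} → x ∈ˡ xs → f x ≡ c) →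
                  List.foldr _+_ 0ℤ (map f xs) ≡ + length xs * c
      sum-equal f c []       eq = refl
      sum-equal f c (x ∷ xs) eq = trans (cong₂ _+_ (eq (here refl)) (sum-equal f c xs (eq ∘ there)))
        (sym (ℤ.suc-* (+ length xs) c))

    -- A common coefficient c excludes cancellation, so the coefficient of the determinant counts
    -- terms.
    coeff-det : ∀ {n} (A : Fin n → Fin n → List X) i j c →
                (∀ {τ} → τ ∈ˡ filter (exponents? (i , j)) (expansion A) → proj₁ (termMonomial τ) ≡ c) →
                coeff (det laurentRing (λ i j → map μ (A i j))) i j ≡
                + length (filter (exponents? (i , j)) (expansion A)) * c
    coeff-det A i j c eq = trans
      (cong (λ p → coeff p i j) (det-expansion A))
      (trans (cong (List.foldr _+_ 0ℤ) (trans (cong (map proj₁) (filter-map _ termMonomial (expansion A)))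
        (sym (List.map-∘ (filter (exponents? (i , j)) (expansion A))))))
        (sum-equal (proj₁ ∘ termMonomial) c (filter (exponents? (i , j)) (expansion A)) eq))

module _ {X : Set} {μ : X → Monomial} {c f g : X → ℤ} (μ≡ : ∀ x → μ x ≡ (c x , f x , g x)) where

  selectionMonomial-sums : ∀ {n} (v : Vec X n) (x : Fin n → X) (s : Fin n → Bool) → Vec.lookup v ≗ x →
    (∀ i → c (x i) ≡ parityOf (s i)) →
    selectionMonomial μ v ≡ (parityOf (∑₂.sum s) , ∑.sum (f ∘ x) , ∑.sum (g ∘ x))
  selectionMonomial-sums []      x s v≡ eq = refl
  selectionMonomial-sums (y ∷ v) x s v≡ eq = trans
    (cong₂ _⊗_ (trans (cong μ (v≡ zero)) (μ≡ (x zero)))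
               (selectionMonomial-sums v (x ∘ suc) (s ∘ suc) (v≡ ∘ suc) (eq ∘ suc)))
    (cong (_, f (x zero) + ∑.sum (f ∘ x ∘ suc) , g (x zero) + ∑.sum (g ∘ x ∘ suc))
      (trans (cong (_* parityOf (∑₂.sum (s ∘ suc))) (eq zero)) (sym (parityOf-xor (s zero) (∑₂.sum (s ∘ suc))))))

  termMonomial-sums : ∀ {n} π (v : Vec X n) (x : Fin n → X) (s : Fin n → Bool) → Vec.lookup v ≗ x →
    (∀ i → c (x i) ≡ parityOf (s i)) →
    termMonomial μ (π , v) ≡ (parityOf (inversionParity π xor ∑₂.sum s) , ∑.sum (f ∘ x) , ∑.sum (g ∘ x))
  termMonomial-sums π v x s v≡ eq = trans
    (cong ((parityOf (inversionParity π) , 0ℤ , 0ℤ) ⊗_) (selectionMonomial-sums v x s v≡ eq))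
    (cong₂ _,_ (sym (parityOf-xor (inversionParity π) (∑₂.sum s)))
      (cong₂ _,_ (ℤ.+-identityˡ (∑.sum (f ∘ x))) (ℤ.+-identityˡ (∑.sum (g ∘ x)))))

lookup-injective : ∀ {A B : Set} (f : A → B) {xs} → AllPairs (λ x y → f x ≢ f y) xs →
                   ∀ i j → f (lookup xs i) ≡ f (lookup xs j) → i ≡ j
lookup-injective f (x# ∷ xs#) zero    zero    eq = refl
lookup-injective f (x# ∷ xs#) zero    (suc j) eq = contradiction eq (All.lookup x# (List.∈-lookup j))
lookup-injective f (x# ∷ xs#) (suc i) zero    eq = contradiction (sym eq) (All.lookup x# (List.∈-lookup i))
lookup-injective f (x# ∷ xs#) (suc i) (suc j) eq = cong suc (lookup-injective f xs# i j eq)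

-- Counting tilings by flux

private
  fromℤ-toℚᵘ : ∀ n → ℚ.toℚᵘ (fromℤ n) ℚᵘ.≃ ℚᵘ.mkℚᵘ n 0
  fromℤ-toℚᵘ n = ℚ.toℚᵘ-fromℚᵘ (ℚᵘ.mkℚᵘ n 0)

fromℤ-+ : ∀ a b → fromℤ (a + b) ≡ fromℤ a ℚ.+ fromℤ b
fromℤ-+ a b = ℚ.toℚᵘ-injective (ℚᵘ.≃-trans (fromℤ-toℚᵘ (a + b)) (ℚᵘ.≃-trans (ℚᵘ.*≡* (i a b))
  (ℚᵘ.≃-sym (ℚᵘ.≃-trans (ℚ.toℚᵘ-homo-+ (fromℤ a) (fromℤ b)) (ℚᵘ.+-cong (fromℤ-toℚᵘ a) (fromℤ-toℚᵘ b))))))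
  where
  i : ∀ a b → (a + b) * 1ℤ ≡ (a * 1ℤ + b * 1ℤ) * 1ℤ
  i = solve-∀

fromℤ-* : ∀ a b → fromℤ (a * b) ≡ fromℤ a ℚ.* fromℤ b
fromℤ-* a b = ℚ.toℚᵘ-injective (ℚᵘ.≃-trans (fromℤ-toℚᵘ (a * b)) (ℚᵘ.≃-sym
  (ℚᵘ.≃-trans (ℚ.toℚᵘ-homo-* (fromℤ a) (fromℤ b)) (ℚᵘ.*-cong (fromℤ-toℚᵘ a) (fromℤ-toℚᵘ b)))))

fromℤ-injective : ∀ {a b} → fromℤ a ≡ fromℤ b → a ≡ b
fromℤ-injective {a} {b} eq with ℚ.fromℚᵘ-injective {ℚᵘ.mkℚᵘ a 0} {ℚᵘ.mkℚᵘ b 0} eq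
... | ℚᵘ.*≡* a≡b = trans (sym (ℤ.*-identityʳ a)) (trans a≡b (ℤ.*-identityʳ b))

*4-cancel : ∀ {p q} → fromℤ (+ 4) ℚ.* p ≡ fromℤ (+ 4) ℚ.* q → p ≡ q
*4-cancel {p} {q} eq = trans (sym (quarter p)) (trans (cong (+ 1 ℚ./ 4 ℚ.*_) eq) (quarter q))
  where
  quarter : ∀ p → + 1 ℚ./ 4 ℚ.* (fromℤ (+ 4) ℚ.* p) ≡ p
  quarter p = trans (sym (ℚ.*-assoc (+ 1 ℚ./ 4) (fromℤ (+ 4)) p)) (ℚ.*-identityˡ p)

IsHeight-≐ : ∀ {t u h} → t ≐ u → IsHeight t h → IsHeight u h
IsHeight-≐ (t⊆u , u⊆t) ht = record
  { origin    = IsHeight.origin ht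
  ; uncrossed = λ e e∉u → IsHeight.uncrossed ht e (e∉u ∘ t⊆u)
  ; crossed   = λ e e∈u → IsHeight.crossed ht e (u⊆t e∈u)
  }

module _ {L : ValidLattice} (B : ReducedBasis L) where
  open ReducedBasis B
  open Enumeration

  module Count {m} (b : Enumeration BlackDomain m) (w : Enumeration WhiteDomain m) where
    open Matching

    -- The dominoes behind an entry of the Kasteleyn matrix: `kasteleyn` is `map weight` of these
    -- lists by definition.
    choices : Fin m → Fin m → List Domino
    choices i j = filter (λ d → whiteEnd d -ᵛ at w j ∈ᴸ? L) (dominoesAt (at b i))

    whiteEnd-domino : ∀ s d → black s ≡ true → whiteEnd (domino s d) ≡ next s d
    whiteEnd-domino s up p = cong (λ c → if c then s +ᵛ unit ver else s) (trans (does-black s) p)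
    whiteEnd-domino s rt p = cong (λ c → if c then s +ᵛ unit hor else s) (trans (does-black s) p)
    whiteEnd-domino s dn p = cong (λ c → if c then (s -ᵛ unit ver) +ᵛ unit ver else s -ᵛ unit ver)
      (trans (does-black (s -ᵛ unit ver)) (next-black B b w dn p))
    whiteEnd-domino s lt p = cong (λ c → if c then (s -ᵛ unit hor) +ᵛ unit hor else s -ᵛ unit hor)
      (trans (does-black (s -ᵛ unit hor)) (next-black B b w lt p))

    choices-∈⁻ : ∀ {i j x} → x ∈ˡ choices i j → ∃[ d ] x ≡ domino (at b i) d × next (at b i) d ≈ at w j mod L
    choices-∈⁻ {i} {j} x∈ =
      let x∈′ , near = List.∈-filter⁻ (λ d → whiteEnd d -ᵛ at w j ∈ᴸ? L) {xs = dominoesAt (at b i)} x∈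
          d , _ , x≡ = List.∈-map⁻ (domino (at b i)) {xs = rt ∷ lt ∷ up ∷ dn ∷ []} x∈′
      in d , x≡ , subst (λ s → s ≈ at w j mod L) (trans (cong whiteEnd x≡) (whiteEnd-domino (at b i) d (black-b B b w i)))
                    (congruent near)

    choices-∈⁺ : ∀ {i j} d → next (at b i) d ≈ at w j mod L → domino (at b i) d ∈ˡ choices i j
    choices-∈⁺ {i} {j} d near = List.∈-filter⁺ (λ d → whiteEnd d -ᵛ at w j ∈ᴸ? L)
      (List.∈-map⁺ (domino (at b i)) (listed d))
      (difference (subst (λ s → s ≈ at w j mod L) (sym (whiteEnd-domino (at b i) d (black-b B b w i))) near))
      where
      listed : ∀ d → d ∈ˡ rt ∷ lt ∷ up ∷ dn ∷ []
      listed rt = here refl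
      listed lt = there (here refl)
      listed up = there (there (here refl))
      listed dn = there (there (there (here refl)))

    choices-unique : ∀ i j → Unique (choices i j)
    choices-unique i j = Unique.filter⁺ (λ d → whiteEnd d -ᵛ at w j ∈ᴸ? L)
      (Unique.map⁺ (domino-injective (at b i)) {rt ∷ lt ∷ up ∷ dn ∷ []}
        (((λ ()) ∷ (λ ()) ∷ (λ ()) ∷ []) ∷ ((λ ()) ∷ (λ ()) ∷ []) ∷ ((λ ()) ∷ []) ∷ [] ∷ []))

    choices-column : ∀ {i j k x} → x ∈ˡ choices i j → x ∈ˡ choices i k → j ≡ k
    choices-column {i} {j} {k} p q =
      let d , x≡ , near = choices-∈⁻ p
          d′ , x≡′ , near′ = choices-∈⁻ q
      in whiteIndex-unique B b w near (subst (λ d → next (at b i) d ≈ at w k mod L)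
           (domino-injective (at b i) (trans (sym x≡′) x≡)) near′)

    terms : List (Term m)
    terms = expansion choices

    -- The term uses the listed permutation ρ, which agrees with `perm M` only pointwise; membership
    -- in `choices` depends on values alone.
    matching-∈-terms : ∀ (M : Matching B b w) →
      (ρ : ∃[ ρ ] ρ ∈ˡ permutations m × (∀ i → ρ ⟨$⟩ʳ i ≡ perm M ⟨$⟩ʳ i)) →
      ∀ v → (∀ i → Vec.lookup v i ≡ placed B b w M i) → (proj₁ ρ , v) ∈ˡ terms
    matching-∈-terms M (ρ , ρ∈ , ρ≡) v v≡ = expansion-∈⁺ {A = choices} {ρ} {v} ρ∈
      λ i → subst₂ (λ d j → d ∈ˡ choices i j) (sym (v≡ i)) (sym (ρ≡ i)) (choices-∈⁺ (dirs M i) (join M i))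

    module _ {τ : Term m} (τ∈ : τ ∈ˡ terms) where
      private
        chosen : ∀ i → ∃[ d ] Vec.lookup (proj₂ τ) i ≡ domino (at b i) d ×
                              next (at b i) d ≈ at w (proj₁ τ ⟨$⟩ʳ i) mod L
        chosen i = choices-∈⁻ (expansion-∈⁻ {A = choices} τ∈ i)

      termMatching : Matching B b w
      termMatching = record
        { dirs = proj₁ ∘ chosen
        ; perm = proj₁ τ
        ; join = proj₂ ∘ proj₂ ∘ chosen
        }

      termMatching-placed : ∀ i → Vec.lookup (proj₂ τ) i ≡ placed B b w termMatching i
      termMatching-placed = proj₁ ∘ proj₂ ∘ chosen

    edgeSign-domino : ∀ s d → black s ≡ true → edgeSign (domino s d) ≡ parityOf (does (d ≟ᵈ rt))
    edgeSign-domino s up p = refl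
    edgeSign-domino s dn p = refl
    edgeSign-domino s rt p = cong (λ c → if c then -1ℤ else 1ℤ) (trans (does-black s) p)
    edgeSign-domino s lt p = cong (λ c → if c then -1ℤ else 1ℤ)
      (trans (does-black (s -ᵛ unit hor)) (next-black B b w lt p))

    termMonomial-matching : ∀ (M : Matching B b w) (π : Permutation′ m) (v : Vec Domino m) →
      (∀ i → Vec.lookup v i ≡ placed B b w M i) →
      termMonomial weight (π , v) ≡ (parityOf (inversionParity π xor ∑₂.sum (is B b w M rt)) ,
        exponent B b w M path₀ , exponent B b w M path₁)
    termMonomial-matching M π v v≡ =
      termMonomial-sums {μ = weight} {edgeSign} {crossingNumber B path₀} {crossingNumber B path₁} (weight-crossingNumber B)
        π v (placed B b w M) (is B b w M rt) v≡
        (λ i → edgeSign-domino (at b i) (dirs M i) (black-b B b w i))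

    exponentsOf : Matching B b w → ℤ × ℤ
    exponentsOf M = exponent B b w M path₀ , exponent B b w M path₁

    module _ (M M′ : Matching B b w) (h h′ : ℤ² → ℤ)
             (pot : IsPotential (matchedField B b w M) h) (pot′ : IsPotential (matchedField B b w M′) h′) where

      -- The exponents determine the heights at `v₀` and `v₁`, hence all periods of the height
      -- function and the flux.
      exponents⇒periodic : exponentsOf M ≡ exponentsOf M′ → ∀ {v} → v ∈ᴸ L → ∀ u →
                           h (u +ᵛ v) - h u ≡ h′ (u +ᵛ v) - h′ u
      exponents⇒periodic eq = difference-periodic B pot pot′
        (trans (height-v₀ B b w M pot) (trans (cong (λ e → + 4 * proj₁ e) eq) (sym (height-v₀ B b w M′ pot′))))
        (trans (height-v₁ B b w M pot) (trans (cong (λ e → + 4 * proj₂ e + ⟦ odd (+ x₁) ⟧ * + 2) eq)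
          (sym (height-v₁ B b w M′ pot′))))

      periodic⇒exponents : h v₀ ≡ h′ v₀ → h v₁ ≡ h′ v₁ → exponentsOf M ≡ exponentsOf M′
      periodic⇒exponents eq₀ eq₁ = cong₂ _,_
        (ℤ.*-cancelˡ-≡ (+ 4) _ _ (trans (sym (height-v₀ B b w M pot)) (trans eq₀ (height-v₀ B b w M′ pot′))))
        (ℤ.*-cancelˡ-≡ (+ 4) _ _ (+-group.∙-cancelʳ (⟦ odd (+ x₁) ⟧ * + 2) _ _
          (trans (sym (height-v₁ B b w M pot)) (trans eq₁ (height-v₁ B b w M′ pot′)))))

      -- With equal periods, the height functions have equal sums of increments over the torus.
      -- These sums give `movingCount` and `drift`, which determine the sign.
      exponents⇒signParity : exponentsOf M ≡ exponentsOf M′ → Parities.signParity B b w M ≡ Parities.signParity B b w M′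
      exponents⇒signParity eq = signParity-determined B b w M M′
        (ℤ.*-cancelˡ-≡ (+ 4) _ _ (trans (movingCount-height B b w M pot)
          (trans (cong (λ c → ∑.sum {m} (λ _ → + 4) + c)
              (incrementSum-determined B b w {h} {h′} (exponents⇒periodic eq) up hor))
            (sym (movingCount-height B b w M′ pot′)))))
        (ℤ.*-cancelˡ-≡ (+ 4) _ _ (trans (drift-height B b w M pot)
          (trans (incrementSum-determined B b w {h} {h′} (exponents⇒periodic eq) rt ver)
            (sym (drift-height B b w M′ pot′)))))

    vectorOf : TorusTiling L → Vec Domino m
    vectorOf t = Vec.tabulate λ i → domino (at b i) (dir (fieldOf t) (at b i))

    matchingOf : TorusTiling L → Matching B b w
    matchingOf t = matching B b w (fieldOf t)

    matchingOf-≐ : ∀ t → dominoes t ≐ tiles (matchedField B b w (matchingOf t))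
    matchingOf-≐ t =
      (λ { {s , a} d∈ → trans (same s) (∈-fieldOf t d∈) }) ,
      (λ { {s , a} eq → fieldOf-∈ t (trans (sym (same s)) eq) })
      where
      same : dir (matchedField B b w (matchingOf t)) ≗ dir (fieldOf t)
      same = dir-determined B b w (matchedField B b w (matchingOf t)) (fieldOf t)
        λ i → direction-black B b w (matchingOf t) ≈-refl

    vectorOf-cong : ∀ {t u} → dominoes t ≐ dominoes u → vectorOf t ≡ vectorOf u
    vectorOf-cong {t} {u} (_ , u⊆t) = Vec.tabulate-cong λ i → cong (domino (at b i))
      (fieldOf-unique t (at b i) (u⊆t (fieldOf-domino u (at b i))))

    vectorOf-injective : ∀ {t u} → vectorOf t ≡ vectorOf u → dominoes t ≐ dominoes u
    vectorOf-injective {t} {u} eq =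
      (λ { {s , a} d∈ → fieldOf-∈ u (trans (sym (same s)) (∈-fieldOf t d∈)) }) ,
      (λ { {s , a} d∈ → fieldOf-∈ t (trans (same s) (∈-fieldOf u d∈)) })
      where
      same : dir (fieldOf t) ≗ dir (fieldOf u)
      same = dir-determined B b w (fieldOf t) (fieldOf u) λ i → domino-injective (at b i)
        (trans (sym (Vec.lookup∘tabulate _ i)) (trans (cong (λ v → Vec.lookup v i) eq) (Vec.lookup∘tabulate _ i)))

    module Flux (φ : ℚ²) (φ∈ : φ ∈ 𝓕 L) where
      private
        t₀ = proj₁ φ∈
        h₀ = proj₁ (proj₂ φ∈)
        flux₀ = proj₂ (proj₂ (proj₂ φ∈))

        M₀ = matchingOf t₀

        heightPotential : ∀ t {h} → IsHeight (dominoes t) h → IsPotential (matchedField B b w (matchingOf t)) h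
        heightPotential t ht = height⇒potential (matchedField B b w (matchingOf t)) (IsHeight-≐ (matchingOf-≐ t) ht)

        pot₀ : IsPotential (matchedField B b w M₀) h₀
        pot₀ = heightPotential t₀ (proj₁ (proj₂ (proj₂ φ∈)))

        i₀ j₀ : ℤ
        i₀ = exponent B b w M₀ path₀
        j₀ = exponent B b w M₀ path₁

        from-0 : ∀ {t h} → IsHeight t h → ∀ v → h (0ᵛ +ᵛ v) - h 0ᵛ ≡ h v
        from-0 {h = h} ht v = trans
          (cong₂ _-_ (cong h (cong₂ _,_ (ℤ.+-identityˡ _) (ℤ.+-identityˡ _))) (IsHeight.origin ht))
                                    (ℤ.+-identityʳ (h v))

        flux-at : ∀ t ((h , ht , _) : HasFlux L t φ) {v} → v ∈ᴸ L → fromℤ (+ 4) ℚ.* ⟨ φ , v ⟩ ≡ fromℤ (h v)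
        flux-at t (h , ht , flux) {v} v∈L = trans (flux v∈L 0ᵛ) (cong fromℤ (from-0 ht v))

      -- Four times the exponents are the heights at `v₀` and `v₁`, up to the correction by 2 for
      -- odd `v₁`, and these heights are four times the pairings with φ.
      corresponds : CorrespondsTo B φ i₀ j₀
      corresponds = *4-cancel at-v₀ , by-parity (odd (+ x₁)) refl
        where
        at-v₀ : fromℤ (+ 4) ℚ.* fromℤ i₀ ≡ fromℤ (+ 4) ℚ.* ⟨ φ , v₀ ⟩
        at-v₀ = trans (sym (fromℤ-* (+ 4) i₀)) (trans (cong fromℤ (sym (height-v₀ B b w M₀ pot₀)))
          (sym (flux-at t₀ (proj₂ φ∈) x₀-mem)))
        at-v₁ : ∀ {c} → odd (+ x₁) ≡ c → fromℤ (+ 4 * j₀ + ⟦ c ⟧ * + 2) ≡ fromℤ (+ 4) ℚ.* ⟨ φ , v₁ ⟩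
        at-v₁ refl = trans (cong fromℤ (sym (height-v₁ B b w M₀ pot₀))) (sym (flux-at t₀ (proj₂ φ∈) v₁-mem))
        odd-y₁ = ∈ᴸ-parity L v₁-mem
        odd⇒ : ∀ {n} → odd n ≡ true → + 2 ∣ n - 1ℤ
        odd⇒ {n} eq = ¬odd⇒even (trans (odd-+ n -1ℤ) (cong₂ _xor_ eq (trans (odd-neg 1ℤ) odd-1)))
        by-parity : ∀ c → odd (+ x₁) ≡ c → (v₁ ∈ 𝓔 × fromℤ j₀ ≡ ⟨ φ , v₁ ⟩) ⊎ (v₁ ∈ 𝓞 × fromℤ j₀ ≡ ⟨ φ , v₁ ⟩ ℚ.- ½)
        by-parity false eq = inj₁ ((¬odd⇒even eq , ¬odd⇒even (trans (sym odd-y₁) eq)) ,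
          *4-cancel (trans (sym (fromℤ-* (+ 4) j₀)) (trans (cong fromℤ (sym (ℤ.+-identityʳ (+ 4 * j₀)))) (at-v₁ eq))))
        by-parity true  eq = inj₂ ((odd⇒ eq , odd⇒ (trans (sym odd-y₁) eq)) , *4-cancel (sym (begin
          fromℤ (+ 4) ℚ.* (⟨ φ , v₁ ⟩ ℚ.- ½)
            ≡⟨ ℚ.*-distribˡ-+ (fromℤ (+ 4)) ⟨ φ , v₁ ⟩ (ℚ.- ½) ⟩
          fromℤ (+ 4) ℚ.* ⟨ φ , v₁ ⟩ ℚ.+ fromℤ (- + 2)
            ≡⟨ cong (ℚ._+ fromℤ (- + 2)) (sym (at-v₁ eq)) ⟩
          fromℤ (+ 4 * j₀ + + 2) ℚ.+ fromℤ (- + 2)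
            ≡⟨ sym (fromℤ-+ (+ 4 * j₀ + + 2) (- + 2)) ⟩
          fromℤ ((+ 4 * j₀ + + 2) + - + 2)
            ≡⟨ cong fromℤ (cancel (+ 4 * j₀)) ⟩
          fromℤ (+ 4 * j₀)
            ≡⟨ fromℤ-* (+ 4) j₀ ⟩
          fromℤ (+ 4) ℚ.* fromℤ j₀ ∎)))
          where
          open ≡-Reasoning
          cancel : ∀ a → (a + + 2) + - + 2 ≡ a
          cancel = solve-∀

      fluxTerms : List (Term m)
      fluxTerms = filter (exponents? weight (i₀ , j₀)) terms

      private
        fluxTerms-∈⁻ : ∀ {τ} → τ ∈ˡ fluxTerms → τ ∈ˡ terms × termExponents weight τ ≡ (i₀ , j₀)
        fluxTerms-∈⁻ = List.∈-filter⁻ (exponents? weight (i₀ , j₀)) {xs = terms}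

        termField : ∀ {τ} → τ ∈ˡ fluxTerms → Field L
        termField τ∈ = matchedField B b w (termMatching (proj₁ (fluxTerms-∈⁻ τ∈)))

        termMatching-exponents : ∀ {τ} (τ∈ : τ ∈ˡ fluxTerms) →
          exponentsOf (termMatching (proj₁ (fluxTerms-∈⁻ τ∈))) ≡ exponentsOf M₀
        termMatching-exponents {τ} τ∈ = trans
          (sym (cong proj₂ (termMonomial-matching (termMatching (proj₁ (fluxTerms-∈⁻ τ∈))) (proj₁ τ) (proj₂ τ)
            (termMatching-placed (proj₁ (fluxTerms-∈⁻ τ∈))))))
          (proj₂ (fluxTerms-∈⁻ τ∈))

      -- Every term with these exponents is compared with the matching of the one tiling that
      -- witnesses `φ∈`.
      fluxTerms-sign : ∀ {τ} → τ ∈ˡ fluxTerms → proj₁ (termMonomial weight τ) ≡ parityOf (Parities.signParity B b w M₀)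
      fluxTerms-sign {τ} τ∈ = trans
        (cong proj₁ (termMonomial-matching M (proj₁ τ) (proj₂ τ) (termMatching-placed (proj₁ (fluxTerms-∈⁻ τ∈)))))
        (cong parityOf (exponents⇒signParity M M₀ (potential (termField τ∈)) h₀
          (potential-isPotential (termField τ∈)) pot₀ (termMatching-exponents τ∈)))
        where
        M = termMatching (proj₁ (fluxTerms-∈⁻ τ∈))

      coeff-count : ∣ coeff (det laurentRing (kasteleyn B b w)) i₀ j₀ ∣ ≡ length fluxTerms
      coeff-count = trans
        (cong ∣_∣ (coeff-det weight choices i₀ j₀ (parityOf (Parities.signParity B b w M₀)) fluxTerms-sign))
        (unsign (Parities.signParity B b w M₀))
        where
        n = length fluxTerms
        unsign : ∀ c → ∣ + n * parityOf c ∣ ≡ n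
        unsign c = trans (ℤ.abs-* (+ n) (parityOf c)) (trans (cong (n ℕ.*_) (∣parity∣ c)) (ℕ.*-identityʳ n))
          where
          ∣parity∣ : ∀ c → ∣ parityOf c ∣ ≡ 1
          ∣parity∣ true  = refl
          ∣parity∣ false = refl

      private
        Tilings = tilingsWithFlux L φ
        open Setoid Tilings using (Carrier) renaming (_≈_ to _≈ᵗ_)

        vector : Carrier → Vec Domino m
        vector = vectorOf ∘ proj₁

        vectorOf-placed : ∀ t i → Vec.lookup (vectorOf t) i ≡ placed B b w (matchingOf t) i
        vectorOf-placed t i = Vec.lookup∘tabulate (λ i → domino (at b i) (dir (fieldOf t) (at b i))) i

        opaque
          listed : TorusTiling L → Permutation′ m
          listed t = proj₁ (permutations-complete (perm (matchingOf t)))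

          termOf-∈ : ∀ t → (listed t , vectorOf t) ∈ˡ terms
          termOf-∈ t = matching-∈-terms (matchingOf t) (permutations-complete (perm (matchingOf t)))
            (vectorOf t) (vectorOf-placed t)

        termOf : TorusTiling L → Term m
        termOf t = listed t , vectorOf t

        termOf-exponents : ∀ t → HasFlux L t φ → termExponents weight (termOf t) ≡ (i₀ , j₀)
        termOf-exponents t hf@(h , ht , flux) = trans
          (cong proj₂ (termMonomial-matching (matchingOf t) (listed t) (vectorOf t) (vectorOf-placed t)))
          (periodic⇒exponents (matchingOf t) M₀ h h₀ (heightPotential t ht) pot₀ (same x₀-mem) (same v₁-mem))
          where
          same : ∀ {v} → v ∈ᴸ L → h v ≡ h₀ v
          same v∈L = fromℤ-injective (trans (sym (flux-at t hf v∈L)) (flux-at t₀ (proj₂ φ∈) v∈L))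

        termOf-∈-fluxTerms : (t : Carrier) → termOf (proj₁ t) ∈ˡ fluxTerms
        termOf-∈-fluxTerms (t , hf) =
          List.∈-filter⁺ (exponents? weight (i₀ , j₀)) {xs = terms} (termOf-∈ t) (termOf-exponents t hf)

        to : Carrier → Fin (length fluxTerms)
        to t = Any.index (termOf-∈-fluxTerms t)

        lookup-to : ∀ t → proj₂ (lookup fluxTerms (to t)) ≡ vector t
        lookup-to t = cong proj₂ (sym (Any.lookup-index (termOf-∈-fluxTerms t)))

        -- The tiling gets its flux from the reference tiling: equal exponents give equal periods of
        -- the potentials.
        fromTerm : ∀ {τ} → τ ∈ˡ fluxTerms → Carrier
        fromTerm τ∈ = tiling F , potential F , potential⇒height F (potential-isPotential F) ,
          λ {v} v∈L u → trans (flux₀ v∈L u) (cong fromℤ (sym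
            (exponents⇒periodic M M₀ (potential F) h₀ (potential-isPotential F) pot₀ (termMatching-exponents τ∈) v∈L u)))
          where
          M = termMatching (proj₁ (fluxTerms-∈⁻ τ∈))
          F = termField τ∈

        vector-fromTerm : ∀ {τ} (τ∈ : τ ∈ˡ fluxTerms) → vector (fromTerm τ∈) ≡ proj₂ τ
        vector-fromTerm {τ} τ∈ = trans (Vec.tabulate-cong λ i → trans
            (cong (domino (at b i)) (trans
              (fieldOf-unique (tiling F) (at b i) (Field.∈-tiles F refl))
              (direction-black B b w M ≈-refl)))
            (sym (termMatching-placed (proj₁ (fluxTerms-∈⁻ τ∈)) i)))
          (Vec.tabulate∘lookup (proj₂ τ))
          where
          M = termMatching (proj₁ (fluxTerms-∈⁻ τ∈))
          F = termField τ∈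

        from : Fin (length fluxTerms) → Carrier
        from k = fromTerm (List.∈-lookup {xs = fluxTerms} k)

        -- Positions in the list of terms are identified by the vector of placed dominoes, which a
        -- tiling determines and by which it is determined.
        fluxTerms-injective : ∀ k l → proj₂ (lookup fluxTerms k) ≡ proj₂ (lookup fluxTerms l) → k ≡ l
        fluxTerms-injective = lookup-injective proj₂ (AllPairs.filter⁺ (exponents? weight (i₀ , j₀))
          (expansion-unique choices choices-unique choices-column))

      tilings↔terms : HasCardinality Tilings (length fluxTerms)
      tilings↔terms = record
        { to        = to
        ; from      = from
        ; to-cong   = λ {t} {u} t≈u → fluxTerms-injective (to t) (to u)
            (trans (lookup-to t) (trans (vectorOf-cong {proj₁ t} {proj₁ u} t≈u) (sym (lookup-to u))))
        ; from-cong = λ { {k} refl → Setoid.refl Tilings {from k} }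
        ; inverse   =
            (λ {k} {t} t≈ → fluxTerms-injective (to t) k (trans (lookup-to t)
              (trans (vectorOf-cong {proj₁ t} {proj₁ (from k)} t≈) (vector-fromTerm (List.∈-lookup {xs = fluxTerms} k))))) ,
            (λ {t} {k} k≡ → vectorOf-injective {proj₁ (from k)} {proj₁ t}
              (trans (vector-fromTerm (List.∈-lookup {xs = fluxTerms} k))
                (trans (cong (proj₂ ∘ lookup fluxTerms) k≡) (lookup-to t))))
        }

proposition7p0p2 :
    (L : ValidLattice) (B : ReducedBasis L) → let open ReducedBasis B in
    ∀ {m} (b : Enumeration BlackDomain m) (w : Enumeration WhiteDomain m) →
    ∀ φ → φ ∈ 𝓕 L →
    ∃₂ λ i j → CorrespondsTo B φ i j ×
    HasCardinality (tilingsWithFlux L φ) ∣ coeff (det laurentRing (kasteleyn B b w)) i j ∣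
-- The exponents i and j are those of the tiling that witnesses `φ∈`.
proposition7p0p2 L B b w φ φ∈ = _ , _ , corresponds ,
  subst (HasCardinality (tilingsWithFlux L φ)) (sym coeff-count) tilings↔terms
  where open Count.Flux B b w φ φ∈
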